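{- Let $p$ be a prime and let $\overline{E}_p(x)\in\mathbb{F}_p[[x]]$ be the reduction modulo $p$ of the Artin–Hasse exponential $E_p(x)=\exp\left(\sum_{n\ge 0} x^{p^n}/p^n\right)\in\mathbb{Z}_{(p)}[[x]]$. Then $\overline{E}_p(x)$ is transcendental over $\mathbb{F}_p[x]$.
   Context: The Artin–Hasse exponential $E_p(x)=\exp\left(\sum_{n=0}^\infty \frac{x^{p^n}}{p^n}\right)$ has coefficients in $\mathbb{Z}_{(p)}$, so its coefficientwise reduction modulo $p$ is a well-defined element $\overline{E}_p(x)$ of $\mathbb{F}_p[[x]]$. -}

module Defs where

open import Data.Bool using (if_then_else_)
open import Data.Nat as ℕ using (ℕ; zero; suc; _∸_; _^_; _!; _≡ᵇ_; _≤ᵇ_)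
open import Data.Integer as ℤ using (ℤ; +_)
open import Data.Integer.Divisibility as ℤD using ()
open import Data.Rational as ℚ using (ℚ; 0ℚ; 1ℚ; ↥_; ↧_)

-- Formal power series are represented by coefficient functions ℕ → A.

sumℚ : ℕ → (ℕ → ℚ) → ℚ
sumℚ zero    h = 0ℚ
sumℚ (suc m) h = sumℚ m h ℚ.+ h m

sumℕ : ℕ → (ℕ → ℕ) → ℕ
sumℕ zero    h = 0
sumℕ (suc m) h = sumℕ m h ℕ.+ h m

-- 1/m as a rational number (only used for m ≠ 0; total by setting 1/0 = 0)
invNat : ℕ → ℚ
invNat zero    = 0ℚ
invNat (suc k) = + 1 ℚ./ suc k

convℚ : (ℕ → ℚ) → (ℕ → ℚ) → ℕ → ℚ
convℚ f g n = sumℚ (suc n) (λ i → f i ℚ.* g (n ∸ i))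

powℚ : (ℕ → ℚ) → ℕ → ℕ → ℚ
powℚ f zero    zero    = 1ℚ
powℚ f zero    (suc n) = 0ℚ
powℚ f (suc k) n       = convℚ f (powℚ f k) n

-- S_p(x) = Σ_{k ≥ 0} x^{p^k} / p^k  : coefficient of x^m is the sum over
-- those k with p^k = m of 1/p^k (only k ≤ m can occur).
AHlog : ℕ → ℕ → ℚ
AHlog p m = sumℚ (suc m) (λ k → if (p ^ k) ≡ᵇ m then invNat (p ^ k) else 0ℚ)

-- Artin–Hasse exponential E_p(x) = exp(S_p(x)) = Σ_k S_p(x)^k / k!.
-- Since S_p has zero constant term, only k ≤ n contribute to x^n.
artinHasse : ℕ → ℕ → ℚ
artinHasse p n = sumℚ (suc n) (λ k → powℚ (AHlog p) k n ℚ.* invNat (k !))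

-- Reduction mod p.  𝔽_p is modelled by ℕ with equality "congruent mod p".
-- e : ℕ → ℕ is a coefficientwise reduction of E_p mod p iff for each n,
-- writing E_p coefficient a_n = u/v (lowest terms), p ∣ u - e(n)·v,
-- i.e. e(n) ≡ u · v⁻¹ (mod p).
IsReductionOfAH : ℕ → (ℕ → ℕ) → Set
IsReductionOfAH p e =
  ∀ n → (+ p) ℤD.∣ ((↥ artinHasse p n) ℤ.- (+ e n) ℤ.* (↧ artinHasse p n))

-- Power series arithmetic over ℕ (reduced mod p afterwards: ℕ → 𝔽_p is a ring map)
convℕ : (ℕ → ℕ) → (ℕ → ℕ) → ℕ → ℕ
convℕ f g n = sumℕ (suc n) (λ i → f i ℕ.* g (n ∸ i))

powℕ : (ℕ → ℕ) → ℕ → ℕ → ℕ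
powℕ f zero    zero    = 1
powℕ f zero    (suc n) = 0
powℕ f (suc k) n       = convℕ f (powℕ f k) n

shiftℕ : ℕ → (ℕ → ℕ) → ℕ → ℕ
shiftℕ i f n = if i ≤ᵇ n then f (n ∸ i) else 0

evalPolyCoeff : ℕ → ℕ → (ℕ → ℕ → ℕ) → (ℕ → ℕ) → ℕ → ℕ
evalPolyCoeff dx dy c f n =
  sumℕ (suc dx) (λ i → sumℕ (suc dy) (λ j → c i j ℕ.* shiftℕ i (powℕ f j) n))

{-# OPTIONS --safe #-}
-- The logarithmic derivative of the Artin–Hasse exponential E is S = ∑ xᵖᵏ, and S is lacunary: a relation
-- ∑ Cⱼ(x) Sʲ ≡ 0 of degree d can hold modulo pᴹ only if all its coefficients are divisible by p, once M is large
-- compared to d.  So it suffices to turn a relation for E modulo p, of minimal degree d, into a relation of degree d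
-- for S modulo a high power of p.  Put V = Eᵖ, so that Vᵖ = exp(p²x) σ(V) with σ : x ↦ xᵖ.
--   * If v satisfies a relation modulo pⁿ, then vᵖ satisfies one of the same degree modulo pⁿ⁺¹; it comes from
--     a linear dependence between the reductions of 1, vᵖ, v²ᵖ, … modulo the relation of v.
--   * Hence V^(pᴹ) satisfies a relation of degree d modulo pᴹ⁺¹, and as V^(pᴹ) is a polynomial times σᴹ(V)
--     modulo pᴹ⁺¹, the sections of that relation are relations for V modulo pᴹ⁺¹.
--   * Differentiating such a relation expresses p S as a quotient of polynomials in V, and a second linear dependence
--     yields a relation of degree d for p S.
module Submission where

open import Defs
open import Algebra.Bundles using (CommutativeRing)
open import Algebra.Structures using (IsCommutativeRing)
import Algebra.Properties.Ring as RingProperties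
import Algebra.Solver.Ring.NaturalCoefficients.Default as NatSolver
open import Data.Bool using (true; false; if_then_else_)
open import Data.Empty using (⊥; ⊥-elim)
import Data.Empty.Irrelevant as Irrelevant
open import Data.Fin as Fin using (Fin; toℕ; fromℕ<; punchIn; punchOut)
import Data.Fin.Properties as FinP
open import Data.Integer as ℤ using (ℤ; +_; 0ℤ; 1ℤ)
import Data.Integer.Properties as ℤP
open import Data.Integer.Divisibility.Signed as ℤ∣ using (divides)
open import Data.Integer.Tactic.RingSolver using (solve-∀)
open import Data.Nat as ℕ using (ℕ; zero; suc; z≤n; s≤s; NonZero; _!; _≤_)
import Data.Nat.Properties as ℕP
open import Data.Nat.Coprimality as Coprimality using (Coprime)
open import Data.Nat.DivMod using (_/_; _%_; m≡m%n+[m/n]*n; m%n<n; [m+kn]%n≡m%n; m<n⇒m%n≡m; +-distrib-/-∣ʳ; m*n/n≡m; m<n⇒m/n≡0; m/n<m; 0/n≡0)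
open import Data.Nat.Divisibility as ℕ∣ using (_∣_; n∣m*n; ∣m+n∣m⇒∣n; ∣-refl; ∣⇒≤)
open import Data.Nat.GCD using (module Bézout)
open import Data.Nat.Induction using (<-wellFounded)
open import Data.Nat.Primality using (Prime; prime⇒nonZero; prime⇒nonTrivial; prime⇒irreducible; euclidsLemma)
open import Data.Product using (Σ; ∃; _×_; _,_; proj₁; proj₂)
open import Data.Rational as ℚ using (ℚ; mkℚ; 0ℚ; 1ℚ; ↥_; ↧_)
import Data.Rational.Properties as ℚP
import Data.Rational.Unnormalised as ℚᵘ
import Data.Rational.Unnormalised.Properties as ℚᵘP
open import Data.Sum as Sum using (_⊎_; inj₁; inj₂)
open import Function using (_∘_)
open import Induction.WellFounded using (Acc; acc)
open import Level using (0ℓ)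
open import Relation.Nullary using (¬_; Dec; yes; no)
import Relation.Nullary.Decidable as Dec
open import Relation.Binary.PropositionalEquality as ≡ using (_≡_)
import Relation.Binary.Reasoning.Setoid as SetoidReasoning

-- Modulo p itself there is no contradiction to be had from S: there σ S ≡ Sᵖ, so S = x + σ S
-- becomes the Artin-Schreier equation Sᵖ - S + x ≡ 0 and S is algebraic. Only modulo higher powers
-- of p do the relations of a given degree disappear, and the exponent needed grows with that
-- degree. This is why every transfer of a relation has to preserve the degree: `M` is fixed from d
-- in advance, and M successive p-th powers are taken afterwards. Minimality of d is used through
-- separability: the derivative of a minimal relation is nonzero modulo p at the series in question,
-- so it can be cancelled. The code runs in the contrapositive direction, from independence of p S
-- to independence of V and then of E. Relations have polynomial coefficients over the integers
-- throughout; they are never divided by a leading coefficient, only multiplied by polynomials that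
-- are nonzero modulo p.

-- Finite sums, polynomial evaluation and translation over a commutative ring.

-- The operations are defined from raw ones, so that series over ℤ are
-- literally the same for all the congruences modulo N put on ℤ.
module RingOps {A : Set} (_+_ _*_ : A → A → A) (0# 1# : A) where

  pow : A → ℕ → A
  pow x zero    = 1#
  pow x (suc n) = x * pow x n

  mul : ℕ → A → A
  mul zero    x = 0#
  mul (suc n) x = x + mul n x

  ∑ : ℕ → (ℕ → A) → A
  ∑ zero    f = 0#
  ∑ (suc n) f = f 0 + ∑ n (f ∘ suc)

  eval : ℕ → (ℕ → A) → A → A
  eval zero    a y = 0#
  eval (suc n) a y = a 0 + (y * eval n (a ∘ suc) y)

  derivative : (ℕ → A) → ℕ → A
  derivative a j = mul (suc j) (a (suc j))

  cons : A → (ℕ → A) → ℕ → A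
  cons x a zero    = x
  cons x a (suc j) = a j

  -- Coefficients of a (x + y) as a polynomial in y.
  translate : A → ℕ → (ℕ → A) → ℕ → A
  translate x zero    a j       = 0#
  translate x (suc n) a zero    = a 0 + (x * translate x n (a ∘ suc) 0)
  translate x (suc n) a (suc j) = (x * translate x n (a ∘ suc) (suc j)) + translate x n (a ∘ suc) j

module SeriesOps {A : Set} (_+_ _*_ : A → A → A) (-_ : A → A) (0# 1# : A) where
  open RingOps _+_ _*_ 0# 1# using (mul)

  infixl 6 _⊕_
  infixl 7 _⊛_
  infix  8 ⊝_

  _⊕_ : (ℕ → A) → (ℕ → A) → ℕ → A
  (f ⊕ g) n = f n + g n

  ⊝_ : (ℕ → A) → ℕ → A
  (⊝ f) n = - f n

  const : A → ℕ → A
  const c zero    = c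
  const c (suc n) = 0#

  𝟘 𝟙 : ℕ → A
  𝟘 n = 0#
  𝟙   = const 1#

  tail : (ℕ → A) → ℕ → A
  tail f n = f (suc n)

  _⊛_ : (ℕ → A) → (ℕ → A) → ℕ → A
  (f ⊛ g) zero    = f 0 * g 0
  (f ⊛ g) (suc n) = (f 0 * g (suc n)) + (tail f ⊛ g) n

  shift : (ℕ → A) → ℕ → A
  shift f zero    = 0#
  shift f (suc n) = f n

  shifts : ℕ → (ℕ → A) → ℕ → A
  shifts zero    f = f
  shifts (suc m) f = shift (shifts m f)

  X : ℕ → A
  X = shift 𝟙

  -- The derivation x d/dx. It moves no exponents, so it commutes with x ↦ xᵖ up to the factor p.
  θ : (ℕ → A) → ℕ → A
  θ f n = mul n (f n)

module RingLaws (R : CommutativeRing 0ℓ 0ℓ) where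
  open CommutativeRing R hiding (zero)
  open RingOps _+_ _*_ 0# 1# public
  open NatSolver commutativeSemiring using (solve; _:=_; _:+_; _:*_; con)
  open SetoidReasoning setoid

  +-interchange : ∀ a b c d → (a + b) + (c + d) ≈ (a + c) + (b + d)
  +-interchange = solve 4 (λ a b c d → ((a :+ b) :+ (c :+ d)) := ((a :+ c) :+ (b :+ d))) refl

  *-interchange : ∀ a b c d → (a * b) * (c * d) ≈ (a * c) * (b * d)
  *-interchange = solve 4 (λ a b c d → ((a :* b) :* (c :* d)) := ((a :* c) :* (b :* d))) refl

  *-leftComm : ∀ a b c → a * (b * c) ≈ b * (a * c)
  *-leftComm = solve 3 (λ a b c → (a :* (b :* c)) := (b :* (a :* c))) refl

  x+[y-x]≈y : ∀ x y → x + (y - x) ≈ y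
  x+[y-x]≈y x y = begin
    x + (y - x)   ≈⟨ +-congˡ (+-comm y (- x)) ⟩
    x + (- x + y) ≈⟨ +-assoc x (- x) y ⟨
    (x - x) + y   ≈⟨ +-congʳ (-‿inverseʳ x) ⟩
    0# + y        ≈⟨ +-identityˡ y ⟩
    y ∎

  +-cancelˡ : ∀ x {y z} → x + y ≈ x + z → y ≈ z
  +-cancelˡ x {y} {z} eq = begin
    y             ≈⟨ lem y ⟨
    - x + (x + y) ≈⟨ +-congˡ eq ⟩
    - x + (x + z) ≈⟨ lem z ⟩
    z ∎
    where
    lem : ∀ w → - x + (x + w) ≈ w
    lem w = trans (sym (+-assoc (- x) x w)) (trans (+-congʳ (-‿inverseˡ x)) (+-identityˡ w))

  pow-cong : ∀ {x y} n → x ≈ y → pow x n ≈ pow y n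
  pow-cong zero    eq = refl
  pow-cong (suc n) eq = *-cong eq (pow-cong n eq)

  pow-+ : ∀ x m n → pow x (m ℕ.+ n) ≈ pow x m * pow x n
  pow-+ x zero    n = sym (*-identityˡ _)
  pow-+ x (suc m) n = trans (*-congˡ (pow-+ x m n)) (sym (*-assoc _ _ _))

  pow-* : ∀ x m n → pow x (m ℕ.* n) ≈ pow (pow x n) m
  pow-* x zero    n = refl
  pow-* x (suc m) n = trans (pow-+ x n (m ℕ.* n)) (*-congˡ (pow-* x m n))

  pow-distrib-* : ∀ x y n → pow (x * y) n ≈ pow x n * pow y n
  pow-distrib-* x y zero    = sym (*-identityˡ _)
  pow-distrib-* x y (suc n) = trans (*-congˡ (pow-distrib-* x y n)) (*-interchange x y _ _)

  mul-cong : ∀ {x y} n → x ≈ y → mul n x ≈ mul n y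
  mul-cong zero    eq = refl
  mul-cong (suc n) eq = +-cong eq (mul-cong n eq)

  mul-0# : ∀ n → mul n 0# ≈ 0#
  mul-0# zero    = refl
  mul-0# (suc n) = trans (+-identityˡ _) (mul-0# n)

  mul-distrib-+ : ∀ n x y → mul n (x + y) ≈ mul n x + mul n y
  mul-distrib-+ zero    x y = sym (+-identityˡ _)
  mul-distrib-+ (suc n) x y = trans (+-congˡ (mul-distrib-+ n x y)) (+-interchange x y _ _)

  mul-*ˡ : ∀ n x y → mul n (x * y) ≈ mul n x * y
  mul-*ˡ zero    x y = sym (zeroˡ y)
  mul-*ˡ (suc n) x y = trans (+-congˡ (mul-*ˡ n x y)) (sym (distribʳ y x _))

  mul-*ʳ : ∀ n x y → mul n (x * y) ≈ x * mul n y
  mul-*ʳ n x y = begin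
    mul n (x * y) ≈⟨ mul-cong n (*-comm x y) ⟩
    mul n (y * x) ≈⟨ mul-*ˡ n y x ⟩
    mul n y * x   ≈⟨ *-comm _ x ⟩
    x * mul n y   ∎

  mul-assoc-+ : ∀ m n x → mul (m ℕ.+ n) x ≈ mul m x + mul n x
  mul-assoc-+ zero    n x = sym (+-identityˡ _)
  mul-assoc-+ (suc m) n x = trans (+-congˡ (mul-assoc-+ m n x)) (sym (+-assoc _ _ _))

  mul-assoc-* : ∀ m n x → mul (m ℕ.* n) x ≈ mul m (mul n x)
  mul-assoc-* zero    n x = refl
  mul-assoc-* (suc m) n x = trans (mul-assoc-+ n (m ℕ.* n) x) (+-congˡ (mul-assoc-* m n x))

  ∑-cong : ∀ n {f g} → (∀ i → i ℕ.< n → f i ≈ g i) → ∑ n f ≈ ∑ n g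
  ∑-cong zero    eq = refl
  ∑-cong (suc n) eq = +-cong (eq 0 (s≤s z≤n)) (∑-cong n (λ i i<n → eq (suc i) (s≤s i<n)))

  ∑-zero : ∀ n {f} → (∀ i → i ℕ.< n → f i ≈ 0#) → ∑ n f ≈ 0#
  ∑-zero zero    eq = refl
  ∑-zero (suc n) eq = trans (+-cong (eq 0 (s≤s z≤n)) (∑-zero n (λ i i<n → eq (suc i) (s≤s i<n)))) (+-identityˡ _)

  ∑-+ : ∀ n f g → ∑ n (λ i → f i + g i) ≈ ∑ n f + ∑ n g
  ∑-+ zero    f g = sym (+-identityˡ _)
  ∑-+ (suc n) f g = trans (+-congˡ (∑-+ n _ _)) (+-interchange _ _ _ _)

  ∑-*ˡ : ∀ n x f → x * ∑ n f ≈ ∑ n (λ i → x * f i)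
  ∑-*ˡ zero    x f = zeroʳ x
  ∑-*ˡ (suc n) x f = trans (distribˡ x _ _) (+-congˡ (∑-*ˡ n x _))

  ∑-*ʳ : ∀ n x f → ∑ n f * x ≈ ∑ n (λ i → f i * x)
  ∑-*ʳ zero    x f = zeroˡ x
  ∑-*ʳ (suc n) x f = trans (distribʳ x _ _) (+-congˡ (∑-*ʳ n x _))

  mul-∑ : ∀ n K f → mul n (∑ K f) ≈ ∑ K (λ k → mul n (f k))
  mul-∑ n zero    f = mul-0# n
  mul-∑ n (suc K) f = trans (mul-distrib-+ n _ _) (+-congˡ (mul-∑ n K (f ∘ suc)))

  ∑-last : ∀ n f → ∑ (suc n) f ≈ ∑ n f + f n
  ∑-last zero    f = +-comm _ _
  ∑-last (suc n) f = trans (+-congˡ (∑-last n (f ∘ suc))) (sym (+-assoc _ _ _))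

  ∑-comm : ∀ m n (f : ℕ → ℕ → Carrier) → ∑ m (λ i → ∑ n (f i)) ≈ ∑ n (λ j → ∑ m (λ i → f i j))
  ∑-comm zero    n f = sym (∑-zero n (λ _ _ → refl))
  ∑-comm (suc m) n f = trans (+-congˡ (∑-comm m n (f ∘ suc))) (sym (∑-+ n _ _))

  eval-cong : ∀ n {a b x y} → (∀ j → j ℕ.< n → a j ≈ b j) → x ≈ y → eval n a x ≈ eval n b y
  eval-cong zero    eq x≈y = refl
  eval-cong (suc n) eq x≈y =
    +-cong (eq 0 (s≤s z≤n)) (*-cong x≈y (eval-cong n (λ j j<n → eq (suc j) (s≤s j<n)) x≈y))

  eval-congʳ : ∀ n a {x y} → x ≈ y → eval n a x ≈ eval n a y
  eval-congʳ n a x≈y = eval-cong n (λ _ _ → refl) x≈y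

  eval-zero : ∀ n {a} x → (∀ j → j ℕ.< n → a j ≈ 0#) → eval n a x ≈ 0#
  eval-zero zero    x eq = refl
  eval-zero (suc n) x eq = begin
    _ + x * _   ≈⟨ +-cong (eq 0 (s≤s z≤n)) (*-congˡ (eval-zero n x (λ j j<n → eq (suc j) (s≤s j<n)))) ⟩
    0# + x * 0# ≈⟨ trans (+-identityˡ _) (zeroʳ x) ⟩
    0#          ∎

  eval-+ : ∀ n a b x → eval n (λ j → a j + b j) x ≈ eval n a x + eval n b x
  eval-+ zero    a b x = sym (+-identityˡ _)
  eval-+ (suc n) a b x = begin
    (a 0 + b 0) + x * eval n _ x                                    ≈⟨ +-congˡ (*-congˡ (eval-+ n _ _ x)) ⟩
    (a 0 + b 0) + x * (eval n (a ∘ suc) x + eval n (b ∘ suc) x)     ≈⟨ +-congˡ (distribˡ x _ _) ⟩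
    (a 0 + b 0) + (x * eval n (a ∘ suc) x + x * eval n (b ∘ suc) x) ≈⟨ +-interchange _ _ _ _ ⟩
    (a 0 + x * eval n (a ∘ suc) x) + (b 0 + x * eval n (b ∘ suc) x) ∎

  eval-*ˡ : ∀ n c a x → eval n (λ j → c * a j) x ≈ c * eval n a x
  eval-*ˡ zero    c a x = sym (zeroʳ c)
  eval-*ˡ (suc n) c a x = begin
    c * a 0 + x * eval n _ x             ≈⟨ +-congˡ (*-congˡ (eval-*ˡ n c _ x)) ⟩
    c * a 0 + x * (c * eval n (a ∘ suc) x) ≈⟨ +-congˡ (*-leftComm x c _) ⟩
    c * a 0 + c * (x * eval n (a ∘ suc) x) ≈⟨ distribˡ c _ _ ⟨
    c * (a 0 + x * eval n (a ∘ suc) x)   ∎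

  eval-last : ∀ n a x → eval (suc n) a x ≈ eval n a x + a n * pow x n
  eval-last zero a x = begin
    a 0 + x * 0#   ≈⟨ +-congˡ (zeroʳ x) ⟩
    a 0 + 0#       ≈⟨ +-comm _ _ ⟩
    0# + a 0       ≈⟨ +-congˡ (*-identityʳ _) ⟨
    0# + a 0 * 1#  ∎
  eval-last (suc n) a x = begin
    a 0 + x * eval (suc n) (a ∘ suc) x                        ≈⟨ +-congˡ (*-congˡ (eval-last n (a ∘ suc) x)) ⟩
    a 0 + x * (eval n (a ∘ suc) x + a (suc n) * pow x n)
      ≈⟨ solve 5 (λ a0 x e an pn → (a0 :+ x :* (e :+ an :* pn)) := ((a0 :+ x :* e) :+ an :* (x :* pn))) refl
           (a 0) x (eval n (a ∘ suc) x) (a (suc n)) (pow x n) ⟩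
    (a 0 + x * eval n (a ∘ suc) x) + a (suc n) * (x * pow x n) ∎

  eval-∑ : ∀ n a x → eval n a x ≈ ∑ n (λ j → a j * pow x j)
  eval-∑ zero    a x = refl
  eval-∑ (suc n) a x = +-cong (sym (*-identityʳ _)) (begin
    x * eval n (a ∘ suc) x                   ≈⟨ *-congˡ (eval-∑ n (a ∘ suc) x) ⟩
    x * ∑ n (λ j → a (suc j) * pow x j)      ≈⟨ ∑-*ˡ n x _ ⟩
    ∑ n (λ j → x * (a (suc j) * pow x j))    ≈⟨ ∑-cong n (λ j _ → *-leftComm x _ _) ⟩
    ∑ n (λ j → a (suc j) * (x * pow x j))    ∎)

  eval-split : ∀ m n a x → eval (m ℕ.+ n) a x ≈ eval m a x + pow x m * eval n (λ j → a (m ℕ.+ j)) x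
  eval-split zero    n a x = sym (trans (+-identityˡ _) (*-identityˡ _))
  eval-split (suc m) n a x = begin
    a 0 + x * eval (m ℕ.+ n) (a ∘ suc) x
      ≈⟨ +-congˡ (*-congˡ (eval-split m n (a ∘ suc) x)) ⟩
    a 0 + x * (eval m (a ∘ suc) x + pow x m * eval n (λ j → a (suc m ℕ.+ j)) x)
      ≈⟨ solve 5 (λ a0 x e p f → (a0 :+ x :* (e :+ p :* f)) := ((a0 :+ x :* e) :+ (x :* p) :* f)) refl _ x _ _ _ ⟩
    (a 0 + x * eval m (a ∘ suc) x) + (x * pow x m) * eval n (λ j → a (suc m ℕ.+ j)) x ∎

  eval-scale : ∀ n a z x → eval n a (z * x) ≈ eval n (λ j → a j * pow z j) x
  eval-scale n a z x = begin
    eval n a (z * x)                          ≈⟨ eval-∑ n a _ ⟩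
    ∑ n (λ j → a j * pow (z * x) j)           ≈⟨ ∑-cong n (λ j _ → trans (*-congˡ (pow-distrib-* z x j)) (sym (*-assoc _ _ _))) ⟩
    ∑ n (λ j → (a j * pow z j) * pow x j)     ≈⟨ eval-∑ n _ x ⟨
    eval n (λ j → a j * pow z j) x            ∎

  ∑-eval : ∀ m n (C : ℕ → Carrier) (a : ℕ → ℕ → Carrier) x →
           ∑ m (λ i → C i * eval n (a i) x) ≈ eval n (λ j → ∑ m (λ i → C i * a i j)) x
  ∑-eval zero    n C a x = sym (eval-zero n x (λ _ _ → refl))
  ∑-eval (suc m) n C a x = begin
    C 0 * eval n (a 0) x + ∑ m _                    ≈⟨ +-cong (sym (eval-*ˡ n _ _ x)) (∑-eval m n (C ∘ suc) (a ∘ suc) x) ⟩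
    eval n (λ j → C 0 * a 0 j) x + eval n _ x       ≈⟨ eval-+ n _ _ x ⟨
    eval n _ x ∎

  eval-derivative : ∀ n a x →
    eval (suc n) (derivative a) x ≈ eval (suc n) (a ∘ suc) x + x * eval n (derivative (a ∘ suc)) x
  eval-derivative n a x =
    trans (eval-+ (suc n) (a ∘ suc) (λ j → mul j (a (suc j))) x) (+-congˡ (+-identityˡ _))

  -- All terms beyond the first order carry `h * h`. The increment will be p^(n+1) modulo p^(n+2).
  eval-taylor : ∀ n a x h → h * h ≈ 0# → eval (suc n) a (x + h) ≈ eval (suc n) a x + h * eval n (derivative a) x
  eval-taylor zero a x h h²≈0 = begin
    a 0 + (x + h) * 0#         ≈⟨ +-congˡ (trans (zeroʳ _) (sym (zeroʳ x))) ⟩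
    a 0 + x * 0#               ≈⟨ +-identityʳ _ ⟨
    a 0 + x * 0# + 0#          ≈⟨ +-congˡ (zeroʳ h) ⟨
    a 0 + x * 0# + h * 0#      ∎
  eval-taylor (suc n) a x h h²≈0 = begin
    a 0 + (x + h) * eval (suc n) (a ∘ suc) (x + h)
      ≈⟨ +-congˡ (*-congˡ (eval-taylor n (a ∘ suc) x h h²≈0)) ⟩
    a 0 + (x + h) * (E + h * D)
      ≈⟨ solve 5 (λ a x h e d → (a :+ (x :+ h) :* (e :+ h :* d)) := ((a :+ x :* e) :+ h :* (e :+ x :* d) :+ (h :* h) :* d))
           refl (a 0) x h E D ⟩
    (a 0 + x * E) + h * (E + x * D) + (h * h) * D
      ≈⟨ +-cong (+-congˡ (*-congˡ (sym (eval-derivative n a x)))) (trans (*-congʳ h²≈0) (zeroˡ D)) ⟩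
    (a 0 + x * E) + h * eval (suc n) (derivative a) x + 0#
      ≈⟨ +-identityʳ _ ⟩
    (a 0 + x * E) + h * eval (suc n) (derivative a) x ∎
    where
    E = eval (suc n) (a ∘ suc) x
    D = eval n (derivative (a ∘ suc)) x

  pow-taylor : ∀ n x h → h * h ≈ 0# → pow (x + h) (suc n) ≈ pow x (suc n) + h * mul (suc n) (pow x n)
  pow-taylor zero x h h²≈0 =
    solve 2 (λ x h → ((x :+ h) :* con 1) := (x :* con 1 :+ h :* (con 1 :+ con 0))) refl x h
  pow-taylor (suc n) x h h²≈0 = begin
    (x + h) * pow (x + h) (suc n)
      ≈⟨ *-congˡ (pow-taylor n x h h²≈0) ⟩
    (x + h) * (pow x (suc n) + h * m)
      ≈⟨ solve 4 (λ x h p m → ((x :+ h) :* (p :+ h :* m)) := (x :* p :+ h :* (p :+ x :* m) :+ (h :* h) :* m)) refl x h (pow x (suc n)) m ⟩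
    x * pow x (suc n) + h * (pow x (suc n) + x * m) + (h * h) * m
      ≈⟨ +-cong (+-congˡ (*-congˡ (+-congˡ (sym (mul-*ʳ (suc n) x (pow x n)))))) (trans (*-congʳ h²≈0) (zeroˡ m)) ⟩
    x * pow x (suc n) + h * mul (suc (suc n)) (pow x (suc n)) + 0#
      ≈⟨ +-identityʳ _ ⟩
    x * pow x (suc n) + h * mul (suc (suc n)) (pow x (suc n)) ∎
    where m = mul (suc n) (pow x n)

  -- Each step splits off a block of `suc p′` coefficients, of which only the first can be nonzero.
  -- This serves the inseparable case, where a polynomial with zero derivative modulo p is a
  -- polynomial in the p-th power.
  eval-multiples : ∀ p′ k a x → (∀ j → j ℕ.≤ k ℕ.* suc p′ → ¬ suc p′ ∣ j → a j ≈ 0#) →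
                   eval (suc (k ℕ.* suc p′)) a x ≈ eval (suc k) (λ i → a (i ℕ.* suc p′)) (pow x (suc p′))
  eval-multiples p′ zero    a x vanish = +-congˡ (trans (zeroʳ x) (sym (zeroʳ _)))
  eval-multiples p′ (suc k) a x vanish = begin
    eval (suc (p ℕ.+ k ℕ.* p)) a x
      ≡⟨ ≡.cong (λ n → eval n a x) (≡.sym (ℕP.+-suc p (k ℕ.* p))) ⟩
    eval (p ℕ.+ suc (k ℕ.* p)) a x
      ≈⟨ eval-split p (suc (k ℕ.* p)) a x ⟩
    (a 0 + x * eval p′ (a ∘ suc) x) + pow x p * eval (suc (k ℕ.* p)) (λ j → a (p ℕ.+ j)) x
      ≈⟨ +-cong (trans (+-congˡ (trans (*-congˡ (eval-zero p′ x low)) (zeroʳ x))) (+-identityʳ _))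
                (*-congˡ (eval-multiples p′ k (λ j → a (p ℕ.+ j)) x
                  (λ j j≤ p∤j → vanish (p ℕ.+ j) (ℕP.+-monoʳ-≤ p j≤) (λ p∣ → p∤j (∣m+n∣m⇒∣n p∣ ∣-refl))))) ⟩
    a 0 + pow x p * eval (suc k) (λ i → a (p ℕ.+ i ℕ.* p)) (pow x p) ∎
    where
    p = suc p′
    low : ∀ j → j ℕ.< p′ → a (suc j) ≈ 0#
    low j j<p′ = vanish (suc j) (ℕP.≤-trans (s≤s (ℕP.<⇒≤ j<p′)) (ℕP.m≤m+n p (k ℕ.* p)))
      (λ p∣ → ℕP.<⇒≱ (s≤s j<p′) (∣⇒≤ p∣))

  -- Division by a polynomial q of degree suc d with leading coefficient q (suc d):
  -- the effect on quotient and remainder of multiplying the dividend by the variable.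
  division-step : ∀ d q r γ f B x →
    γ * f ≈ eval (suc (suc d)) q x * B + eval (suc d) r x →
    (q (suc d) * γ) * (x * f) ≈
      eval (suc (suc d)) q x * (q (suc d) * (x * B) + r d)
        + eval (suc d) (λ j → q (suc d) * cons 0# r j + - r d * q j) x
  division-step d q r γ f B x eq = begin
    (c * γ) * (x * f)
      ≈⟨ solve 4 (λ c γ x f → ((c :* γ) :* (x :* f)) := (c :* (x :* (γ :* f)))) refl c γ x f ⟩
    c * (x * (γ * f))
      ≈⟨ *-congˡ (*-congˡ eq) ⟩
    c * (x * (Q * B + eval (suc d) r x))
      ≈⟨ solve 5 (λ c x Q B e → (c :* (x :* (Q :* B :+ e))) := (Q :* (c :* (x :* B)) :+ c :* (x :* e))) refl c x Q B _ ⟩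
    Q * (c * (x * B)) + c * (x * eval (suc d) r x)
      ≈⟨ +-congˡ (*-congˡ (trans (sym (+-identityˡ _)) (eval-last (suc d) (cons 0# r) x))) ⟩
    Q * (c * (x * B)) + c * (T + r d * P)
      ≈⟨ +-congˡ (sym cancelled) ⟩
    Q * (c * (x * B)) + (Q * r d + (c * T + - r d * e))
      ≈⟨ solve 5 (λ Q a r t n → (Q :* a :+ (Q :* r :+ (t :+ n))) := (Q :* (a :+ r) :+ (t :+ n))) refl Q _ (r d) _ _ ⟩
    Q * (c * (x * B) + r d) + (c * T + - r d * e)
      ≈⟨ +-congˡ (+-cong (sym (eval-*ˡ (suc d) c (cons 0# r) x)) (sym (eval-*ˡ (suc d) (- r d) q x))) ⟩
    Q * (c * (x * B) + r d) + (eval (suc d) (λ j → c * cons 0# r j) x + eval (suc d) (λ j → - r d * q j) x)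
      ≈⟨ +-congˡ (sym (eval-+ (suc d) (λ j → c * cons 0# r j) (λ j → - r d * q j) x)) ⟩
    Q * (c * (x * B) + r d) + eval (suc d) (λ j → c * cons 0# r j + - r d * q j) x ∎
    where
    c = q (suc d)
    Q = eval (suc (suc d)) q x
    e = eval (suc d) q x
    P = pow x (suc d)
    T = eval (suc d) (cons 0# r) x
    cancelled : Q * r d + (c * T + - r d * e) ≈ c * (T + r d * P)
    cancelled = begin
      Q * r d + (c * T + - r d * e)
        ≈⟨ +-congʳ (*-congʳ (eval-last (suc d) q x)) ⟩
      (e + c * P) * r d + (c * T + - r d * e)
        ≈⟨ solve 6 (λ e c P r T n → ((e :+ c :* P) :* r :+ (c :* T :+ n :* e)) := (c :* (T :+ r :* P) :+ (r :+ n) :* e)) refl e c P (r d) T (- r d) ⟩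
      c * (T + r d * P) + (r d - r d) * e
        ≈⟨ +-congˡ (trans (*-congʳ (-‿inverseʳ (r d))) (zeroˡ e)) ⟩
      c * (T + r d * P) + 0# ≈⟨ +-identityʳ _ ⟩
      c * (T + r d * P) ∎

  -- In the expansion of `Q′ * B′`, every term other than `Q * B` and `H * (D * B)` contains
  -- `H * π`, because `Q` is itself a multiple of `H`. Here `Q` and `Q′` will be values of one
  -- polynomial at two neighbouring points.
  perturbation : ∀ {Q Q′ B B′} H D π b w → Q * B ≈ Q′ * B′ → Q′ ≈ Q + H * D → B′ ≈ B + π * b → Q ≈ H * w →
                 H * π ≈ 0# → H * (D * B) ≈ 0#
  perturbation {Q} {Q′} {B} {B′} H D π b w eq Q′≈ B′≈ Q≈ Hπ≈0 = sym (+-cancelˡ (Q * B) (begin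
    Q * B + 0#  ≈⟨ +-identityʳ _ ⟩
    Q * B       ≈⟨ eq ⟩
    Q′ * B′     ≈⟨ *-cong Q′≈ B′≈ ⟩
    (Q + H * D) * (B + π * b)
      ≈⟨ solve 6 (λ Q H D B π b → ((Q :+ H :* D) :* (B :+ π :* b)) := (Q :* B :+ H :* (D :* B) :+ (Q :+ H :* D) :* (π :* b))) refl Q H D B π b ⟩
    Q * B + H * (D * B) + (Q + H * D) * (π * b)
      ≈⟨ +-congˡ (*-congʳ (+-congʳ Q≈)) ⟩
    Q * B + H * (D * B) + (H * w + H * D) * (π * b)
      ≈⟨ +-congˡ (solve 5 (λ H w D π b → ((H :* w :+ H :* D) :* (π :* b)) := ((H :* π) :* ((w :+ D) :* b))) refl H w D π b) ⟩
    Q * B + H * (D * B) + (H * π) * ((w + D) * b)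
      ≈⟨ +-congˡ (trans (*-congʳ Hπ≈0) (zeroˡ _)) ⟩
    Q * B + H * (D * B) + 0#
      ≈⟨ +-identityʳ _ ⟩
    Q * B + H * (D * B) ∎))

  pair-expand : ∀ a b x y → (a * b) * (x + y) ≈ b * (a * x) + a * (b * y)
  pair-expand = solve 4 (λ a b x y → ((a :* b) :* (x :+ y)) := (b :* (a :* x) :+ a :* (b :* y))) refl

  pair-collect : ∀ a b Q x y u v → b * (Q * x + u) + a * (Q * y + v) ≈ Q * (b * x + a * y) + (b * u + a * v)
  pair-collect = solve 7 (λ a b Q x y u v →
    (b :* (Q :* x :+ u) :+ a :* (Q :* y :+ v)) := (Q :* (b :* x :+ a :* y) :+ (b :* u :+ a :* v))) refl

  division-𝟙 : ∀ d Q x → 1# * 1# ≈ Q * 0# + eval (suc d) (cons 1# (λ _ → 0#)) x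
  division-𝟙 d Q x = trans (*-identityˡ 1#) (sym (trans (+-cong (zeroʳ Q)
    (trans (+-congˡ (trans (*-congˡ (eval-zero d x (λ _ _ → refl))) (zeroʳ x))) (+-identityʳ 1#))) (+-identityˡ 1#)))

  division-𝟘 : ∀ d Q x → 1# * 0# ≈ Q * 0# + eval (suc d) (λ _ → 0#) x
  division-𝟘 d Q x = trans (zeroʳ 1#) (sym (trans (+-cong (zeroʳ Q) (eval-zero (suc d) x (λ _ _ → refl))) (+-identityˡ 0#)))

  translate-≥ : ∀ x n a j → n ℕ.≤ j → translate x n a j ≈ 0#
  translate-≥ x zero    a j       n≤j       = refl
  translate-≥ x (suc n) a (suc j) (s≤s n≤j) =
    trans (+-cong (trans (*-congˡ (translate-≥ x n (a ∘ suc) (suc j) (ℕP.m≤n⇒m≤1+n n≤j))) (zeroʳ x))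
                  (translate-≥ x n (a ∘ suc) j n≤j)) (+-identityˡ 0#)

  translate-top : ∀ x n a → translate x (suc n) a n ≈ a n
  translate-top x zero    a = trans (+-congˡ (zeroʳ x)) (+-identityʳ (a 0))
  translate-top x (suc n) a =
    trans (+-cong (trans (*-congˡ (translate-≥ x (suc n) (a ∘ suc) (suc n) ℕP.≤-refl)) (zeroʳ x))
                  (translate-top x n (a ∘ suc))) (+-identityˡ _)

  -- With `x = X`, the second summand carries the leading coefficient into the subleading one, one
  -- exponent higher. The argument for lacunary series rests on this term.
  translate-subtop : ∀ x n a → translate x (suc (suc n)) a n ≈ a n + mul (suc n) (x * a (suc n))
  translate-subtop x zero    a =
    +-congˡ (trans (*-congˡ (translate-top x zero (a ∘ suc))) (sym (+-identityʳ (x * a 1))))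
  translate-subtop x (suc n) a = begin
    x * translate x (suc (suc n)) (a ∘ suc) (suc n) + translate x (suc (suc n)) (a ∘ suc) n
      ≈⟨ +-cong (*-congˡ (translate-top x (suc n) (a ∘ suc))) (translate-subtop x n (a ∘ suc)) ⟩
    x * a (suc (suc n)) + (a (suc n) + mul (suc n) (x * a (suc (suc n))))
      ≈⟨ solve 3 (λ u v w → (u :+ (v :+ w)) := (v :+ (u :+ w))) refl _ _ _ ⟩
    a (suc n) + (x * a (suc (suc n)) + mul (suc n) (x * a (suc (suc n)))) ∎

  eval-translate : ∀ x n a y → eval n a (x + y) ≈ eval n (translate x n a) y
  eval-translate x zero    a y = refl
  eval-translate x (suc n) a y = begin
    a 0 + (x + y) * eval n (a ∘ suc) (x + y)
      ≈⟨ +-congˡ (*-congˡ (eval-translate x n (a ∘ suc) y)) ⟩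
    a 0 + (x + y) * E
      ≈⟨ +-congˡ (distribʳ E x y) ⟩
    a 0 + (x * E + y * E)
      ≈⟨ +-congˡ (+-congʳ (*-congˡ unfolded)) ⟩
    a 0 + (x * (T 0 + y * E′) + y * E)
      ≈⟨ solve 6 (λ a x t y e′ e → (a :+ (x :* (t :+ y :* e′) :+ y :* e)) := ((a :+ x :* t) :+ y :* (x :* e′ :+ e))) refl (a 0) x (T 0) y E′ E ⟩
    (a 0 + x * T 0) + y * (x * E′ + E)
      ≈⟨ +-congˡ (*-congˡ (trans (+-congʳ (sym (eval-*ˡ n x (T ∘ suc) y))) (sym (eval-+ n (λ j → x * T (suc j)) T y)))) ⟩
    (a 0 + x * T 0) + y * eval n (λ j → x * T (suc j) + T j) y ∎
    where
    T = translate x n (a ∘ suc)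
    E = eval n T y
    E′ = eval n (T ∘ suc) y
    unfolded : E ≈ T 0 + y * E′
    unfolded = sym (trans (eval-last n T y)
      (trans (+-congˡ (trans (*-congʳ (translate-≥ x n (a ∘ suc) n ℕP.≤-refl)) (zeroˡ _))) (+-identityʳ E)))

  x+c≈y⇒x≈y-c : ∀ {x c y} → x + c ≈ y → x ≈ y - c
  x+c≈y⇒x≈y-c {x} {c} {y} eq = sym (begin
    y - c        ≈⟨ +-congʳ eq ⟨
    (x + c) - c  ≈⟨ +-assoc x c (- c) ⟩
    x + (c - c)  ≈⟨ +-congˡ (-‿inverseʳ c) ⟩
    x + 0#       ≈⟨ +-identityʳ x ⟩
    x ∎)

-- Formal power series: ring structure, cancellation and logarithmic derivatives.

module SeriesRing (R : CommutativeRing 0ℓ 0ℓ) where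
  open CommutativeRing R hiding (zero)
  open RingLaws R
  open SeriesOps _+_ _*_ -_ 0# 1# public
  open NatSolver commutativeSemiring using (solve; _:=_; _:+_; _:*_; con)

  infix 4 _≋_

  -- A record instead of a function type, so that `f` and `g` can be recovered from the type by
  -- unification.
  record _≋_ (f g : ℕ → Carrier) : Set where
    constructor pointwise
    field at : ∀ n → f n ≈ g n
  open _≋_ public

  ≋-refl : ∀ {f} → f ≋ f
  ≋-refl .at n = refl

  ≋-sym : ∀ {f g} → f ≋ g → g ≋ f
  ≋-sym eq .at n = sym (eq .at n)

  ≋-trans : ∀ {f g h} → f ≋ g → g ≋ h → f ≋ h
  ≋-trans eq eq′ .at n = trans (eq .at n) (eq′ .at n)

  ⊛-cong-≤ : ∀ n {f f′ g g′} → (∀ i → i ℕ.≤ n → f i ≈ f′ i) → (∀ i → i ℕ.≤ n → g i ≈ g′ i) →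
             (f ⊛ g) n ≈ (f′ ⊛ g′) n
  ⊛-cong-≤ zero    eq eq′ = *-cong (eq 0 z≤n) (eq′ 0 z≤n)
  ⊛-cong-≤ (suc n) eq eq′ =
    +-cong (*-cong (eq 0 z≤n) (eq′ (suc n) ℕP.≤-refl))
           (⊛-cong-≤ n (λ i i≤n → eq (suc i) (s≤s i≤n)) (λ i i≤n → eq′ i (ℕP.m≤n⇒m≤1+n i≤n)))

  ⊛-cong : ∀ {f f′ g g′} → f ≋ f′ → g ≋ g′ → f ⊛ g ≋ f′ ⊛ g′
  ⊛-cong eq eq′ .at n = ⊛-cong-≤ n (λ i _ → eq .at i) (λ i _ → eq′ .at i)

  ⊛-zeroˡ : ∀ g n → (𝟘 ⊛ g) n ≈ 0#
  ⊛-zeroˡ g zero    = zeroˡ _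
  ⊛-zeroˡ g (suc n) = trans (+-cong (zeroˡ _) (⊛-zeroˡ g n)) (+-identityˡ _)

  ⊛-distribʳ : ∀ f g h n → ((g ⊕ h) ⊛ f) n ≈ (g ⊛ f) n + (h ⊛ f) n
  ⊛-distribʳ f g h zero    = distribʳ _ _ _
  ⊛-distribʳ f g h (suc n) =
    trans (+-cong (distribʳ _ _ _) (⊛-distribʳ f (tail g) (tail h) n)) (+-interchange _ _ _ _)

  ⊛-unfoldʳ : ∀ f g n → (f ⊛ g) (suc n) ≈ f (suc n) * g 0 + (f ⊛ tail g) n
  ⊛-unfoldʳ f g zero    = +-comm _ _
  ⊛-unfoldʳ f g (suc n) = begin
    f 0 * g (suc (suc n)) + (tail f ⊛ g) (suc n)
      ≈⟨ +-congˡ (⊛-unfoldʳ (tail f) g n) ⟩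
    f 0 * g (suc (suc n)) + (f (suc (suc n)) * g 0 + (tail f ⊛ tail g) n)
      ≈⟨ solve 3 (λ a b c → (a :+ (b :+ c)) := (b :+ (a :+ c))) refl _ _ _ ⟩
    f (suc (suc n)) * g 0 + (f 0 * g (suc (suc n)) + (tail f ⊛ tail g) n) ∎
    where open SetoidReasoning setoid

  ⊛-comm : ∀ f g n → (f ⊛ g) n ≈ (g ⊛ f) n
  ⊛-comm f g zero    = *-comm _ _
  ⊛-comm f g (suc n) = trans (+-cong (*-comm _ _) (⊛-comm (tail f) g n)) (sym (⊛-unfoldʳ g f n))

  const-⊛ : ∀ c f n → (const c ⊛ f) n ≈ c * f n
  const-⊛ c f zero    = refl
  const-⊛ c f (suc n) = trans (+-congˡ (⊛-zeroˡ f n)) (+-identityʳ _)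

  ⊛-scaleˡ : ∀ c f g n → ((λ i → c * f i) ⊛ g) n ≈ c * (f ⊛ g) n
  ⊛-scaleˡ c f g zero    = *-assoc _ _ _
  ⊛-scaleˡ c f g (suc n) =
    trans (+-cong (*-assoc _ _ _) (⊛-scaleˡ c (tail f) g n)) (sym (distribˡ c _ _))

  ⊛-scaleʳ : ∀ c f g n → (f ⊛ (λ i → c * g i)) n ≈ c * (f ⊛ g) n
  ⊛-scaleʳ c f g n =
    trans (⊛-comm f (λ i → c * g i) n) (trans (⊛-scaleˡ c g f n) (*-congˡ (⊛-comm g f n)))

  ⊛-as-∑ : ∀ f g n → (f ⊛ g) n ≈ ∑ (suc n) (λ i → f i * g (n ℕ.∸ i))
  ⊛-as-∑ f g zero    = sym (+-identityʳ _)
  ⊛-as-∑ f g (suc n) = +-congˡ (⊛-as-∑ (tail f) g n)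

  ⊛-assoc : ∀ f g h n → ((f ⊛ g) ⊛ h) n ≈ (f ⊛ (g ⊛ h)) n
  ⊛-assoc f g h zero    = *-assoc _ _ _
  ⊛-assoc f g h (suc n) = begin
    (f 0 * g 0) * h (suc n) + (tail (f ⊛ g) ⊛ h) n
      ≈⟨ +-cong (*-assoc _ _ _) (⊛-distribʳ h (λ i → f 0 * g (suc i)) (tail f ⊛ g) n) ⟩
    f 0 * (g 0 * h (suc n)) + (((λ i → f 0 * g (suc i)) ⊛ h) n + ((tail f ⊛ g) ⊛ h) n)
      ≈⟨ +-congˡ (+-cong (⊛-scaleˡ (f 0) (tail g) h n) (⊛-assoc (tail f) g h n)) ⟩
    f 0 * (g 0 * h (suc n)) + (f 0 * (tail g ⊛ h) n + (tail f ⊛ (g ⊛ h)) n)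
      ≈⟨ solve 4 (λ a b c d → (a :* b :+ (a :* c :+ d)) := (a :* (b :+ c) :+ d)) refl _ _ _ _ ⟩
    f 0 * (g 0 * h (suc n) + (tail g ⊛ h) n) + (tail f ⊛ (g ⊛ h)) n ∎
    where open SetoidReasoning setoid

  isCommutativeRing′ : IsCommutativeRing _≋_ _⊕_ _⊛_ ⊝_ 𝟘 𝟙
  isCommutativeRing′ = record
    { isRing = record
      { +-isAbelianGroup = record
        { isGroup = record
          { isMonoid = record
            { isSemigroup = record
              { isMagma = record
                { isEquivalence = record { refl = ≋-refl ; sym = ≋-sym ; trans = ≋-trans }
                ; ∙-cong = λ eq eq′ → pointwise λ n → +-cong (eq .at n) (eq′ .at n) }
              ; assoc = λ f g h → pointwise λ n → +-assoc _ _ _ }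
            ; identity = (λ f → pointwise λ n → +-identityˡ _) , (λ f → pointwise λ n → +-identityʳ _) }
          ; inverse = (λ f → pointwise λ n → -‿inverseˡ _) , (λ f → pointwise λ n → -‿inverseʳ _)
          ; ⁻¹-cong = λ eq → pointwise λ n → -‿cong (eq .at n) }
        ; comm = λ f g → pointwise λ n → +-comm _ _ }
      ; *-cong = ⊛-cong
      ; *-assoc = λ f g h → pointwise (⊛-assoc f g h)
      ; *-identity = (λ f → pointwise λ n → trans (const-⊛ 1# f n) (*-identityˡ _))
                   , (λ f → pointwise λ n → trans (⊛-comm f 𝟙 n) (trans (const-⊛ 1# f n) (*-identityˡ _)))
      ; distrib = (λ f g h → pointwise λ n → trans (⊛-comm f (g ⊕ h) n)
                       (trans (⊛-distribʳ f g h n) (+-cong (⊛-comm g f n) (⊛-comm h f n))))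
                , (λ f g h → pointwise (⊛-distribʳ f g h)) }
    ; *-comm = λ f g → pointwise (⊛-comm f g) }

  seriesRing : CommutativeRing 0ℓ 0ℓ
  seriesRing = record { isCommutativeRing = isCommutativeRing′ }

  module 𝕊 = RingLaws seriesRing
  module 𝕊R = CommutativeRing seriesRing

  module Domain (zero? : ∀ a → Dec (a ≈ 0#)) (*-cancel : ∀ a b → ¬ a ≈ 0# → a * b ≈ 0# → b ≈ 0#) where

    -- Leading zeros of `f` are removed by `tail`, with `m` bounding their number. Once `f 0` is
    -- nonzero, the coefficients of `g` vanish one after the other.
    ⊛-cancel-at : ∀ m f g → ¬ f m ≈ 0# → f ⊛ g ≋ 𝟘 → g ≋ 𝟘
    ⊛-cancel-at m f g fm≉0 fg≈0 with zero? (f 0)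
    ⊛-cancel-at zero    f g fm≉0 fg≈0 | yes f0≈0 = ⊥-elim (fm≉0 f0≈0)
    ⊛-cancel-at (suc m) f g fm≉0 fg≈0 | yes f0≈0 = ⊛-cancel-at m (tail f) g fm≉0 (pointwise λ n →
      trans (sym (trans (+-congʳ (trans (*-congʳ f0≈0) (zeroˡ (g (suc n))))) (+-identityˡ _))) (fg≈0 .at (suc n)))
    ⊛-cancel-at m f g fm≉0 fg≈0 | no f0≉0 = pointwise (go g fg≈0)
      where
      go : ∀ g → f ⊛ g ≋ 𝟘 → ∀ n → g n ≈ 0#
      go g fg≈0 zero    = *-cancel (f 0) (g 0) f0≉0 (fg≈0 .at 0)
      go g fg≈0 (suc n) = go (tail g) (pointwise λ n →
        trans (sym (trans (⊛-unfoldʳ f g n)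
          (trans (+-congʳ (trans (*-congˡ (go g fg≈0 zero)) (zeroʳ (f (suc n))))) (+-identityˡ _))))
          (fg≈0 .at (suc n))) n

    -- The bare negation `¬ f ≋ 𝟘` yields no index of a nonzero coefficient. So the roles are
    -- exchanged: a nonzero coefficient of `g` would force `f ≋ 𝟘`.
    ⊛-cancel : ∀ {f g} → ¬ f ≋ 𝟘 → f ⊛ g ≋ 𝟘 → g ≋ 𝟘
    ⊛-cancel {f} {g} f≉0 fg≈0 = pointwise λ n → Dec.decidable-stable (zero? (g n)) λ gn≉0 →
      f≉0 (⊛-cancel-at n g f gn≉0 (≋-trans (pointwise (⊛-comm g f)) fg≈0))

    ⊛-nonzero : ∀ {f g} → ¬ f ≋ 𝟘 → ¬ g ≋ 𝟘 → ¬ f ⊛ g ≋ 𝟘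
    ⊛-nonzero f≉0 g≉0 fg≈0 = g≉0 (⊛-cancel f≉0 fg≈0)

  const-cong : ∀ {a b} → a ≈ b → const a ≋ const b
  const-cong eq .at zero    = eq
  const-cong eq .at (suc n) = refl

  const-0# : const 0# ≋ 𝟘
  const-0# .at zero    = refl
  const-0# .at (suc n) = refl

  const-* : ∀ a b → const (a * b) ≋ const a ⊛ const b
  const-* a b .at zero    = refl
  const-* a b .at (suc n) = sym (trans (const-⊛ a (const b) (suc n)) (zeroʳ a))

  shift-cong : ∀ {f g} → f ≋ g → shift f ≋ shift g
  shift-cong eq .at zero    = refl
  shift-cong eq .at (suc n) = eq .at n

  shifts-cong : ∀ m {f g} → f ≋ g → shifts m f ≋ shifts m g
  shifts-cong zero    eq = eq
  shifts-cong (suc m) eq = shift-cong (shifts-cong m eq)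

  shift-⊛ : ∀ f g → shift f ⊛ g ≋ shift (f ⊛ g)
  shift-⊛ f g .at zero    = zeroˡ _
  shift-⊛ f g .at (suc n) = trans (+-congʳ (zeroˡ _)) (+-identityˡ _)

  shifts-⊛ : ∀ m f g → shifts m f ⊛ g ≋ shifts m (f ⊛ g)
  shifts-⊛ zero    f g = ≋-refl
  shifts-⊛ (suc m) f g = ≋-trans (shift-⊛ (shifts m f) g) (shift-cong (shifts-⊛ m f g))

  X-⊛ : ∀ f → X ⊛ f ≋ shift f
  X-⊛ f = ≋-trans (shift-⊛ 𝟙 f) (shift-cong (𝕊R.*-identityˡ f))

  shifts-< : ∀ m f n → n ℕ.< m → shifts m f n ≈ 0#
  shifts-< (suc m) f zero    n<m       = refl
  shifts-< (suc m) f (suc n) (s≤s n<m) = shifts-< m f n n<m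

  shifts-+ : ∀ m f n → shifts m f (m ℕ.+ n) ≡ f n
  shifts-+ zero    f n = ≡.refl
  shifts-+ (suc m) f n = shifts-+ m f n

  θ-cong : ∀ {f g} → f ≋ g → θ f ≋ θ g
  θ-cong eq .at n = mul-cong n (eq .at n)

  θ-⊕ : ∀ f g → θ (f ⊕ g) ≋ θ f ⊕ θ g
  θ-⊕ f g .at n = mul-distrib-+ n (f n) (g n)

  θ-⊛ : ∀ f g → θ (f ⊛ g) ≋ θ f ⊛ g ⊕ f ⊛ θ g
  θ-⊛ f g .at = leibniz f g
    where
    open SetoidReasoning setoid
    leibniz : ∀ f g n → θ (f ⊛ g) n ≈ (θ f ⊛ g) n + (f ⊛ θ g) n
    leibniz f g zero = sym (trans (+-cong (zeroˡ _) (zeroʳ _)) (+-identityˡ _))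
    leibniz f g (suc n) = begin
      mul (suc n) (f 0 * g (suc n) + (tail f ⊛ g) n)
        ≈⟨ mul-distrib-+ (suc n) _ _ ⟩
      mul (suc n) (f 0 * g (suc n)) + ((tail f ⊛ g) n + θ (tail f ⊛ g) n)
        ≈⟨ +-cong (mul-*ʳ (suc n) _ _) (+-congˡ (leibniz (tail f) g n)) ⟩
      f 0 * θ g (suc n) + ((tail f ⊛ g) n + ((θ (tail f) ⊛ g) n + (tail f ⊛ θ g) n))
        ≈⟨ solve 5 (λ z a b c d → (b :+ (a :+ (c :+ d))) := ((con 0 :* z :+ (a :+ c)) :+ (b :+ d))) refl
             (g (suc n)) _ _ _ _ ⟩
      (0# * g (suc n) + ((tail f ⊛ g) n + (θ (tail f) ⊛ g) n)) + (f 0 * θ g (suc n) + (tail f ⊛ θ g) n)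
        ≈⟨ +-congʳ (+-congˡ (⊛-distribʳ g (tail f) (θ (tail f)) n)) ⟨
      (0# * g (suc n) + ((tail f ⊕ θ (tail f)) ⊛ g) n) + (f 0 * θ g (suc n) + (tail f ⊛ θ g) n) ∎

  mul-at : ∀ m f n → 𝕊.mul m f n ≈ mul m (f n)
  mul-at zero    f n = refl
  mul-at (suc m) f n = +-congˡ (mul-at m f n)

  -- `h` is the logarithmic derivative of `f` with respect to x d/dx, written without division.
  LogDer : (ℕ → Carrier) → (ℕ → Carrier) → Set
  LogDer h f = θ f ≋ h ⊛ f

  module _ where
    open SetoidReasoning 𝕊R.setoid
    open NatSolver 𝕊R.commutativeSemiring using () renaming (solve to solveₛ; _:=_ to _:=ₛ_; _:+_ to _:+ₛ_; _:*_ to _:*ₛ_)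

    LogDer-⊛ : ∀ {h k f g} → LogDer h f → LogDer k g → LogDer (h ⊕ k) (f ⊛ g)
    LogDer-⊛ {h} {k} {f} {g} Df Dg = begin
      θ (f ⊛ g)                   ≈⟨ θ-⊛ f g ⟩
      θ f ⊛ g ⊕ f ⊛ θ g           ≈⟨ 𝕊R.+-cong (⊛-cong Df ≋-refl) (⊛-cong ≋-refl Dg) ⟩
      h ⊛ f ⊛ g ⊕ f ⊛ (k ⊛ g)
        ≈⟨ solveₛ 4 (λ h k f g → ((h :*ₛ f) :*ₛ g :+ₛ f :*ₛ (k :*ₛ g)) :=ₛ ((h :+ₛ k) :*ₛ (f :*ₛ g))) ≋-refl h k f g ⟩
      (h ⊕ k) ⊛ (f ⊛ g) ∎

    LogDer-𝟙 : LogDer 𝟘 𝟙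
    LogDer-𝟙 .at zero    = sym (zeroˡ _)
    LogDer-𝟙 .at (suc n) = trans (mul-0# (suc n)) (sym (⊛-zeroˡ 𝟙 (suc n)))

    LogDer-pow : ∀ n {h f} → LogDer h f → LogDer (𝕊.mul n h) (𝕊.pow f n)
    LogDer-pow zero    Df = LogDer-𝟙
    LogDer-pow (suc n) Df = LogDer-⊛ Df (LogDer-pow n Df)

    -- Since θ (vʲ) = j h vʲ, differentiating the powers of `v` keeps their exponents: the
    -- coefficients are `mul j (a j)` and not the shifted ones of `derivative`.
    θ-eval : ∀ n a {h v} → LogDer h v →
             θ (𝕊.eval n a v) ≋ 𝕊.eval n (λ j → θ (a j)) v ⊕ h ⊛ 𝕊.eval n (λ j → 𝕊.mul j (a j)) v
    θ-eval zero    a {h} {v} Dv = ≋-trans (pointwise mul-0#) (≋-sym (≋-trans (𝕊R.+-identityˡ _) (𝕊R.zeroʳ h)))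
    θ-eval (suc n) a {h} {v} Dv = begin
      θ (a 0 ⊕ v ⊛ E)
        ≈⟨ ≋-trans (θ-⊕ (a 0) (v ⊛ E)) (𝕊R.+-congˡ (θ-⊛ v E)) ⟩
      θ (a 0) ⊕ (θ v ⊛ E ⊕ v ⊛ θ E)
        ≈⟨ 𝕊R.+-congˡ (𝕊R.+-cong (𝕊R.*-congʳ Dv) (𝕊R.*-congˡ (θ-eval n (λ j → a (suc j)) Dv))) ⟩
      θ (a 0) ⊕ (h ⊛ v ⊛ E ⊕ v ⊛ (P ⊕ h ⊛ D))
        ≈⟨ solveₛ 6 (λ t h v E P D → (t :+ₛ ((h :*ₛ v) :*ₛ E :+ₛ v :*ₛ (P :+ₛ h :*ₛ D)))
                                 :=ₛ ((t :+ₛ v :*ₛ P) :+ₛ h :*ₛ (v :*ₛ (E :+ₛ D)))) ≋-refl (θ (a 0)) h v E P D ⟩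
      θ (a 0) ⊕ v ⊛ P ⊕ h ⊛ (v ⊛ (E ⊕ D))
        ≈⟨ 𝕊R.+-congˡ (𝕊R.*-congˡ (≋-trans (𝕊R.*-congˡ (≋-sym (𝕊.eval-+ n _ _ v))) (≋-sym (𝕊R.+-identityˡ _)))) ⟩
      θ (a 0) ⊕ v ⊛ P ⊕ h ⊛ 𝕊.eval (suc n) (λ j → 𝕊.mul j (a j)) v ∎
      where
      E = 𝕊.eval n (λ j → a (suc j)) v
      P = 𝕊.eval n (λ j → θ (a (suc j))) v
      D = 𝕊.eval n (λ j → 𝕊.mul j (a (suc j))) v

-- The substitution x ↦ xᵖ and the sections of a series by exponents modulo p.

module FrobeniusOps {A : Set} (0# : A) (p : ℕ) .{{_ : NonZero p}} where

  select : ℕ → A → A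
  select zero    a = a
  select (suc _) a = 0#

  -- The r-th section, or Cartier operator: f is the sum of xʳ σ (Λ r f) over r < p.
  Λ : ℕ → (ℕ → A) → ℕ → A
  Λ r f k = f (r ℕ.+ k ℕ.* p)

  σ : (ℕ → A) → ℕ → A
  σ f n = select (n % p) (f (n / p))

module Frobenius (p : ℕ) .{{_ : NonZero p}} (R : CommutativeRing 0ℓ 0ℓ) where
  open CommutativeRing R hiding (zero)
  open RingLaws R
  open SeriesRing R
  open FrobeniusOps 0# p public

  [r+kp]%p≡r : ∀ r k → r ℕ.< p → (r ℕ.+ k ℕ.* p) % p ≡ r
  [r+kp]%p≡r r k r<p = ≡.trans ([m+kn]%n≡m%n r k p) (m<n⇒m%n≡m r<p)

  [r+kp]/p≡k : ∀ r k → r ℕ.< p → (r ℕ.+ k ℕ.* p) / p ≡ k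
  [r+kp]/p≡k r k r<p =
    ≡.trans (+-distrib-/-∣ʳ r (n∣m*n k)) (≡.cong₂ ℕ._+_ (m<n⇒m/n≡0 r<p) (m*n/n≡m k p))

  swap : ∀ r k → r ℕ.+ (p ℕ.+ k ℕ.* p) ≡ p ℕ.+ (r ℕ.+ k ℕ.* p)
  swap r k = ≡.trans (≡.sym (ℕP.+-assoc r p (k ℕ.* p)))
    (≡.trans (≡.cong (ℕ._+ k ℕ.* p) (ℕP.+-comm r p)) (ℕP.+-assoc p r (k ℕ.* p)))

  0<p : 0 ℕ.< p
  0<p = ℕ.>-nonZero⁻¹ p

  Λσ : ∀ r f k → r ℕ.< p → Λ r (σ f) k ≡ select r (f k)
  Λσ r f k r<p = ≡.cong₂ select ([r+kp]%p≡r r k r<p) (≡.cong f ([r+kp]/p≡k r k r<p))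

  Λ-ext : ∀ {f g} → (∀ r → r ℕ.< p → Λ r f ≋ Λ r g) → f ≋ g
  Λ-ext {f} {g} eq .at n =
    ≡.subst (λ m → f m ≈ g m) (≡.sym (m≡m%n+[m/n]*n n p)) (eq (n % p) (m%n<n n p) .at (n / p))

  Λ-cong : ∀ r {f g} → f ≋ g → Λ r f ≋ Λ r g
  Λ-cong r eq .at k = eq .at _

  select-cong : ∀ r {a b} → a ≈ b → select r a ≈ select r b
  select-cong zero    eq = eq
  select-cong (suc r) eq = refl

  σ-cong : ∀ {f g} → f ≋ g → σ f ≋ σ g
  σ-cong eq .at n = select-cong (n % p) (eq .at (n / p))

  σ-unfold : ∀ f → σ f ≋ const (f 0) ⊕ shifts p (σ (tail f))
  σ-unfold f = Λ-ext λ r r<p → pointwise λ k → trans (reflexive (Λσ r f k r<p)) (rhs r k r<p)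
    where
    rhs : ∀ r k → r ℕ.< p → select r (f k) ≈ Λ r (const (f 0) ⊕ shifts p (σ (tail f))) k
    rhs zero zero r<p = sym (trans (+-congˡ (shifts-< p _ 0 r<p)) (+-identityʳ _))
    rhs (suc r) zero r<p = sym (trans (+-identityˡ _) (shifts-< p _ _ (≡.subst (ℕ._< p) (≡.sym (ℕP.+-identityʳ _)) r<p)))
    rhs r (suc k) r<p = sym (begin
      const (f 0) (r ℕ.+ (p ℕ.+ k ℕ.* p)) + shifts p (σ (tail f)) (r ℕ.+ (p ℕ.+ k ℕ.* p))
        ≡⟨ ≡.cong (λ n → const (f 0) n + shifts p (σ (tail f)) n) (swap r k) ⟩
      const (f 0) (p ℕ.+ (r ℕ.+ k ℕ.* p)) + shifts p (σ (tail f)) (p ℕ.+ (r ℕ.+ k ℕ.* p))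
        ≈⟨ +-cong (const-+0 p 0<p) (reflexive (shifts-+ p _ _)) ⟩
      0# + σ (tail f) (r ℕ.+ k ℕ.* p)
        ≈⟨ +-identityˡ _ ⟩
      σ (tail f) (r ℕ.+ k ℕ.* p)
        ≡⟨ Λσ r (tail f) k r<p ⟩
      select r (f (suc k)) ∎)
      where
      open SetoidReasoning setoid
      const-+0 : ∀ m {n c} → 0 ℕ.< m → const c (m ℕ.+ n) ≈ 0#
      const-+0 (suc m) _ = refl

  Λ-shifts : ∀ r f → r ℕ.< p → Λ r (shifts p f) ≋ shift (Λ r f)
  Λ-shifts r f r<p .at zero    = shifts-< p f _ (≡.subst (ℕ._< p) (≡.sym (ℕP.+-identityʳ r)) r<p)
  Λ-shifts r f r<p .at (suc k) = reflexive (≡.trans (≡.cong (shifts p f) (swap r k)) (shifts-+ p f _))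

  -- A projection formula: multiplication by `σ g` moves exponents by multiples of p only, so it
  -- preserves residue classes. The proof peels off one coefficient of `g` at a time with
  -- `σ-unfold`.
  Λ-⊛σ : ∀ r f g → r ℕ.< p → Λ r (f ⊛ σ g) ≋ Λ r f ⊛ g
  Λ-⊛σ r f g r<p .at = go g
    where
    open SetoidReasoning setoid
    step : ∀ g → f ⊛ σ g ≋ const (g 0) ⊛ f ⊕ shifts p (f ⊛ σ (tail g))
    step g = ≋-trans (⊛-cong ≋-refl (σ-unfold g)) (≋-trans (𝕊R.distribˡ f _ _) (𝕊R.+-cong (𝕊R.*-comm f _)
      (≋-trans (𝕊R.*-comm f _) (≋-trans (shifts-⊛ p _ f) (shifts-cong p (𝕊R.*-comm _ f))))))
    go : ∀ g k → Λ r (f ⊛ σ g) k ≈ (Λ r f ⊛ g) k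
    go g k = begin
      Λ r (f ⊛ σ g) k                                                   ≈⟨ step g .at _ ⟩
      (const (g 0) ⊛ f) (r ℕ.+ k ℕ.* p) + Λ r (shifts p (f ⊛ σ (tail g))) k
        ≈⟨ +-cong (const-⊛ (g 0) f _) (Λ-shifts r _ r<p .at k) ⟩
      g 0 * Λ r f k + shift (Λ r (f ⊛ σ (tail g))) k                    ≈⟨ +-cong (*-comm _ _) (shifted k) ⟩
      Λ r f k * g 0 + shift (Λ r f ⊛ tail g) k                          ≈⟨ unfold k ⟨
      (Λ r f ⊛ g) k ∎
      where
      shifted : ∀ k → shift (Λ r (f ⊛ σ (tail g))) k ≈ shift (Λ r f ⊛ tail g) k
      shifted zero    = refl
      shifted (suc k) = go (tail g) k
      unfold : ∀ k → (Λ r f ⊛ g) k ≈ Λ r f k * g 0 + shift (Λ r f ⊛ tail g) k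
      unfold zero    = sym (+-identityʳ _)
      unfold (suc k) = ⊛-unfoldʳ (Λ r f) g k

  Λ₀σ : ∀ f → Λ 0 (σ f) ≋ f
  Λ₀σ f .at k = reflexive (Λσ 0 f k 0<p)

  Λₛσ : ∀ r f → suc r ℕ.< p → Λ (suc r) (σ f) ≋ 𝟘
  Λₛσ r f r<p .at k = reflexive (Λσ (suc r) f k r<p)

  σ-⊛ : ∀ f g → σ (f ⊛ g) ≋ σ f ⊛ σ g
  σ-⊛ f g = Λ-ext λ r r<p → ≋-trans (lemma r r<p) (≋-sym (Λ-⊛σ r (σ f) g r<p))
    where
    lemma : ∀ r → r ℕ.< p → Λ r (σ (f ⊛ g)) ≋ Λ r (σ f) ⊛ g
    lemma zero    r<p = ≋-trans (Λ₀σ _) (⊛-cong (≋-sym (Λ₀σ f)) ≋-refl)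
    lemma (suc r) r<p =
      ≋-trans (Λₛσ r (f ⊛ g) r<p) (≋-trans (≋-sym (pointwise (⊛-zeroˡ g))) (⊛-cong (≋-sym (Λₛσ r f r<p)) ≋-refl))

  σ-𝟙 : σ 𝟙 ≋ 𝟙
  σ-𝟙 = ≋-trans (σ-unfold 𝟙) (pointwise λ n → trans (+-congˡ (vanish p n)) (+-identityʳ _))
    where
    σ𝟘 : ∀ n → σ 𝟘 n ≈ 0#
    σ𝟘 n with n % p
    ... | zero  = refl
    ... | suc _ = refl
    vanish : ∀ m n → shifts m (σ 𝟘) n ≈ 0#
    vanish zero    n       = σ𝟘 n
    vanish (suc m) zero    = refl
    vanish (suc m) (suc n) = vanish m n

  σ-pow : ∀ f n → σ (𝕊.pow f n) ≋ 𝕊.pow (σ f) n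
  σ-pow f zero    = σ-𝟙
  σ-pow f (suc n) = ≋-trans (σ-⊛ f _) (⊛-cong ≋-refl (σ-pow f n))

  θσ : ∀ f → θ (σ f) ≋ 𝕊.mul p (σ (θ f))
  θσ f = Λ-ext λ r r<p → pointwise λ k → lemma r k r<p
    where
    open SetoidReasoning setoid
    sel : ∀ r k a → mul (r ℕ.+ k ℕ.* p) (select r a) ≈ mul p (select r (mul k a))
    sel zero    k a = trans (reflexive (≡.cong (λ n → mul n a) (ℕP.*-comm k p))) (mul-assoc-* p k a)
    sel (suc r) k a = trans (mul-0# (suc r ℕ.+ k ℕ.* p)) (sym (mul-0# p))
    lemma : ∀ r k → r ℕ.< p → Λ r (θ (σ f)) k ≈ Λ r (𝕊.mul p (σ (θ f))) k
    lemma r k r<p = begin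
      mul (r ℕ.+ k ℕ.* p) (Λ r (σ f) k)       ≡⟨ ≡.cong (mul (r ℕ.+ k ℕ.* p)) (Λσ r f k r<p) ⟩
      mul (r ℕ.+ k ℕ.* p) (select r (f k))    ≈⟨ sel r k (f k) ⟩
      mul p (select r (mul k (f k)))          ≡⟨ ≡.cong (mul p) (Λσ r (θ f) k r<p) ⟨
      mul p (Λ r (σ (θ f)) k)                 ≈⟨ mul-at p (σ (θ f)) _ ⟨
      Λ r (𝕊.mul p (σ (θ f))) k               ∎

  LogDer-σ : ∀ {h f} → LogDer h f → LogDer (𝕊.mul p (σ h)) (σ f)
  LogDer-σ {h} {f} Df =
    ≋-trans (θσ f) (≋-trans (𝕊.mul-cong p (≋-trans (σ-cong Df) (σ-⊛ h f))) (𝕊.mul-*ˡ p (σ h) (σ f)))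

  Λ-eval : ∀ r n a u → r ℕ.< p → Λ r (𝕊.eval n a (σ u)) ≋ 𝕊.eval n (λ j → Λ r (a j)) u
  Λ-eval r zero    a u r<p = ≋-refl
  Λ-eval r (suc n) a u r<p = 𝕊R.+-cong ≋-refl
    (≋-trans (Λ-cong r (𝕊R.*-comm (σ u) _))
    (≋-trans (Λ-⊛σ r _ u r<p)
    (≋-trans (𝕊R.*-comm _ u) (⊛-cong ≋-refl (Λ-eval r n (λ j → a (suc j)) u r<p)))))

-- Exponential series and the uniqueness of solutions of θ f = h f.

module Exponential (R : CommutativeRing 0ℓ 0ℓ) where
  open CommutativeRing R hiding (zero)
  open RingLaws R
  open SeriesRing R
  open SetoidReasoning setoid

  module WithInverses (inv : ℕ → Carrier) (mul-inv : ∀ n .{{_ : NonZero n}} → mul n (inv n) ≈ 1#) where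

    mul-cancel : ∀ n .{{_ : NonZero n}} {a b} → mul n a ≈ mul n b → a ≈ b
    mul-cancel n {a} {b} eq = trans (sym (divided a)) (trans (*-congʳ eq) (divided b))
      where
      divided : ∀ a → mul n a * inv n ≈ a
      divided a = begin
        mul n a * inv n    ≈⟨ mul-*ˡ n a (inv n) ⟨
        mul n (a * inv n)  ≈⟨ mul-*ʳ n a (inv n) ⟩
        a * mul n (inv n)  ≈⟨ *-congˡ (mul-inv n) ⟩
        a * 1#             ≈⟨ *-identityʳ a ⟩
        a ∎

    -- As `h 0` vanishes, the coefficient of index n + 1 in θ f = h f expresses (n + 1) f (n + 1) by
    -- earlier coefficients of `f`, and n + 1 is invertible.
    LogDer-unique : ∀ {h f g} → h 0 ≈ 0# → f 0 ≈ g 0 → LogDer h f → LogDer h g → f ≋ g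
    LogDer-unique {h} {f} {g} h₀≈0 f₀≈g₀ Df Dg = pointwise λ n → upTo n n ℕP.≤-refl
      where
      upTo : ∀ n i → i ℕ.≤ n → f i ≈ g i
      upTo n       zero    i≤n       = f₀≈g₀
      upTo (suc n) (suc i) (s≤s i≤n) = mul-cancel (suc i) (begin
        mul (suc i) (f (suc i))                ≈⟨ Df .at (suc i) ⟩
        h 0 * f (suc i) + (tail h ⊛ f) i       ≈⟨ +-cong (trans (*-congʳ h₀≈0) (zeroˡ _)) (⊛-cong-≤ i (λ _ _ → refl) (λ j j≤i → upTo n j (ℕP.≤-trans j≤i i≤n))) ⟩
        0# + (tail h ⊛ g) i                    ≈⟨ +-congʳ (trans (*-congʳ h₀≈0) (zeroˡ _)) ⟨
        h 0 * g (suc i) + (tail h ⊛ g) i       ≈⟨ Dg .at (suc i) ⟨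
        mul (suc i) (g (suc i)) ∎)

    -- The coefficients cⁿ / n! of exp (c x).
    expX : ℕ → ℕ → Carrier
    expX c zero    = 1#
    expX c (suc n) = mul c (expX c n) * inv (suc n)

    𝕊mul-⊛ : ∀ c f g n → (𝕊.mul c f ⊛ g) n ≈ mul c ((f ⊛ g) n)
    𝕊mul-⊛ c f g n = trans (sym (𝕊.mul-*ˡ c f g .at n)) (mul-at c (f ⊛ g) n)

    LogDer-expX : ∀ c → LogDer (𝕊.mul c X) (expX c)
    LogDer-expX c .at zero = sym (trans (𝕊mul-⊛ c X (expX c) 0) (trans (mul-cong c (X-⊛ (expX c) .at 0)) (mul-0# c)))
    LogDer-expX c .at (suc n) = begin
      mul (suc n) (mul c (expX c n) * inv (suc n)) ≈⟨ mul-*ʳ (suc n) _ _ ⟩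
      mul c (expX c n) * mul (suc n) (inv (suc n)) ≈⟨ trans (*-congˡ (mul-inv (suc n))) (*-identityʳ _) ⟩
      mul c (expX c n)                             ≈⟨ mul-cong c (X-⊛ (expX c) .at (suc n)) ⟨
      mul c ((X ⊛ expX c) (suc n))                 ≈⟨ 𝕊mul-⊛ c X (expX c) (suc n) ⟨
      (𝕊.mul c X ⊛ expX c) (suc n) ∎

    -- For a = b = p, the coefficient of exp (p² x) is pⁿ times that of exp (p x). Given that the
    -- latter is integral at p, exp (p² x) is a polynomial modulo every power of p.
    expX-* : ∀ a b n → expX (a ℕ.* b) n ≈ mul (a ℕ.^ n) (expX b n)
    expX-* a b zero    = sym (+-identityʳ 1#)
    expX-* a b (suc n) = begin
      mul (a ℕ.* b) (expX (a ℕ.* b) n) * inv (suc n)        ≈⟨ *-congʳ (mul-cong (a ℕ.* b) (expX-* a b n)) ⟩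
      mul (a ℕ.* b) (mul (a ℕ.^ n) (expX b n)) * inv (suc n) ≈⟨ *-congʳ rearranged ⟩
      mul (a ℕ.^ suc n) (mul b (expX b n)) * inv (suc n)    ≈⟨ mul-*ˡ (a ℕ.^ suc n) _ _ ⟨
      mul (a ℕ.^ suc n) (mul b (expX b n) * inv (suc n)) ∎
      where
      rearranged : mul (a ℕ.* b) (mul (a ℕ.^ n) (expX b n)) ≈ mul (a ℕ.^ suc n) (mul b (expX b n))
      rearranged = begin
        mul (a ℕ.* b) (mul (a ℕ.^ n) (expX b n))   ≈⟨ mul-assoc-* (a ℕ.* b) (a ℕ.^ n) _ ⟨
        mul (a ℕ.* b ℕ.* a ℕ.^ n) (expX b n)       ≡⟨ ≡.cong (λ m → mul m (expX b n)) swap ⟩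
        mul (a ℕ.^ suc n ℕ.* b) (expX b n)         ≈⟨ mul-assoc-* (a ℕ.^ suc n) b _ ⟩
        mul (a ℕ.^ suc n) (mul b (expX b n)) ∎
        where
        swap : a ℕ.* b ℕ.* a ℕ.^ n ≡ a ℕ.^ suc n ℕ.* b
        swap = ≡.trans (ℕP.*-assoc a b (a ℕ.^ n)) (≡.trans (≡.cong (a ℕ.*_) (ℕP.*-comm b (a ℕ.^ n))) (≡.sym (ℕP.*-assoc a (a ℕ.^ n) b)))

    module _ (ℓ : ℕ → Carrier) (ℓ₀≈0 : ℓ 0 ≈ 0#) where

      exp : ℕ → Carrier
      exp n = ∑ (suc n) (λ k → 𝕊.pow ℓ k n * inv (k !))

      pow-< : ∀ k i → i ℕ.< k → 𝕊.pow ℓ k i ≈ 0#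
      pow-< (suc k) zero    i<k       = trans (*-congʳ ℓ₀≈0) (zeroˡ _)
      pow-< (suc k) (suc i) (s≤s i<k) = begin
        ℓ 0 * 𝕊.pow ℓ k (suc i) + (tail ℓ ⊛ 𝕊.pow ℓ k) i
          ≈⟨ +-cong (trans (*-congʳ ℓ₀≈0) (zeroˡ _)) (⊛-cong-≤ i (λ _ _ → refl) (λ j j≤i → pow-< k j (ℕP.≤-<-trans j≤i i<k))) ⟩
        0# + (tail ℓ ⊛ 𝟘) i  ≈⟨ trans (+-identityˡ _) (trans (⊛-comm (tail ℓ) 𝟘 i) (⊛-zeroˡ (tail ℓ) i)) ⟩
        0# ∎

      partialExp : ℕ → ℕ → Carrier
      partialExp K n = ∑ K (λ k → 𝕊.pow ℓ k n * inv (k !))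

      exp≈partialExp : ∀ K n → n ℕ.< K → exp n ≈ partialExp K n
      exp≈partialExp (suc K) n (s≤s n≤K) = go (ℕP.≤⇒≤′ n≤K)
        where
        go : ∀ {K} → n ℕ.≤′ K → exp n ≈ partialExp (suc K) n
        go ℕ.≤′-refl = refl
        go (ℕ.≤′-step {K} n≤′K) = trans (go n≤′K) (sym (trans (∑-last (suc K) (λ k → 𝕊.pow ℓ k n * inv (k !)))
          (trans (+-congˡ (trans (*-congʳ (pow-< (suc K) n (s≤s (ℕP.≤′⇒≤ n≤′K)))) (zeroˡ _))) (+-identityʳ _))))

      ⊛-∑ : ∀ K f (g : ℕ → ℕ → Carrier) (c : ℕ → Carrier) n → (f ⊛ (λ i → ∑ K (λ k → g k i * c k))) n ≈ ∑ K (λ k → (f ⊛ g k) n * c k)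
      ⊛-∑ zero    f g c n = trans (⊛-comm f 𝟘 n) (⊛-zeroˡ f n)
      ⊛-∑ (suc K) f g c n = begin
        (f ⊛ ((λ i → g 0 i * c 0) ⊕ rest)) n            ≈⟨ 𝕊R.distribˡ f _ _ .at n ⟩
        (f ⊛ (λ i → g 0 i * c 0)) n + (f ⊛ rest) n
          ≈⟨ +-cong (trans (⊛-cong-≤ n (λ _ _ → refl) (λ i _ → *-comm (g 0 i) (c 0)))
                      (trans (⊛-scaleʳ (c 0) f (g 0) n) (*-comm _ _)))
                    (⊛-∑ K f (g ∘ suc) (c ∘ suc) n) ⟩
        (f ⊛ g 0) n * c 0 + ∑ K (λ k → (f ⊛ g (suc k)) n * c (suc k)) ∎
        where
        rest : ℕ → Carrier
        rest i = ∑ K (λ k → g (suc k) i * c (suc k))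

      θ-pow : ∀ k → θ (𝕊.pow ℓ (suc k)) ≋ 𝕊.mul (suc k) (θ ℓ ⊛ 𝕊.pow ℓ k)
      θ-pow zero = ≋-trans (θ-cong (𝕊R.*-identityʳ ℓ)) (≋-sym (≋-trans (𝕊R.+-identityʳ _) (𝕊R.*-identityʳ (θ ℓ))))
      θ-pow (suc k) = ≋-trans (θ-⊛ ℓ (𝕊.pow ℓ (suc k))) (𝕊R.+-congˡ (≋-trans (𝕊R.*-congˡ (θ-pow k))
        (≋-trans (≋-sym (𝕊.mul-*ʳ (suc k) ℓ (θ ℓ ⊛ 𝕊.pow ℓ k))) (𝕊.mul-cong (suc k) (𝕊.*-leftComm ℓ (θ ℓ) (𝕊.pow ℓ k))))))

      mul-inv-! : ∀ k → mul (suc k) (inv (suc k !)) ≈ inv (k !)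
      mul-inv-! k = mul-cancel (k !) {{k ℕP.!≢0}} (begin
        mul (k !) (mul (suc k) (inv (suc k !))) ≈⟨ mul-assoc-* (k !) (suc k) _ ⟨
        mul (k ! ℕ.* suc k) (inv (suc k !))     ≡⟨ ≡.cong (λ m → mul m (inv (suc k !))) (ℕP.*-comm (k !) (suc k)) ⟩
        mul (suc k !) (inv (suc k !))           ≈⟨ mul-inv (suc k !) {{(suc k) ℕP.!≢0}} ⟩
        1#                                      ≈⟨ mul-inv (k !) {{k ℕP.!≢0}} ⟨
        mul (k !) (inv (k !)) ∎)

      θ-term : ∀ n k → mul n (𝕊.pow ℓ (suc k) n * inv (suc k !)) ≈ (θ ℓ ⊛ 𝕊.pow ℓ k) n * inv (k !)
      θ-term n k = begin
        mul n (𝕊.pow ℓ (suc k) n * inv (suc k !))              ≈⟨ mul-*ˡ n _ _ ⟩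
        θ (𝕊.pow ℓ (suc k)) n * inv (suc k !)                  ≈⟨ *-congʳ (trans (θ-pow k .at n) (mul-at (suc k) _ n)) ⟩
        mul (suc k) ((θ ℓ ⊛ 𝕊.pow ℓ k) n) * inv (suc k !)      ≈⟨ mul-*ˡ (suc k) _ _ ⟨
        mul (suc k) ((θ ℓ ⊛ 𝕊.pow ℓ k) n * inv (suc k !))      ≈⟨ mul-*ʳ (suc k) _ _ ⟩
        (θ ℓ ⊛ 𝕊.pow ℓ k) n * mul (suc k) (inv (suc k !))      ≈⟨ *-congˡ (mul-inv-! k) ⟩
        (θ ℓ ⊛ 𝕊.pow ℓ k) n * inv (k !) ∎

      LogDer-exp : LogDer (θ ℓ) exp
      LogDer-exp .at zero    = sym (zeroˡ _)
      LogDer-exp .at (suc n) = begin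
        mul m (𝟙 m * inv 1 + ∑ m (λ k → 𝕊.pow ℓ (suc k) m * inv (suc k !)))
          ≈⟨ mul-distrib-+ m _ _ ⟩
        mul m (0# * inv 1) + mul m (∑ m (λ k → 𝕊.pow ℓ (suc k) m * inv (suc k !)))
          ≈⟨ +-cong (trans (mul-cong m (zeroˡ _)) (mul-0# m)) (trans (mul-∑ m m (λ k → 𝕊.pow ℓ (suc k) m * inv (suc k !))) (∑-cong m (λ k _ → θ-term m k))) ⟩
        0# + ∑ m (λ k → (θ ℓ ⊛ 𝕊.pow ℓ k) m * inv (k !))
          ≈⟨ +-identityˡ _ ⟩
        ∑ m (λ k → (θ ℓ ⊛ 𝕊.pow ℓ k) m * inv (k !))
          ≈⟨ ⊛-∑ m (θ ℓ) (𝕊.pow ℓ) (λ k → inv (k !)) m ⟨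
        θ ℓ 0 * partialExp m m + (tail (θ ℓ) ⊛ partialExp m) n
          -- The truncation `partialExp m` agrees with `exp` below index `m` only; at index `m`
          -- itself both are multiplied by `θ ℓ 0`, which is zero.
          ≈⟨ +-cong (trans (zeroˡ _) (sym (zeroˡ _))) (⊛-cong-≤ n (λ _ _ → refl) (λ i i≤n → sym (exp≈partialExp m i (s≤s i≤n)))) ⟩
        θ ℓ 0 * exp m + (tail (θ ℓ) ⊛ exp) n ∎
        where m = suc n

-- Linear dependence of n + 1 vectors of length n, without fractions.

module LinearDependence (R : CommutativeRing 0ℓ 0ℓ) where
  open CommutativeRing R hiding (zero)
  open RingLaws R
  open NatSolver commutativeSemiring using (solve; _:=_; _:+_; _:*_)
  open SetoidReasoning setoid

  -- `P` cuts out a subring without zero divisors in which vanishing is decidable. It will be the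
  -- polynomials inside the ring of integer power series, where vanishing in general is not
  -- decidable.
  module Over (P : Carrier → Set) (P-0 : P 0#) (P-1 : P 1#)
    (P-+ : ∀ {x y} → P x → P y → P (x + y)) (P-* : ∀ {x y} → P x → P y → P (x * y))
    (P-neg : ∀ {x} → P x → P (- x))
    (zero? : ∀ {x} → P x → Dec (x ≈ 0#)) (1≉0 : ¬ 1# ≈ 0#)
    (*-nonzero : ∀ {x y} → P x → P y → ¬ x ≈ 0# → ¬ y ≈ 0# → ¬ x * y ≈ 0#) where

    P-∑ : ∀ n {f} → (∀ i → P (f i)) → P (∑ n f)
    P-∑ zero    Pf = P-0
    P-∑ (suc n) Pf = P-+ (Pf 0) (P-∑ n (Pf ∘ suc))

    record Dependence (n : ℕ) (a : ℕ → Fin n → Carrier) : Set where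
      field
        coeff    : ℕ → Carrier
        P-coeff  : ∀ i → P (coeff i)
        index    : ℕ
        index≤n  : index ℕ.≤ n
        nonzero  : ¬ coeff index ≈ 0#
        relation : ∀ j → ∑ (suc n) (λ i → coeff i * a i j) ≈ 0#

    -- Fraction-free elimination. If row 0 is not zero, its entry `a 0 k` is a pivot and the
    -- combined rows `b` vanish in column `k`. A dependence of them in the remaining columns is
    -- multiplied by the pivot, and the coefficient `- s` of row 0 compensates.
    dependence : ∀ n (a : ℕ → Fin n → Carrier) → (∀ i j → P (a i j)) → Dependence n a
    dependence zero a Pa = record
      { coeff = λ _ → 1# ; P-coeff = λ _ → P-1 ; index = 0 ; index≤n = z≤n ; nonzero = 1≉0 ; relation = λ () }
    dependence (suc n) a Pa with FinP.all? (λ j → zero? (Pa 0 j))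
    ... | yes a₀≈0 = record
      { coeff = cons 1# (λ _ → 0#) ; P-coeff = λ { zero → P-1 ; (suc _) → P-0 }
      ; index = 0 ; index≤n = z≤n ; nonzero = 1≉0
      ; relation = λ j → trans (+-cong (trans (*-identityˡ _) (a₀≈0 j)) (∑-zero (suc n) (λ i _ → zeroˡ (a (suc i) j)))) (+-identityˡ _) }
    ... | no a₀≉0 with FinP.¬∀⟶∃¬ (suc n) (λ j → a 0 j ≈ 0#) (λ j → zero? (Pa 0 j)) a₀≉0
    ... | k , a₀ₖ≉0 = record
      { coeff = cons (- s) (λ i → a 0 k * IH.coeff i)
      ; P-coeff = λ { zero → P-neg (P-∑ (suc n) (λ i → P-* (IH.P-coeff i) (Pa (suc i) k)))
                    ; (suc i) → P-* (Pa 0 k) (IH.P-coeff i) }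
      ; index = suc IH.index ; index≤n = s≤s IH.index≤n
      ; nonzero = *-nonzero (Pa 0 k) (IH.P-coeff _) a₀ₖ≉0 IH.nonzero
      ; relation = relation }
      where
      b : ℕ → Fin (suc n) → Carrier
      b i j = a 0 k * a (suc i) j + - (a (suc i) k * a 0 j)
      Pb : ∀ i j → P (b i j)
      Pb i j = P-+ (P-* (Pa 0 k) (Pa (suc i) j)) (P-neg (P-* (Pa (suc i) k) (Pa 0 j)))
      module IH = Dependence (dependence n (λ i j → b i (punchIn k j)) (λ i j → Pb i (punchIn k j)))
      s : Carrier
      s = ∑ (suc n) (λ i → IH.coeff i * a (suc i) k)
      bₖ≈0 : ∀ i → b i k ≈ 0#
      bₖ≈0 i = trans (+-congˡ (-‿cong (*-comm _ _))) (-‿inverseʳ _)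
      b-relation : ∀ j → ∑ (suc n) (λ i → IH.coeff i * b i j) ≈ 0#
      b-relation j with k Fin.≟ j
      ... | yes ≡.refl = ∑-zero (suc n) (λ i _ → trans (*-congˡ (bₖ≈0 i)) (zeroʳ (IH.coeff i)))
      ... | no k≢j = ≡.subst (λ l → ∑ (suc n) (λ i → IH.coeff i * b i l) ≈ 0#)
                       (FinP.punchIn-punchOut k≢j) (IH.relation (punchOut k≢j))
      relation : ∀ j → - s * a 0 j + ∑ (suc n) (λ i → (a 0 k * IH.coeff i) * a (suc i) j) ≈ 0#
      relation j = begin
        - s * a 0 j + ∑ (suc n) (λ i → (a 0 k * IH.coeff i) * a (suc i) j)
          ≈⟨ +-congˡ (∑-cong (suc n) (λ i _ → term i)) ⟩
        - s * a 0 j + ∑ (suc n) (λ i → IH.coeff i * b i j + (IH.coeff i * a (suc i) k) * a 0 j)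
          ≈⟨ +-congˡ (∑-+ (suc n) (λ i → IH.coeff i * b i j) (λ i → (IH.coeff i * a (suc i) k) * a 0 j)) ⟩
        - s * a 0 j + (∑ (suc n) (λ i → IH.coeff i * b i j) + ∑ (suc n) (λ i → (IH.coeff i * a (suc i) k) * a 0 j))
          ≈⟨ +-congˡ (+-cong (b-relation j) (sym (∑-*ʳ (suc n) (a 0 j) (λ i → IH.coeff i * a (suc i) k)))) ⟩
        - s * a 0 j + (0# + s * a 0 j) ≈⟨ +-congˡ (+-identityˡ _) ⟩
        - s * a 0 j + s * a 0 j        ≈⟨ distribʳ _ _ _ ⟨
        (- s + s) * a 0 j              ≈⟨ *-congʳ (-‿inverseˡ s) ⟩
        0# * a 0 j                     ≈⟨ zeroˡ _ ⟩
        0# ∎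
        where
        term : ∀ i → (a 0 k * IH.coeff i) * a (suc i) j ≈ IH.coeff i * b i j + (IH.coeff i * a (suc i) k) * a 0 j
        term i = sym (begin
          IH.coeff i * b i j + (IH.coeff i * a (suc i) k) * a 0 j
            ≈⟨ solve 6 (λ c x y w z n → (c :* (x :* y :+ n) :+ (c :* w) :* z) := ((x :* c) :* y :+ c :* (w :* z :+ n))) refl
                 (IH.coeff i) (a 0 k) (a (suc i) j) (a (suc i) k) (a 0 j) _ ⟩
          (a 0 k * IH.coeff i) * a (suc i) j + IH.coeff i * (a (suc i) k * a 0 j + - (a (suc i) k * a 0 j))
            ≈⟨ +-congˡ (trans (*-congˡ (-‿inverseʳ _)) (zeroʳ _)) ⟩
          (a 0 k * IH.coeff i) * a (suc i) j + 0# ≈⟨ +-identityʳ _ ⟩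
          (a 0 k * IH.coeff i) * a (suc i) j ∎)

-- Integers and integer power series modulo N, and polynomials among the series.

infix 4 _∣ℤ_
_∣ℤ_ : ℤ → ℤ → Set
_∣ℤ_ = ℤ∣._∣_

record Congruent (N a b : ℤ) : Set where
  constructor congruent
  field difference : N ∣ℤ a ℤ.- b
open Congruent

module _ (N : ℤ) where

  private
    ≡⇒≈ : ∀ {a b} → a ≡ b → Congruent N a b
    ≡⇒≈ {a} ≡.refl = congruent (divides 0ℤ (ℤP.+-inverseʳ a))

    ≈-sym : ∀ {a b} → Congruent N a b → Congruent N b a
    ≈-sym {a} {b} (congruent (divides q eq)) = congruent (divides (ℤ.- q)
      (≡.trans (lemma a b) (≡.trans (≡.cong ℤ.-_ eq) (ℤP.neg-distribˡ-* q N))))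
      where
      lemma : ∀ a b → b ℤ.- a ≡ ℤ.- (a ℤ.- b)
      lemma = solve-∀

    ≈-trans : ∀ {a b c} → Congruent N a b → Congruent N b c → Congruent N a c
    ≈-trans {a} {b} {c} (congruent d) (congruent d′) =
      congruent (≡.subst (N ∣ℤ_) (lemma a b c) (ℤ∣.∣m∣n⇒∣m+n d d′))
      where
      lemma : ∀ a b c → (a ℤ.- b) ℤ.+ (b ℤ.- c) ≡ a ℤ.- c
      lemma = solve-∀

    ≈-+ : ∀ {a b c d} → Congruent N a b → Congruent N c d → Congruent N (a ℤ.+ c) (b ℤ.+ d)
    ≈-+ {a} {b} {c} {d} (congruent e) (congruent e′) =
      congruent (≡.subst (N ∣ℤ_) (lemma a b c d) (ℤ∣.∣m∣n⇒∣m+n e e′))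
      where
      lemma : ∀ a b c d → (a ℤ.- b) ℤ.+ (c ℤ.- d) ≡ (a ℤ.+ c) ℤ.- (b ℤ.+ d)
      lemma = solve-∀

    ≈-* : ∀ {a b c d} → Congruent N a b → Congruent N c d → Congruent N (a ℤ.* c) (b ℤ.* d)
    ≈-* {a} {b} {c} {d} (congruent e) (congruent e′) =
      congruent (≡.subst (N ∣ℤ_) (lemma a b c d) (ℤ∣.∣m∣n⇒∣m+n (ℤ∣.∣n⇒∣m*n c e) (ℤ∣.∣n⇒∣m*n b e′)))
      where
      lemma : ∀ a b c d → c ℤ.* (a ℤ.- b) ℤ.+ b ℤ.* (c ℤ.- d) ≡ a ℤ.* c ℤ.- b ℤ.* d
      lemma = solve-∀

    ≈-neg : ∀ {a b} → Congruent N a b → Congruent N (ℤ.- a) (ℤ.- b)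
    ≈-neg {a} {b} (congruent e) = congruent (≡.subst (N ∣ℤ_) (lemma a b) (ℤ∣.∣m⇒∣-m e))
      where
      lemma : ∀ a b → ℤ.- (a ℤ.- b) ≡ ℤ.- a ℤ.- (ℤ.- b)
      lemma = solve-∀

  -- The case `N = 0ℤ` is the ring of integers itself, so exact identities are handled by the same
  -- theory as congruences and can be weakened to any modulus.
  ℤmod : CommutativeRing 0ℓ 0ℓ
  ℤmod = record
    { Carrier = ℤ ; _≈_ = Congruent N ; _+_ = ℤ._+_ ; _*_ = ℤ._*_ ; -_ = ℤ.-_ ; 0# = 0ℤ ; 1# = 1ℤ
    ; isCommutativeRing = record
      { isRing = record
        { +-isAbelianGroup = record
          { isGroup = record
            { isMonoid = record
              { isSemigroup = record
                { isMagma = record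
                  { isEquivalence = record { refl = ≡⇒≈ ≡.refl ; sym = ≈-sym ; trans = ≈-trans }
                  ; ∙-cong = ≈-+ }
                ; assoc = λ a b c → ≡⇒≈ (ℤP.+-assoc a b c) }
              ; identity = (λ a → ≡⇒≈ (ℤP.+-identityˡ a)) , (λ a → ≡⇒≈ (ℤP.+-identityʳ a)) }
            ; inverse = (λ a → ≡⇒≈ (ℤP.+-inverseˡ a)) , (λ a → ≡⇒≈ (ℤP.+-inverseʳ a))
            ; ⁻¹-cong = ≈-neg }
          ; comm = λ a b → ≡⇒≈ (ℤP.+-comm a b) }
        ; *-cong = ≈-*
        ; *-assoc = λ a b c → ≡⇒≈ (ℤP.*-assoc a b c)
        ; *-identity = (λ a → ≡⇒≈ (ℤP.*-identityˡ a)) , (λ a → ≡⇒≈ (ℤP.*-identityʳ a))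
        ; distrib = (λ a b c → ≡⇒≈ (ℤP.*-distribˡ-+ a b c)) , (λ a b c → ≡⇒≈ (ℤP.*-distribʳ-+ a b c)) }
      ; *-comm = λ a b → ≡⇒≈ (ℤP.*-comm a b) } }

  ≡⇒Congruent : ∀ {a b} → a ≡ b → Congruent N a b
  ≡⇒Congruent = ≡⇒≈

Series : Set
Series = ℕ → ℤ

open SeriesOps ℤ._+_ ℤ._*_ ℤ.-_ 0ℤ 1ℤ public
open RingOps _⊕_ _⊛_ 𝟘 𝟙 public

infix 4 _≈[_]_
_≈[_]_ : Series → ℤ → Series → Set
f ≈[ N ] g = SeriesRing._≋_ (ℤmod N) f g

∣⇒≈0 : ∀ {N a} → N ∣ℤ a → Congruent N a 0ℤ
∣⇒≈0 {N} {a} d = congruent (≡.subst (N ∣ℤ_) (≡.sym (ℤP.+-identityʳ a)) d)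

≈0⇒∣ : ∀ {N a} → Congruent N a 0ℤ → N ∣ℤ a
≈0⇒∣ {N} {a} (congruent d) = ≡.subst (N ∣ℤ_) (ℤP.+-identityʳ a) d

congruent? : ∀ N a → Dec (Congruent N a 0ℤ)
congruent? N a = Dec.map′ ∣⇒≈0 ≈0⇒∣ (N ℤ∣.∣? a)

≈[0]⇒≡ : ∀ {a b} → Congruent 0ℤ a b → a ≡ b
≈[0]⇒≡ {a} {b} (congruent d) = ℤP.i-j≡0⇒i≡j a b (ℤ∣.0∣⇒≡0 d)

weaken : ∀ {N N′ f g} → N ∣ℤ N′ → f ≈[ N′ ] g → f ≈[ N ] g
weaken N∣N′ eq = pointwise λ n → congruent (ℤ∣.∣-trans N∣N′ (difference (eq .at n)))
  where open SeriesRing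

exact : ∀ {N f g} → f ≈[ 0ℤ ] g → f ≈[ N ] g
exact = weaken (divides 0ℤ ≡.refl)

-- A polynomial. The explicit bound makes vanishing modulo `N` a finite check, and the coefficients
-- beyond it are equal to zero, not merely congruent to it.
record Bounded (f : Series) : Set where
  constructor bounded
  field
    bound    : ℕ
    vanishes : ∀ n → bound ℕ.≤ n → f n ≡ 0ℤ
open Bounded public

bounded-𝟘 : Bounded 𝟘
bounded-𝟘 = bounded 0 λ _ _ → ≡.refl

bounded-const : ∀ c → Bounded (const c)
bounded-const c = bounded 1 λ { (suc n) _ → ≡.refl }

bounded-⊕ : ∀ {f g} → Bounded f → Bounded g → Bounded (f ⊕ g)
bounded-⊕ (bounded D v) (bounded D′ v′) = bounded (D ℕ.⊔ D′) λ n le →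
  ≡.cong₂ ℤ._+_ (v n (ℕP.m⊔n≤o⇒m≤o D D′ le)) (v′ n (ℕP.m⊔n≤o⇒n≤o D D′ le))

bounded-⊝ : ∀ {f} → Bounded f → Bounded (⊝ f)
bounded-⊝ (bounded D v) = bounded D λ n le → ≡.cong ℤ.-_ (v n le)

⊛-vanishes : ∀ D D′ f g → (∀ n → D ℕ.≤ n → f n ≡ 0ℤ) → (∀ n → D′ ℕ.≤ n → g n ≡ 0ℤ) →
             ∀ n → D ℕ.+ D′ ℕ.≤ n → (f ⊛ g) n ≡ 0ℤ
⊛-vanishes zero D′ f g v v′ n le = go f (λ n → v n z≤n) n
  where
  go : ∀ f → (∀ n → f n ≡ 0ℤ) → ∀ n → (f ⊛ g) n ≡ 0ℤ
  go f v zero    = ≡.cong (ℤ._* g 0) (v 0)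
  go f v (suc n) = ≡.cong₂ ℤ._+_ (≡.cong (ℤ._* g (suc n)) (v 0)) (go (tail f) (v ∘ suc) n)
⊛-vanishes (suc D) D′ f g v v′ (suc n) (s≤s le) = ≡.cong₂ ℤ._+_
  (≡.trans (≡.cong (f 0 ℤ.*_) (v′ (suc n) (ℕP.m≤n⇒m≤1+n (ℕP.m+n≤o⇒n≤o D le)))) (ℤP.*-zeroʳ (f 0)))
  (⊛-vanishes D D′ (tail f) g (λ n le → v (suc n) (s≤s le)) v′ n le)

bounded-⊛ : ∀ {f g} → Bounded f → Bounded g → Bounded (f ⊛ g)
bounded-⊛ {f} {g} (bounded D v) (bounded D′ v′) = bounded (D ℕ.+ D′) (⊛-vanishes D D′ f g v v′)

bounded-pow : ∀ {f} n → Bounded f → Bounded (pow f n)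
bounded-pow zero    b = bounded-const 1ℤ
bounded-pow (suc n) b = bounded-⊛ b (bounded-pow n b)

bounded-θ : ∀ {f} → Bounded f → Bounded (θ f)
bounded-θ (bounded D v) = bounded D λ n le → ≡.trans (≡.cong (RingOps.mul ℤ._+_ ℤ._*_ 0ℤ 1ℤ n) (v n le)) (mul-0 n)
  where
  mul-0 : ∀ n → RingOps.mul ℤ._+_ ℤ._*_ 0ℤ 1ℤ n 0ℤ ≡ 0ℤ
  mul-0 zero    = ≡.refl
  mul-0 (suc n) = ≡.trans (ℤP.+-identityˡ _) (mul-0 n)

bounded-mul : ∀ n {f} → Bounded f → Bounded (mul n f)
bounded-mul zero    b = bounded-𝟘
bounded-mul (suc n) b = bounded-⊕ b (bounded-mul n b)

bounded-cons : ∀ {f a} → Bounded f → (∀ j → Bounded (a j)) → ∀ j → Bounded (cons f a j)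
bounded-cons b bs zero    = b
bounded-cons b bs (suc j) = bs j

≈𝟘? : ∀ N {f} → Bounded f → Dec (f ≈[ N ] 𝟘)
≈𝟘? N {f} (bounded D v) with ℕP.allUpTo? (λ n → congruent? N (f n)) D
... | no ¬all = no λ eq → ¬all λ {n} _ → SeriesRing.at eq n
... | yes all = yes (pointwise λ n → helper n (n ℕP.<? D))
  where
  open SeriesRing
  helper : ∀ n → Dec (n ℕ.< D) → Congruent N (f n) 0ℤ
  helper n (yes n<D) = all n<D
  helper n (no  n≮D) = ≡⇒Congruent N (v n (ℕP.≮⇒≥ n≮D))

≉𝟘⇒∃ : ∀ N {f} → Bounded f → ¬ f ≈[ N ] 𝟘 → ∃ λ n → ¬ Congruent N (f n) 0ℤ
≉𝟘⇒∃ N {f} (bounded D v) f≉0 with ℕP.anyUpTo? (λ n → Dec.¬? (congruent? N (f n))) D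
... | yes (n , _ , ne) = n , ne
... | no none = ⊥-elim (f≉0 (pointwise λ n → helper n (n ℕP.<? D)))
  where
  open SeriesRing
  helper : ∀ n → Dec (n ℕ.< D) → Congruent N (f n) 0ℤ
  helper n (yes n<D) = Dec.decidable-stable (congruent? N (f n)) (λ ne → none (n , n<D , ne))
  helper n (no  n≮D) = ≡⇒Congruent N (v n (ℕP.≮⇒≥ n≮D))

open SeriesRing using (at; pointwise)

infixl 7 _∙_
_∙_ : ℤ → Series → Series
(c ∙ f) n = c ℤ.* f n

∙-⊛ : ∀ {N} c f g → f ⊛ (c ∙ g) ≈[ N ] c ∙ (f ⊛ g)
∙-⊛ {N} c f g = pointwise (SeriesRing.⊛-scaleʳ (ℤmod N) c f g)

const-∙ : ∀ {N} c f → const c ⊛ f ≈[ N ] c ∙ f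
const-∙ {N} c f = pointwise (SeriesRing.const-⊛ (ℤmod N) c f)

∙-mono : ∀ c {N f} → f ≈[ N ] 𝟘 → c ∙ f ≈[ c ℤ.* N ] 𝟘
∙-mono c eq = pointwise λ n → ∣⇒≈0 (ℤ∣.*-monoʳ-∣ c (≈0⇒∣ (eq .at n)))

∙-cancel : ∀ c .{{_ : ℤ.NonZero c}} {N f} → c ∙ f ≈[ c ℤ.* N ] 𝟘 → f ≈[ N ] 𝟘
∙-cancel c eq = pointwise λ n → ∣⇒≈0 (ℤ∣.*-cancelˡ-∣ c (≈0⇒∣ (eq .at n)))

quotient-series : ∀ {N f} → f ≈[ N ] 𝟘 → ∃ λ g → ∀ {M} → f ≈[ M ] N ∙ g
quotient-series {N} {f} eq = (λ n → ℤ∣.quotient (≈0⇒∣ (eq .at n))) , λ {M} → pointwise λ n →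
  ≡⇒Congruent M (≡.trans (ℤ∣._∣_.equality (≈0⇒∣ (eq .at n))) (ℤP.*-comm _ N))

-- Covers both kinds of modulus under which series have no zero divisors here: `+ p` and `0ℤ`.
PrimeIdeal : ℤ → Set
PrimeIdeal N = ∀ a b → N ∣ℤ a ℤ.* b → N ∣ℤ a ⊎ N ∣ℤ b

primeIdeal-0 : PrimeIdeal 0ℤ
primeIdeal-0 a b 0∣ab with ℤP.i*j≡0⇒i≡0∨j≡0 a {b} (ℤ∣.0∣⇒≡0 0∣ab)
... | inj₁ eq = inj₁ (divides 0ℤ eq)
... | inj₂ eq = inj₂ (divides 0ℤ eq)

primeIdeal-p : ∀ {p} → Prime p → PrimeIdeal (+ p)
primeIdeal-p {p} pr a b p∣ab = Sum.map ℤ∣.∣ᵤ⇒∣ ℤ∣.∣ᵤ⇒∣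
  (euclidsLemma ℤ.∣ a ∣ ℤ.∣ b ∣ pr (≡.subst (p ℕ∣.∣_) (ℤP.abs-* a b) (ℤ∣.∣⇒∣ᵤ p∣ab)))

module _ {N : ℤ} (N-prime : PrimeIdeal N) where

  private
    cancel : ∀ a b → ¬ Congruent N a 0ℤ → Congruent N (a ℤ.* b) 0ℤ → Congruent N b 0ℤ
    cancel a b a≉0 ab≈0 with N-prime a b (≈0⇒∣ ab≈0)
    ... | inj₁ N∣a = ⊥-elim (a≉0 (∣⇒≈0 N∣a))
    ... | inj₂ N∣b = ∣⇒≈0 N∣b

  open SeriesRing.Domain (ℤmod N) (congruent? N) cancel public using (⊛-cancel; ⊛-nonzero)

𝟙≉𝟘 : ¬ 𝟙 ≈[ 0ℤ ] 𝟘
𝟙≉𝟘 eq with ≈[0]⇒≡ (eq .at 0)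
... | ()

module Dependent = LinearDependence.Over (SeriesRing.seriesRing (ℤmod 0ℤ)) Bounded
  bounded-𝟘 (bounded-const 1ℤ) bounded-⊕ bounded-⊛ bounded-⊝ (≈𝟘? 0ℤ)
  𝟙≉𝟘 (λ _ _ → ⊛-nonzero primeIdeal-0)

-- Series modulo p and its powers; dependences that are nontrivial modulo p.

module PrimeModulus (p : ℕ) (p-prime : Prime p) where

  private
    instance
      p≢0 : NonZero p
      p≢0 = prime⇒nonZero p-prime

  open FrobeniusOps {A = ℤ} 0ℤ p public

  infix 9 p^_
  p^_ : ℕ → ℤ
  p^ n = (+ p) ℤ.^ n

  p-ideal : PrimeIdeal (+ p)
  p-ideal = primeIdeal-p p-prime

  infix 4 _≈ₚ_ _≈₀_
  _≈ₚ_ _≈₀_ : Series → Series → Set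
  f ≈ₚ g = f ≈[ + p ] g
  f ≈₀ g = f ≈[ 0ℤ ] g

  module ℤₚ = CommutativeRing (ℤmod (+ p))
  module 𝔽 = SeriesRing (ℤmod (+ p))
  module 𝔼 = SeriesRing (ℤmod 0ℤ)

  p>1 : 1 ℕ.< p
  p>1 = ℕ.nonTrivial⇒n>1 p {{prime⇒nonTrivial p-prime}}

  n<p^n : ∀ n → n ℕ.< p ℕ.^ n
  n<p^n zero    = s≤s z≤n
  n<p^n (suc n) = ℕP.<-≤-trans (ℕP.≤-<-trans (n<p^n n) (ℕP.m<m*n (p ℕ.^ n) p {{ℕP.m^n≢0 p n}} p>1))
    (ℕP.≤-reflexive (ℕP.*-comm (p ℕ.^ n) p))

  1≢0-mod-p : ¬ Congruent (+ p) 1ℤ 0ℤ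
  1≢0-mod-p eq = ℕP.<⇒≱ p>1 (ℕ∣.∣⇒≤ (ℤ∣.∣⇒∣ᵤ (≈0⇒∣ eq)))

  𝟙≉ₚ𝟘 : ¬ 𝟙 ≈ₚ 𝟘
  𝟙≉ₚ𝟘 eq = 1≢0-mod-p (eq .at 0)

  pow-nonzero : ∀ {z} n → ¬ z ≈ₚ 𝟘 → ¬ pow z n ≈ₚ 𝟘
  pow-nonzero zero    z≉0 = 𝟙≉ₚ𝟘
  pow-nonzero (suc n) z≉0 = ⊛-nonzero p-ideal z≉0 (pow-nonzero n z≉0)

  p^≢0 : ∀ n → ℤ.NonZero (p^ n)
  p^≢0 zero    = _
  p^≢0 (suc n) = ℤP.i*j≢0 (+ p) (p^ n) {{p≢0}} {{p^≢0 n}}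

  p∣p^ : ∀ n → + p ∣ℤ p^ (suc n)
  p∣p^ n = ℤ∣.∣m⇒∣m*n (p^ n) ℤ∣.∣-refl

  -- Modulo p there are no zero divisors, so `g` is p times some `h`; dividing the product by p
  -- lowers the exponent, and the induction applies to `h`.
  ⊛-cancel-p^ : ∀ M {f g} → ¬ f ≈ₚ 𝟘 → f ⊛ g ≈[ p^ M ] 𝟘 → g ≈[ p^ M ] 𝟘
  ⊛-cancel-p^ zero {g = g} f≉0 fg≈0 = pointwise λ n → ∣⇒≈0 (divides (g n) (≡.sym (ℤP.*-identityʳ (g n))))
  ⊛-cancel-p^ (suc M) {f} {g} f≉0 fg≈0 = ≋-trans g≈ph (∙-mono (+ p) (⊛-cancel-p^ M f≉0 (∙-cancel (+ p)
    (≋-trans (≋-sym (∙-⊛ (+ p) f h)) (≋-trans (⊛-cong ≋-refl (≋-sym g≈ph)) fg≈0)))))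
    where
    open SeriesRing (ℤmod (p^ (suc M))) using (≋-refl; ≋-sym; ≋-trans; ⊛-cong)
    divided : ∃ λ h → ∀ {N} → g ≈[ N ] (+ p) ∙ h
    divided = quotient-series (⊛-cancel p-ideal f≉0 (weaken (p∣p^ M) fg≈0))
    h = proj₁ divided
    g≈ph : g ≈[ p^ (suc M) ] (+ p) ∙ h
    g≈ph = proj₂ divided

  record PrimitiveDependence (n : ℕ) (a : ℕ → Fin n → Series) : Set where
    field
      coeff         : ℕ → Series
      bounded-coeff : ∀ i → Bounded (coeff i)
      primitive-at  : ∃ λ i → i ℕ.≤ n × ¬ coeff i ≈ₚ 𝟘
      relation      : ∀ j → ∑ (suc n) (λ i → coeff i ⊛ a i j) ≈₀ 𝟘

  private
    -- The fallback value `0ℤ` makes division by p total, so that it can be applied coefficientwise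
    -- to a whole family of series, of which only those with index up to `n` are known to be
    -- divisible.
    divide : ℤ → ℤ
    divide a with (+ p) ℤ∣.∣? a
    ... | yes (divides q _) = q
    ... | no  _             = 0ℤ

    divide-≡ : ∀ {a} → (+ p) ∣ℤ a → a ≡ divide a ℤ.* + p
    divide-≡ {a} p∣a with (+ p) ℤ∣.∣? a
    ... | yes (divides q eq) = eq
    ... | no  p∤a            = ⊥-elim (p∤a p∣a)

    divide-0 : divide 0ℤ ≡ 0ℤ
    divide-0 = ℤP.*-cancelʳ-≡ (divide 0ℤ) 0ℤ (+ p) (≡.sym (divide-≡ (divides 0ℤ ≡.refl)))

    divide-< : ∀ {a} → (+ p) ∣ℤ a → ¬ a ≡ 0ℤ → ℤ.∣ divide a ∣ ℕ.< ℤ.∣ a ∣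
    divide-< {a} p∣a a≢0 = ≡.subst (ℤ.∣ divide a ∣ ℕ.<_) (≡.sym ∣a∣≡)
      (ℕP.m<m*n ℤ.∣ divide a ∣ p {{ℕ.≢-nonZero q≢0}} (ℕ.nonTrivial⇒n>1 p {{prime⇒nonTrivial p-prime}}))
      where
      ∣a∣≡ : ℤ.∣ a ∣ ≡ ℤ.∣ divide a ∣ ℕ.* p
      ∣a∣≡ = ≡.trans (≡.cong ℤ.∣_∣ (divide-≡ p∣a)) (ℤP.abs-* (divide a) (+ p))
      q≢0 : ¬ ℤ.∣ divide a ∣ ≡ 0
      q≢0 eq = a≢0 (ℤP.∣i∣≡0⇒i≡0 (≡.trans ∣a∣≡ (≡.cong (ℕ._* p) eq)))

  -- A nontrivial dependence over the integers is divided by p as long as all its coefficients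
  -- vanish modulo p. This stops because the absolute value of one fixed nonzero integer, the entry
  -- `c k m`, decreases each time.
  primitiveDependence : ∀ n (a : ℕ → Fin n → Series) → (∀ i j → Bounded (a i j)) → PrimitiveDependence n a
  primitiveDependence n a ba =
    let m , c≢0 = ≉𝟘⇒∃ 0ℤ (P-coeff index) nonzero
    in go coeff P-coeff index index≤n m (c≢0 ∘ ≡⇒Congruent 0ℤ) relation (<-wellFounded _)
    where
    open Dependent.Dependence (Dependent.dependence n a ba)
    go : ∀ (c : ℕ → Series) → (∀ i → Bounded (c i)) → ∀ k → k ℕ.≤ n → ∀ m → ¬ c k m ≡ 0ℤ →
         (∀ j → ∑ (suc n) (λ i → c i ⊛ a i j) ≈₀ 𝟘) → Acc ℕ._<_ ℤ.∣ c k m ∣ → PrimitiveDependence n a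
    go c bc k k≤n m ckm≢0 rel (acc rec) with ℕP.anyUpTo? (λ i → Dec.¬? (≈𝟘? (+ p) (bc i))) (suc n)
    ... | yes (i , s≤s i≤n , ci≉0) = record
      { coeff = c ; bounded-coeff = bc ; primitive-at = i , i≤n , ci≉0 ; relation = rel }
    ... | no none = go c′ bc′ k k≤n m
        (λ eq → ckm≢0 (≡.trans (c≡ k (s≤s k≤n) m) (≡.cong (ℤ._* + p) eq))) rel′
        (rec (divide-< (≈0⇒∣ (c≈0 k (s≤s k≤n) .at m)) ckm≢0))
      where
      open SetoidReasoning 𝔼.𝕊R.setoid
      c≈0 : ∀ i → i ℕ.< suc n → c i ≈ₚ 𝟘
      c≈0 i i<n = Dec.decidable-stable (≈𝟘? (+ p) (bc i)) (λ ci≉0 → none (i , i<n , ci≉0))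
      c′ : ℕ → Series
      c′ i l = divide (c i l)
      c≡ : ∀ i → i ℕ.< suc n → ∀ l → c i l ≡ c′ i l ℤ.* + p
      c≡ i i<n l = divide-≡ (≈0⇒∣ (c≈0 i i<n .at l))
      bc′ : ∀ i → Bounded (c′ i)
      bc′ i = bounded (bound (bc i)) λ l le → ≡.trans (≡.cong divide (vanishes (bc i) l le)) divide-0
      rel′ : ∀ j → ∑ (suc n) (λ i → c′ i ⊛ a i j) ≈₀ 𝟘
      -- The divided relation is exact: p times it is the old one, and cancelling p from a multiple
      -- of p · 0 leaves the modulus 0.
      rel′ j = ∙-cancel (+ p) {f = ∑ (suc n) (λ i → c′ i ⊛ a i j)} (≡.subst (λ N → (+ p) ∙ ∑ (suc n) (λ i → c′ i ⊛ a i j) ≈[ N ] 𝟘) (≡.sym (ℤP.*-zeroʳ (+ p))) (begin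
        (+ p) ∙ ∑ (suc n) (λ i → c′ i ⊛ a i j)        ≈⟨ const-∙ (+ p) _ ⟨
        const (+ p) ⊛ ∑ (suc n) (λ i → c′ i ⊛ a i j)  ≈⟨ 𝔼.𝕊.∑-*ˡ (suc n) (const (+ p)) (λ i → c′ i ⊛ a i j) ⟩
        ∑ (suc n) (λ i → const (+ p) ⊛ (c′ i ⊛ a i j))
          ≈⟨ 𝔼.𝕊.∑-cong (suc n) (λ i i<n → 𝔼.≋-trans (𝔼.≋-sym (𝔼.𝕊R.*-assoc (const (+ p)) (c′ i) (a i j))) (𝔼.⊛-cong (scaled i i<n) (𝔼.≋-refl {f = a i j}))) ⟩
        ∑ (suc n) (λ i → c i ⊛ a i j)                 ≈⟨ rel j ⟩
        𝟘 ∎))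
        where
        scaled : ∀ i → i ℕ.< suc n → const (+ p) ⊛ c′ i ≈₀ c i
        scaled i i<n = 𝔼.≋-trans (const-∙ (+ p) (c′ i)) (pointwise λ l →
          ≡⇒Congruent 0ℤ (≡.trans (ℤP.*-comm (+ p) _) (≡.sym (c≡ i i<n l))))

-- Pseudo-division by a polynomial and polynomial multiples of prescribed shape.

module Elimination (p : ℕ) (p-prime : Prime p) where
  open PrimeModulus p p-prime

  module _ (d : ℕ) (q : ℕ → Series) (bounded-q : ∀ j → Bounded (q j)) (q-lead : ¬ q (suc d) ≈ₚ 𝟘) where

    -- Pseudo-division of `f` by the polynomial with coefficients `q`. The factor `γ` gathers the
    -- powers of the leading coefficient, which is only known to be nonzero modulo p. The identity
    -- is exact and holds at every `x`, so it can be read at several points and for several moduli.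
    -- Of the quotient `B` only `B-cong` will be used, to compare its values at points congruent
    -- modulo p.
    record Reducible (f : Series → Series) : Set where
      field
        γ           : Series
        bounded-γ   : Bounded γ
        γ≉0         : ¬ γ ≈ₚ 𝟘
        B           : Series → Series
        B-cong      : ∀ {x y} → x ≈ₚ y → B x ≈ₚ B y
        r           : ℕ → Series
        bounded-r   : ∀ j → Bounded (r j)
        division    : ∀ x → γ ⊛ f x ≈₀ eval (suc (suc d)) q x ⊛ B x ⊕ eval (suc d) r x

    open Reducible

    reducible-𝟙 : Reducible (λ _ → 𝟙)
    reducible-𝟙 = record
      { γ = 𝟙 ; bounded-γ = bounded-const 1ℤ ; γ≉0 = 𝟙≉ₚ𝟘
      ; B = λ _ → 𝟘 ; B-cong = λ _ → 𝔽.≋-refl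
      ; r = cons 𝟙 (λ _ → 𝟘) ; bounded-r = bounded-cons (bounded-const 1ℤ) (λ _ → bounded-𝟘)
      ; division = λ x → 𝔼.𝕊.division-𝟙 d (eval (suc (suc d)) q x) x }

    reducible-𝟘 : Reducible (λ _ → 𝟘)
    reducible-𝟘 = record
      { γ = 𝟙 ; bounded-γ = bounded-const 1ℤ ; γ≉0 = 𝟙≉ₚ𝟘
      ; B = λ _ → 𝟘 ; B-cong = λ _ → 𝔽.≋-refl
      ; r = λ _ → 𝟘 ; bounded-r = λ _ → bounded-𝟘
      ; division = λ x → 𝔼.𝕊.division-𝟘 d (eval (suc (suc d)) q x) x }

    reducible-x* : ∀ {f} → Reducible f → Reducible (λ x → x ⊛ f x)
    reducible-x* {f} ρ = record
      { γ = q (suc d) ⊛ γ ρ ; bounded-γ = bounded-⊛ (bounded-q (suc d)) (bounded-γ ρ)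
      ; γ≉0 = ⊛-nonzero p-ideal q-lead (γ≉0 ρ)
      ; B = λ x → q (suc d) ⊛ (x ⊛ B ρ x) ⊕ r ρ d
      ; B-cong = λ eq → 𝔽.𝕊R.+-congʳ (𝔽.𝕊R.*-congˡ (𝔽.𝕊R.*-cong eq (B-cong ρ eq)))
      ; r = λ j → q (suc d) ⊛ cons 𝟘 (r ρ) j ⊕ (⊝ r ρ d) ⊛ q j
      ; bounded-r = λ j → bounded-⊕ (bounded-⊛ (bounded-q (suc d)) (bounded-cons bounded-𝟘 (bounded-r ρ) j))
                                    (bounded-⊛ (bounded-⊝ (bounded-r ρ d)) (bounded-q j))
      ; division = λ x → 𝔼.𝕊.division-step d q (r ρ) (γ ρ) (f x) (B ρ x) x (division ρ x) }

    reducible-*ˡ : ∀ {s f} → Bounded s → Reducible f → Reducible (λ x → s ⊛ f x)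
    reducible-*ˡ {s} {f} bs ρ = record
      { γ = γ ρ ; bounded-γ = bounded-γ ρ ; γ≉0 = γ≉0 ρ
      ; B = λ x → s ⊛ B ρ x ; B-cong = λ eq → 𝔽.𝕊R.*-congˡ (B-cong ρ eq)
      ; r = λ j → s ⊛ r ρ j ; bounded-r = λ j → bounded-⊛ bs (bounded-r ρ j)
      ; division = λ x → begin
          γ ρ ⊛ (s ⊛ f x)                                   ≈⟨ 𝔼.𝕊.*-leftComm (γ ρ) s (f x) ⟩
          s ⊛ (γ ρ ⊛ f x)                                   ≈⟨ 𝔼.𝕊R.*-congˡ (division ρ x) ⟩
          s ⊛ (eval (suc (suc d)) q x ⊛ B ρ x ⊕ eval (suc d) (r ρ) x) ≈⟨ 𝔼.𝕊R.distribˡ s _ _ ⟩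
          s ⊛ (eval (suc (suc d)) q x ⊛ B ρ x) ⊕ s ⊛ eval (suc d) (r ρ) x
            ≈⟨ 𝔼.𝕊R.+-cong (𝔼.𝕊.*-leftComm s (eval (suc (suc d)) q x) (B ρ x)) (𝔼.≋-sym (𝔼.𝕊.eval-*ˡ (suc d) s (r ρ) x)) ⟩
          eval (suc (suc d)) q x ⊛ (s ⊛ B ρ x) ⊕ eval (suc d) (λ j → s ⊛ r ρ j) x ∎ }
      where open SetoidReasoning 𝔼.𝕊R.setoid

    reducible-⊕ : ∀ {f g} → Reducible f → Reducible g → Reducible (λ x → f x ⊕ g x)
    reducible-⊕ {f} {g} ρ ρ′ = record
      { γ = γ ρ ⊛ γ ρ′ ; bounded-γ = bounded-⊛ (bounded-γ ρ) (bounded-γ ρ′) ; γ≉0 = ⊛-nonzero p-ideal (γ≉0 ρ) (γ≉0 ρ′)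
      ; B = λ x → γ ρ′ ⊛ B ρ x ⊕ γ ρ ⊛ B ρ′ x
      ; B-cong = λ eq → 𝔽.𝕊R.+-cong (𝔽.𝕊R.*-congˡ (B-cong ρ eq)) (𝔽.𝕊R.*-congˡ (B-cong ρ′ eq))
      ; r = λ j → γ ρ′ ⊛ r ρ j ⊕ γ ρ ⊛ r ρ′ j
      ; bounded-r = λ j → bounded-⊕ (bounded-⊛ (bounded-γ ρ′) (bounded-r ρ j)) (bounded-⊛ (bounded-γ ρ) (bounded-r ρ′ j))
      ; division = λ x → begin
          γ ρ ⊛ γ ρ′ ⊛ (f x ⊕ g x)
            ≈⟨ 𝔼.𝕊.pair-expand (γ ρ) (γ ρ′) (f x) (g x) ⟩
          γ ρ′ ⊛ (γ ρ ⊛ f x) ⊕ γ ρ ⊛ (γ ρ′ ⊛ g x)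
            ≈⟨ 𝔼.𝕊R.+-cong (𝔼.𝕊R.*-congˡ (division ρ x)) (𝔼.𝕊R.*-congˡ (division ρ′ x)) ⟩
          γ ρ′ ⊛ (Q x ⊛ B ρ x ⊕ eval (suc d) (r ρ) x) ⊕ γ ρ ⊛ (Q x ⊛ B ρ′ x ⊕ eval (suc d) (r ρ′) x)
            ≈⟨ 𝔼.𝕊.pair-collect (γ ρ) (γ ρ′) (Q x) (B ρ x) (B ρ′ x) _ _ ⟩
          Q x ⊛ (γ ρ′ ⊛ B ρ x ⊕ γ ρ ⊛ B ρ′ x) ⊕ (γ ρ′ ⊛ eval (suc d) (r ρ) x ⊕ γ ρ ⊛ eval (suc d) (r ρ′) x)
            ≈⟨ 𝔼.𝕊R.+-congˡ {x = Q x ⊛ (γ ρ′ ⊛ B ρ x ⊕ γ ρ ⊛ B ρ′ x)} (𝔼.≋-sym (𝔼.≋-trans (𝔼.𝕊.eval-+ (suc d) (λ j → γ ρ′ ⊛ r ρ j) (λ j → γ ρ ⊛ r ρ′ j) x)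
                 (𝔼.𝕊R.+-cong (𝔼.𝕊.eval-*ˡ (suc d) (γ ρ′) (r ρ) x) (𝔼.𝕊.eval-*ˡ (suc d) (γ ρ) (r ρ′) x)))) ⟩
          Q x ⊛ (γ ρ′ ⊛ B ρ x ⊕ γ ρ ⊛ B ρ′ x) ⊕ eval (suc d) (λ j → γ ρ′ ⊛ r ρ j ⊕ γ ρ ⊛ r ρ′ j) x ∎ }
      where
      open SetoidReasoning 𝔼.𝕊R.setoid
      Q : Series → Series
      Q x = eval (suc (suc d)) q x

    reducible-≈ : ∀ {f g} → (∀ x → f x ≈₀ g x) → Reducible f → Reducible g
    reducible-≈ eq ρ = record
      { γ = γ ρ ; bounded-γ = bounded-γ ρ ; γ≉0 = γ≉0 ρ ; B = B ρ ; B-cong = B-cong ρ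
      ; r = r ρ ; bounded-r = bounded-r ρ
      ; division = λ x → 𝔼.≋-trans (𝔼.𝕊R.*-congˡ (𝔼.≋-sym (eq x))) (division ρ x) }

    reducible-pow : ∀ n → Reducible (λ x → pow x n)
    reducible-pow zero    = reducible-𝟙
    reducible-pow (suc n) = reducible-x* (reducible-pow n)

    reducible-eval* : ∀ n (b : ℕ → Series) {f} → (∀ j → Bounded (b j)) → Reducible f → Reducible (λ x → eval n b x ⊛ f x)
    reducible-eval* zero    b {f} bb ρ = reducible-≈ (λ x → 𝔼.≋-sym (𝔼.𝕊R.zeroˡ (f x))) reducible-𝟘
    reducible-eval* (suc n) b {f} bb ρ = reducible-≈
      (λ x → 𝔼.≋-sym (𝔼.≋-trans (𝔼.𝕊R.distribʳ (f x) (b 0) (x ⊛ eval n (b ∘ suc) x)) (𝔼.𝕊R.+-congˡ {x = b 0 ⊛ f x} (𝔼.𝕊R.*-assoc x (eval n (b ∘ suc) x) (f x)))))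
      (reducible-⊕ (reducible-*ˡ (bb 0) ρ) (reducible-x* (reducible-eval* n (b ∘ suc) (bb ∘ suc) ρ)))

    reducible-pow-eval* : ∀ i n (b : ℕ → Series) {f} → (∀ j → Bounded (b j)) → Reducible f →
                          Reducible (λ x → pow (eval n b x) i ⊛ f x)
    reducible-pow-eval* zero    n b {f} bb ρ = reducible-≈ (λ x → 𝔼.≋-sym (𝔼.𝕊R.*-identityˡ (f x))) ρ
    reducible-pow-eval* (suc i) n b {f} bb ρ = reducible-≈
      (λ x → 𝔼.≋-sym (𝔼.𝕊R.*-assoc (eval n b x) (pow (eval n b x) i) (f x)))
      (reducible-eval* n b bb (reducible-pow-eval* i n b bb ρ))

    record Multiple (f : ℕ → Series → Series) : Set where
      field
        c            : ℕ → Series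
        bounded-c    : ∀ i → Bounded (c i)
        primitive-at : ∃ λ i → i ℕ.≤ suc d × ¬ c i ≈ₚ 𝟘
        B            : Series → Series
        B-cong       : ∀ {x y} → x ≈ₚ y → B x ≈ₚ B y
        identity     : ∀ x → ∑ (suc (suc d)) (λ i → c i ⊛ f i x) ≈₀ eval (suc (suc d)) q x ⊛ B x

    -- d + 2 polynomials have linearly dependent remainders of degree ≤ d.
    multiple : ∀ (f : ℕ → Series → Series) → (∀ i → Reducible (f i)) → Multiple f
    multiple f ρ = record
      { c = λ i → coeff i ⊛ γ (ρ i)
      ; bounded-c = λ i → bounded-⊛ (bounded-coeff i) (bounded-γ (ρ i))
      ; primitive-at = let i , i≤ , ci≉0 = primitive-at in i , i≤ , ⊛-nonzero p-ideal ci≉0 (γ≉0 (ρ i))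
      ; B = λ x → ∑ (suc (suc d)) (λ i → coeff i ⊛ B (ρ i) x)
      ; B-cong = λ eq → 𝔽.𝕊.∑-cong (suc (suc d)) (λ i _ → 𝔽.𝕊R.*-congˡ {x = coeff i} (B-cong (ρ i) eq))
      ; identity = identity }
      where
      open PrimitiveDependence (primitiveDependence (suc d) (λ i j → r (ρ i) (toℕ j)) (λ i j → bounded-r (ρ i) (toℕ j)))
      open SetoidReasoning 𝔼.𝕊R.setoid
      n = suc (suc d)
      identity : ∀ x → ∑ n (λ i → coeff i ⊛ γ (ρ i) ⊛ f i x) ≈₀ eval n q x ⊛ ∑ n (λ i → coeff i ⊛ B (ρ i) x)
      identity x = begin
        ∑ n (λ i → coeff i ⊛ γ (ρ i) ⊛ f i x)
          ≈⟨ 𝔼.𝕊.∑-cong n (λ i _ → term i) ⟩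
        ∑ n (λ i → eval n q x ⊛ (coeff i ⊛ B (ρ i) x) ⊕ coeff i ⊛ eval (suc d) (r (ρ i)) x)
          ≈⟨ 𝔼.𝕊.∑-+ n (λ i → eval n q x ⊛ (coeff i ⊛ B (ρ i) x)) (λ i → coeff i ⊛ eval (suc d) (r (ρ i)) x) ⟩
        ∑ n (λ i → eval n q x ⊛ (coeff i ⊛ B (ρ i) x)) ⊕ ∑ n (λ i → coeff i ⊛ eval (suc d) (r (ρ i)) x)
          ≈⟨ 𝔼.𝕊R.+-cong (𝔼.≋-sym (𝔼.𝕊.∑-*ˡ n (eval n q x) (λ i → coeff i ⊛ B (ρ i) x)))
               (𝔼.≋-trans (𝔼.𝕊.∑-eval n (suc d) coeff (λ i → r (ρ i)) x) (𝔼.𝕊.eval-zero (suc d) x remainder)) ⟩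
        eval n q x ⊛ ∑ n (λ i → coeff i ⊛ B (ρ i) x) ⊕ 𝟘
          ≈⟨ 𝔼.𝕊R.+-identityʳ _ ⟩
        eval n q x ⊛ ∑ n (λ i → coeff i ⊛ B (ρ i) x) ∎
        where
        term : ∀ i → coeff i ⊛ γ (ρ i) ⊛ f i x ≈₀ eval n q x ⊛ (coeff i ⊛ B (ρ i) x) ⊕ coeff i ⊛ eval (suc d) (r (ρ i)) x
        term i = begin
          coeff i ⊛ γ (ρ i) ⊛ f i x                 ≈⟨ 𝔼.𝕊R.*-assoc (coeff i) (γ (ρ i)) (f i x) ⟩
          coeff i ⊛ (γ (ρ i) ⊛ f i x)               ≈⟨ 𝔼.𝕊R.*-congˡ (division (ρ i) x) ⟩
          coeff i ⊛ (eval n q x ⊛ B (ρ i) x ⊕ eval (suc d) (r (ρ i)) x) ≈⟨ 𝔼.𝕊R.distribˡ (coeff i) _ _ ⟩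
          coeff i ⊛ (eval n q x ⊛ B (ρ i) x) ⊕ coeff i ⊛ eval (suc d) (r (ρ i)) x
            ≈⟨ 𝔼.𝕊R.+-congʳ (𝔼.𝕊.*-leftComm (coeff i) (eval n q x) (B (ρ i) x)) ⟩
          eval n q x ⊛ (coeff i ⊛ B (ρ i) x) ⊕ coeff i ⊛ eval (suc d) (r (ρ i)) x ∎
        remainder : ∀ j → j ℕ.< suc d → ∑ n (λ i → coeff i ⊛ r (ρ i) j) ≈₀ 𝟘
        remainder j j<n = ≡.subst (λ k → ∑ n (λ i → coeff i ⊛ r (ρ i) k) ≈₀ 𝟘) (FinP.toℕ-fromℕ< j<n) (relation (fromℕ< j<n))

-- How independence of powers passes between a series, its p-th power and its logarithmic
-- derivative.

module Independence (p : ℕ) (p-prime : Prime p) where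
  open PrimeModulus p p-prime
  open Elimination p p-prime

  private
    instance
      p≢0 : NonZero p
      p≢0 = prime⇒nonZero p-prime

  -- The relation is taken modulo N, but its coefficients are only claimed to vanish modulo p.
  Independent : ℕ → Series → ℤ → Set
  Independent n v N = ∀ a → (∀ j → Bounded (a j)) → eval n a v ≈[ N ] 𝟘 → ∀ j → j ℕ.< n → a j ≈ₚ 𝟘

  -- Here `n` counts coefficients, so this says that a relation for `v` with a coefficient nonzero
  -- modulo p has degree at least `d`. It plays the part of the minimality of d.
  IndependentUpTo : ℕ → Series → Set
  IndependentUpTo d v = ∀ n → n ℕ.≤ d → Independent n v (+ p)

  independent-≈ : ∀ {n v w N} → v ≈[ N ] w → Independent n v N → Independent n w N
  independent-≈ {n} {N = N} v≈w ind a ba eq = ind a ba (≋-trans (𝕊.eval-congʳ n a v≈w) eq)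
    where open SeriesRing (ℤmod N) using (≋-trans; module 𝕊)

  -- Only the leading coefficient matters: once it vanishes modulo p, what remains is a shorter
  -- relation modulo p, to which the minimality hypothesis applies. A single coefficient is its own
  -- relation, so `step` may assume positive degree, as the division by the relation requires.
  independent-suc : ∀ {d v N} → + p ∣ℤ N → IndependentUpTo d v →
    (∀ d′ → d ≡ suc d′ → ∀ a → (∀ j → Bounded (a j)) → eval (suc d) a v ≈[ N ] 𝟘 → ¬ a d ≈ₚ 𝟘 → ⊥) →
    Independent (suc d) v N
  independent-suc {zero} {v} {N} p∣N ind step a ba eq zero (s≤s z≤n) =
    𝔽.≋-trans (𝔽.≋-sym (𝔽.≋-trans (𝔽.𝕊R.+-congˡ {x = a 0} (𝔽.𝕊R.zeroʳ v)) (𝔽.𝕊R.+-identityʳ (a 0)))) (weaken p∣N eq)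
  independent-suc {suc d} {v} {N} p∣N ind step a ba eq = go
    where
    top : a (suc d) ≈ₚ 𝟘
    top = Dec.decidable-stable (≈𝟘? (+ p) (ba (suc d))) (step d ≡.refl a ba eq)
    rest : eval (suc d) a v ≈ₚ 𝟘
    rest = 𝔽.≋-trans (𝔽.≋-sym (𝔽.≋-trans (𝔽.𝕊.eval-last (suc d) a v)
      (𝔽.≋-trans (𝔽.𝕊R.+-congˡ {x = eval (suc d) a v} (𝔽.≋-trans (𝔽.𝕊R.*-congʳ top) (𝔽.𝕊R.zeroˡ (pow v (suc d)))))
                 (𝔽.𝕊R.+-identityʳ (eval (suc d) a v))))) (weaken p∣N eq)
    go : ∀ j → j ℕ.< suc (suc d) → a j ≈ₚ 𝟘
    go j (s≤s j≤) with ℕP.m≤n⇒m<n∨m≡n j≤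
    ... | inj₁ j<       = ind (suc d) ℕP.≤-refl a ba rest j j<
    ... | inj₂ ≡.refl   = top

  bounded-Λ : ∀ r {f} → Bounded f → Bounded (Λ r f)
  bounded-Λ r (bounded D v) = bounded D λ k le →
    v _ (ℕP.≤-trans le (ℕP.≤-trans (ℕP.m≤m*n k p) (ℕP.m≤n+m (k ℕ.* p) r)))

  -- A relation for z · σ u is taken apart into the sections Λ r of its coefficients.
  independent-σ : ∀ {n u w N} z → Bounded z → ¬ z ≈ₚ 𝟘 → w ≈[ N ] z ⊛ σ u → Independent n u N → Independent n w N
  independent-σ {n} {u} {w} {N} z bz z≉0 w≈ ind a ba eq j j<n =
    ⊛-cancel p-ideal (pow-nonzero j z≉0) (𝔽.≋-trans (𝔽.𝕊R.*-comm (pow z j) (a j)) (Fr.Λ-ext λ r r<p →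
      ind (λ j → Λ r (a j ⊛ pow z j)) (λ j → bounded-Λ r (bounded-⊛ (ba j) (bounded-pow j bz)))
        (≋-trans (≋-sym (FrN.Λ-eval r n (λ j → a j ⊛ pow z j) u r<p)) (FrN.Λ-cong r (≋-trans (≋-sym (𝕊.eval-scale n a z (σ u)))
           (≋-trans (𝕊.eval-congʳ n a (≋-sym w≈)) eq))))
        j j<n))
    where
    module Fr = Frobenius p (ℤmod (+ p))
    module FrN = Frobenius p (ℤmod N)
    open SeriesRing (ℤmod N) using (≋-sym; ≋-trans; module 𝕊)

  -- A general fact for integer series, by Fermat's little theorem; for the powers of V it is read
  -- off their functional equation.
  FrobeniusLift : Series → Set
  FrobeniusLift v = pow v p ≈ₚ σ v

  independent-pow : ∀ {n v} → FrobeniusLift v → Independent n v (+ p) → Independent n (pow v p) (+ p)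
  independent-pow {v = v} frob = independent-σ 𝟙 (bounded-const 1ℤ) 𝟙≉ₚ𝟘 (𝔽.≋-trans frob (𝔽.≋-sym (𝔽.𝕊R.*-identityˡ (σ v))))

  frobeniusLift-pow : ∀ {v} → FrobeniusLift v → FrobeniusLift (pow v p)
  frobeniusLift-pow {v} frob = 𝔽.≋-trans (𝔽.𝕊.pow-cong p frob) (𝔽.≋-sym (Frobenius.σ-pow p (ℤmod (+ p)) v p))

  mul≈ : ∀ {N} j f → mul j f ≈[ N ] (+ j) ∙ f
  mul≈ {N} j f = pointwise λ n → ≡⇒Congruent N (go j n)
    where
    go : ∀ j n → mul j f n ≡ + j ℤ.* f n
    go zero    n = ≡.sym (ℤP.*-zeroˡ (f n))
    go (suc j) n = ≡.trans (≡.cong (λ z → f n ℤ.+ z) (go j n)) (≡.sym (ℤP.suc-* (+ j) (f n)))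

  mul-cancel : ∀ j {f} → ¬ p ℕ∣.∣ j → mul j f ≈ₚ 𝟘 → f ≈ₚ 𝟘
  mul-cancel j {f} p∤j eq = pointwise λ n → ∣⇒≈0 (Sum.[ (λ p∣j → ⊥-elim (p∤j (ℤ∣.∣⇒∣ᵤ p∣j))) , (λ z → z) ]
    (p-ideal (+ j) (f n) (≈0⇒∣ (𝔽.≋-trans (𝔽.≋-sym (mul≈ j f)) eq .at n))))

  -- If the derivative vanished at v, the relation would be one for vᵖ of lower degree.
  separable : ∀ {d v} a → (∀ j → Bounded (a j)) → FrobeniusLift v → IndependentUpTo (suc d) v →
    eval (suc (suc d)) a v ≈ₚ 𝟘 → ¬ a (suc d) ≈ₚ 𝟘 → ¬ eval (suc d) (derivative a) v ≈ₚ 𝟘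
  separable {d} {v} a ba frob ind eq top≉0 eq′ = lowDegree (p ℕ∣.∣? suc d)
    where
    ja≈0 : ∀ j → j ℕ.< suc d → mul (suc j) (a (suc j)) ≈ₚ 𝟘
    ja≈0 = ind (suc d) ℕP.≤-refl (derivative a) (λ j → bounded-mul (suc j) (ba (suc j))) eq′
    lowDegree : Dec (p ℕ∣.∣ suc d) → ⊥
    lowDegree (no p∤) = top≉0 (mul-cancel (suc d) p∤ (ja≈0 d ℕP.≤-refl))
    lowDegree (yes (ℕ∣.divides zero ()))
    lowDegree (yes (ℕ∣.divides k@(suc _) d≡kp)) = top≉0 (≡.subst (λ n → a n ≈ₚ 𝟘) (≡.sym d≡kp)
      (independent-pow frob (ind (suc k) k<d) (λ i → a (i ℕ.* p)) (λ i → ba (i ℕ.* p))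
        (𝔽.≋-trans (𝔽.≋-sym (multiples p p>1 (λ j j≤ p∤j → vanish j (≡.subst (j ℕ.≤_) (≡.sym d≡kp) j≤) p∤j)))
          (≡.subst (λ n → eval (suc n) a v ≈ₚ 𝟘) d≡kp eq)) k ℕP.≤-refl))
      where
      k<d : k ℕ.< suc d
      k<d = ≡.subst (k ℕ.<_) (≡.sym d≡kp) (ℕP.m<m*n k p p>1)
      vanish : ∀ j → j ℕ.≤ suc d → ¬ p ℕ∣.∣ j → a j ≈ₚ 𝟘
      vanish zero    j≤ p∤j = ⊥-elim (p∤j (p ℕ∣.∣0))
      vanish (suc j) j≤ p∤j = mul-cancel (suc j) p∤j (ja≈0 j j≤)
      multiples : ∀ q → 1 ℕ.< q → (∀ j → j ℕ.≤ k ℕ.* q → ¬ q ℕ∣.∣ j → a j ≈ₚ 𝟘) →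
                  eval (suc (k ℕ.* q)) a v ≈ₚ eval (suc k) (λ i → a (i ℕ.* q)) (pow v q)
      multiples (suc q) _ = 𝔽.𝕊.eval-multiples q k a v

  -- The powers vᵖⁱ reduce modulo the relation Q of v, which gives a relation for vᵖ of the same degree
  -- that is a multiple Q · B.  Comparing values at v and v + pⁿ shows Q′(v) B(v) ≡ 0, hence B(v) ≡ 0 (mod p).
  independent-pow⁻¹ : ∀ {d v} n → FrobeniusLift v → IndependentUpTo d v →
    Independent (suc d) (pow v p) (p^ suc (suc n)) → Independent (suc d) v (p^ suc n)
  independent-pow⁻¹ {d₀} {v} n frob ind ind′ = independent-suc (p∣p^ n) ind step
    where
    step : ∀ d → d₀ ≡ suc d → ∀ a → (∀ j → Bounded (a j)) → eval (suc d₀) a v ≈[ p^ suc n ] 𝟘 → ¬ a d₀ ≈ₚ 𝟘 → ⊥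
    step d ≡.refl a ba Qv≈0 top≉0 =
      let i , i≤ , ci≉0 = primitive-at in ci≉0 (ind′ c bounded-c Tv≈0 i (s≤s i≤))
      where
      open Multiple (multiple d a ba top≉0 (λ i x → pow x (i ℕ.* p)) (λ i → reducible-pow d a ba top≉0 (i ℕ.* p)))
      N : ℤ
      N = p^ suc (suc n)
      module 𝕄 = SeriesRing (ℤmod N)
      open SetoidReasoning 𝕄.𝕊R.setoid
      H : Series
      H = const (p^ suc n)
      Q T : Series → Series
      Q = eval (suc (suc d)) a
      T x = eval (suc (suc d)) c (pow x p)
      D : Series
      D = eval (suc d) (derivative a) v
      T≈ : ∀ x → T x ≈[ N ] Q x ⊛ B x
      T≈ x = 𝕄.≋-trans (𝕄.𝕊.eval-∑ (suc (suc d)) c (pow x p))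
        (𝕄.≋-trans (𝕄.𝕊.∑-cong (suc (suc d)) (λ i _ → 𝕄.𝕊R.*-congˡ {x = c i} (𝕄.≋-sym (𝕄.𝕊.pow-* x i p))))
          (exact (identity x)))
      const-vanish : ∀ b → N ∣ℤ b → const b ≈[ N ] 𝟘
      const-vanish b N∣b = 𝕄.≋-trans (𝕄.const-cong (∣⇒≈0 N∣b)) 𝕄.const-0#
      H²≈0 : H ⊛ H ≈[ N ] 𝟘
      H²≈0 = 𝕄.≋-trans (𝕄.≋-sym (𝕄.const-* (p^ suc n) (p^ suc n)))
        (const-vanish _ (≡.subst (_∣ℤ p^ suc n ℤ.* p^ suc n) (ℤP.*-comm (p^ suc n) (+ p)) (ℤ∣.*-monoʳ-∣ (p^ suc n) (p∣p^ n))))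
      Hp≈0 : H ⊛ const (+ p) ≈[ N ] 𝟘
      Hp≈0 = 𝕄.≋-trans (𝕄.≋-sym (𝕄.const-* (p^ suc n) (+ p)))
        (const-vanish _ (ℤ∣.∣-reflexive (ℤP.*-comm (+ p) (p^ suc n))))
      -- To first order the p-th power changes by p H v^(p-1), a multiple of p^(n+2). Hence `T`, a
      -- polynomial in the p-th power, takes the same value at `v` and `v ⊕ H`, although `Q` and `B`
      -- need not.
      pow-invariant : pow (v ⊕ H) p ≈[ N ] pow v p
      pow-invariant = go p p>1 (λ f → 𝕄.≋-trans (𝕄.𝕊R.*-congˡ (𝕄.≋-trans (mul≈ p f) (𝕄.≋-sym (const-∙ (+ p) f))))
          (𝕄.≋-trans (𝕄.≋-sym (𝕄.𝕊R.*-assoc H (const (+ p)) f)) (𝕄.≋-trans (𝕄.𝕊R.*-congʳ Hp≈0) (𝕄.𝕊R.zeroˡ f))))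
        where
        go : ∀ m → 1 ℕ.< m → (∀ f → H ⊛ mul m f ≈[ N ] 𝟘) → pow (v ⊕ H) m ≈[ N ] pow v m
        go (suc m) _ H*m≈0 = 𝕄.≋-trans (𝕄.𝕊.pow-taylor m v H H²≈0)
          (𝕄.≋-trans (𝕄.𝕊R.+-congˡ {x = pow v (suc m)} (H*m≈0 (pow v m))) (𝕄.𝕊R.+-identityʳ (pow v (suc m))))
      B-difference : B (v ⊕ H) ⊕ ⊝ B v ≈ₚ 𝟘
      B-difference = 𝔽.≋-trans (𝔽.𝕊R.+-congʳ (B-cong v+H≈v)) (𝔽.𝕊R.-‿inverseʳ (B v))
        where
        v+H≈v : v ⊕ H ≈ₚ v
        v+H≈v = 𝔽.≋-trans (𝔽.𝕊R.+-congˡ {x = v} (𝔽.≋-trans (𝔽.const-cong (∣⇒≈0 (p∣p^ n))) 𝔽.const-0#)) (𝔽.𝕊R.+-identityʳ v)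
      b w : Series
      b = proj₁ (quotient-series B-difference)
      w = proj₁ (quotient-series Qv≈0)
      B≈ : B (v ⊕ H) ≈[ N ] B v ⊕ const (+ p) ⊛ b
      B≈ = 𝕄.≋-trans (𝕄.≋-sym (𝕄.𝕊.x+[y-x]≈y (B v) (B (v ⊕ H))))
        (𝕄.𝕊R.+-congˡ {x = B v} (𝕄.≋-trans (proj₂ (quotient-series B-difference)) (𝕄.≋-sym (const-∙ (+ p) b))))
      Q≈ : Q v ≈[ N ] H ⊛ w
      Q≈ = 𝕄.≋-trans (proj₂ (quotient-series Qv≈0)) (𝕄.≋-sym (const-∙ (p^ suc n) w))
      HDB≈0 : H ⊛ (D ⊛ B v) ≈[ N ] 𝟘
      HDB≈0 = 𝕄.𝕊.perturbation H D (const (+ p)) b w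
        (𝕄.≋-trans (𝕄.≋-sym (T≈ v)) (𝕄.≋-trans (𝕄.𝕊.eval-congʳ (suc (suc d)) c (𝕄.≋-sym pow-invariant)) (T≈ (v ⊕ H))))
        (𝕄.𝕊.eval-taylor (suc d) a v H H²≈0) B≈ Q≈ Hp≈0
      Bv≈0 : B v ≈ₚ 𝟘
      Bv≈0 = ⊛-cancel p-ideal (separable a ba frob ind (weaken (p∣p^ n) Qv≈0) top≉0)
        (∙-cancel (p^ suc n) {{p^≢0 (suc n)}} (≡.subst (λ M → p^ suc n ∙ (D ⊛ B v) ≈[ M ] 𝟘) (ℤP.*-comm (+ p) (p^ suc n))
          (𝕄.≋-trans (𝕄.≋-sym (const-∙ (p^ suc n) (D ⊛ B v))) HDB≈0)))
      -- The modulus rises by one factor p here: `Q v` contributes p^(n+1) and `B v` one more p.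
      Tv≈0 : T v ≈[ N ] 𝟘
      Tv≈0 = begin
        T v                         ≈⟨ T≈ v ⟩
        Q v ⊛ B v                   ≈⟨ 𝕄.𝕊R.*-cong Q≈ (𝕄.≋-trans (proj₂ (quotient-series Bv≈0)) (𝕄.≋-sym (const-∙ (+ p) B′))) ⟩
        H ⊛ w ⊛ (const (+ p) ⊛ B′)  ≈⟨ 𝕄.𝕊.*-interchange H w (const (+ p)) B′ ⟩
        H ⊛ const (+ p) ⊛ (w ⊛ B′)  ≈⟨ 𝕄.≋-trans (𝕄.𝕊R.*-congʳ Hp≈0) (𝕄.𝕊R.zeroˡ (w ⊛ B′)) ⟩
        𝟘 ∎
        where B′ = proj₁ (quotient-series Bv≈0)

  -- Same elimination, without raising the modulus.
  independent-root : ∀ {e} → (∀ n → Independent n (pow e p) (+ p)) → ∀ d → IndependentUpTo d e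
  independent-root {e} ind d zero n≤d a ba eq j ()
  independent-root {e} ind (suc d) (suc n) (s≤s n≤d) =
    independent-suc ℤ∣.∣-refl (λ m m≤n → independent-root ind d m (ℕP.≤-trans m≤n n≤d)) step
    where
    step : ∀ m → n ≡ suc m → ∀ a → (∀ j → Bounded (a j)) → eval (suc n) a e ≈ₚ 𝟘 → ¬ a n ≈ₚ 𝟘 → ⊥
    step m ≡.refl a ba Qe≈0 top≉0 = let i , i≤ , ci≉0 = primitive-at in ci≉0 (ind (suc (suc m)) c bounded-c relation i (s≤s i≤))
      where
      open Multiple (multiple m a ba top≉0 (λ i x → pow x (i ℕ.* p)) (λ i → reducible-pow m a ba top≉0 (i ℕ.* p)))
      relation : eval (suc (suc m)) c (pow e p) ≈ₚ 𝟘
      relation = 𝔽.≋-trans (𝔽.𝕊.eval-∑ (suc (suc m)) c (pow e p))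
        (𝔽.≋-trans (𝔽.𝕊.∑-cong (suc (suc m)) (λ i _ → 𝔽.𝕊R.*-congˡ {x = c i} (𝔽.≋-sym (𝔽.𝕊.pow-* e i p))))
        (𝔽.≋-trans (exact (identity e)) (𝔽.≋-trans (𝔽.𝕊R.*-congʳ Qe≈0) (𝔽.𝕊R.zeroˡ (B e)))))

  -- Differentiating a relation for v expresses its logarithmic derivative h as a quotient of polynomials in v.
  independent-logDer : ∀ {d v h} M → FrobeniusLift v → ¬ v ≈ₚ 𝟘 → SeriesRing.LogDer (ℤmod (p^ suc M)) h v →
    IndependentUpTo d v → Independent (suc d) h (p^ suc M) → Independent (suc d) v (p^ suc M)
  independent-logDer {d₀} {v} {h} M frob v≉0 Dv ind ind′ = independent-suc (p∣p^ M) ind step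
    where
    step : ∀ d → d₀ ≡ suc d → ∀ a → (∀ j → Bounded (a j)) → eval (suc d₀) a v ≈[ p^ suc M ] 𝟘 → ¬ a d₀ ≈ₚ 𝟘 → ⊥
    step d ≡.refl a ba Qv≈0 top≉0 =
      let i , i≤ , ci≉0 = primitive-at in ci≉0 (ind′ c bounded-c relation i (s≤s i≤))
      where
      N = p^ suc M
      m = suc (suc d)
      module 𝕄 = SeriesRing (ℤmod N)
      open SetoidReasoning 𝕄.𝕊R.setoid
      ja -θa : ℕ → Series
      ja  j = mul j (a j)
      -θa j = ⊝ θ (a j)
      D P : Series → Series
      D = eval m ja
      P = eval m -θa
      -- With h = P / D at `v`, these are the powers hⁱ for i ≤ d + 1, brought to the common
      -- denominator D^(d+1). There are d + 2 of them, as `multiple` requires.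
      f : ℕ → Series → Series
      f i x = pow (P x) i ⊛ (pow (D x) (suc d ℕ.∸ i) ⊛ 𝟙)
      open Multiple (multiple d a ba top≉0 f (λ i →
        reducible-pow-eval* d a ba top≉0 i m -θa (λ j → bounded-⊝ (bounded-θ (ba j)))
          (reducible-pow-eval* d a ba top≉0 (suc d ℕ.∸ i) m ja (λ j → bounded-mul j (ba j)) (reducible-𝟙 d a ba top≉0))))
      hD≈P : h ⊛ D v ≈[ N ] P v
      hD≈P = 𝕄.𝕊.+-cancelˡ (eval m (λ j → θ (a j)) v) (begin
        eval m (λ j → θ (a j)) v ⊕ h ⊛ D v   ≈⟨ 𝕄.θ-eval m a Dv ⟨
        θ (eval m a v)                       ≈⟨ 𝕄.θ-cong Qv≈0 ⟩
        θ 𝟘                                  ≈⟨ pointwise (λ n → RingLaws.mul-0# (ℤmod N) n) ⟩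
        𝟘                                    ≈⟨ 𝕄.𝕊.eval-zero m v (λ j _ → 𝕄.𝕊R.-‿inverseʳ (θ (a j))) ⟨
        eval m (λ j → θ (a j) ⊕ -θa j) v     ≈⟨ 𝕄.𝕊.eval-+ m (λ j → θ (a j)) -θa v ⟩
        eval m (λ j → θ (a j)) v ⊕ P v ∎)
      -- At `v`, `D` is `v` times the derivative of the relation, since the coefficient of index 0
      -- in `ja` is zero.
      Dv≉0 : ¬ D v ≈ₚ 𝟘
      Dv≉0 Dv≈0 = separable a ba frob ind (weaken (p∣p^ M) Qv≈0) top≉0
        (⊛-cancel p-ideal v≉0 (𝔽.≋-trans (𝔽.≋-sym (𝔽.𝕊R.+-identityˡ (v ⊛ eval (suc d) (derivative a) v))) Dv≈0))
      term : ∀ i → i ℕ.< m → c i ⊛ f i v ≈[ N ] (c i ⊛ pow h i) ⊛ pow (D v) (suc d)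
      term i (s≤s i≤) = begin
        c i ⊛ (pow (P v) i ⊛ (pow (D v) (suc d ℕ.∸ i) ⊛ 𝟙))
          ≈⟨ 𝕄.𝕊R.*-congˡ (𝕄.𝕊R.*-cong (𝕄.𝕊.pow-cong i (𝕄.≋-sym hD≈P)) (𝕄.𝕊R.*-identityʳ _)) ⟩
        c i ⊛ (pow (h ⊛ D v) i ⊛ pow (D v) (suc d ℕ.∸ i))
          ≈⟨ 𝕄.𝕊R.*-congˡ (𝕄.𝕊R.*-congʳ (𝕄.𝕊.pow-distrib-* h (D v) i)) ⟩
        c i ⊛ (pow h i ⊛ pow (D v) i ⊛ pow (D v) (suc d ℕ.∸ i))
          ≈⟨ 𝕄.𝕊R.*-congˡ (𝕄.𝕊R.*-assoc (pow h i) _ _) ⟩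
        c i ⊛ (pow h i ⊛ (pow (D v) i ⊛ pow (D v) (suc d ℕ.∸ i)))
          ≈⟨ 𝕄.𝕊R.*-congˡ (𝕄.𝕊R.*-congˡ (𝕄.≋-trans (𝕄.≋-sym (𝕄.𝕊.pow-+ (D v) i (suc d ℕ.∸ i)))
               (𝕄.𝕊R.reflexive (≡.cong (pow (D v)) (ℕP.m+[n∸m]≡n i≤))))) ⟩
        c i ⊛ (pow h i ⊛ pow (D v) (suc d))
          ≈⟨ 𝕄.𝕊R.*-assoc (c i) (pow h i) (pow (D v) (suc d)) ⟨
        c i ⊛ pow h i ⊛ pow (D v) (suc d) ∎
      relation : eval m c h ≈[ N ] 𝟘
      relation = ⊛-cancel-p^ (suc M) (pow-nonzero (suc d) Dv≉0) (begin
        pow (D v) (suc d) ⊛ eval m c h        ≈⟨ 𝕄.𝕊R.*-comm _ (eval m c h) ⟩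
        eval m c h ⊛ pow (D v) (suc d)        ≈⟨ 𝕄.𝕊R.*-congʳ (𝕄.𝕊.eval-∑ m c h) ⟩
        ∑ m (λ i → c i ⊛ pow h i) ⊛ pow (D v) (suc d) ≈⟨ 𝕄.𝕊.∑-*ʳ m (pow (D v) (suc d)) (λ i → c i ⊛ pow h i) ⟩
        ∑ m (λ i → c i ⊛ pow h i ⊛ pow (D v) (suc d)) ≈⟨ 𝕄.𝕊.∑-cong m (λ i i<m → 𝕄.≋-sym (term i i<m)) ⟩
        ∑ m (λ i → c i ⊛ f i v)               ≈⟨ exact (identity v) ⟩
        eval m a v ⊛ B v                      ≈⟨ 𝕄.≋-trans (𝕄.𝕊R.*-congʳ Qv≈0) (𝕄.𝕊R.zeroˡ (B v)) ⟩
        𝟘 ∎)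

-- Relations for the lacunary series S modulo N.

bounded-shift : ∀ {f} → Bounded f → Bounded (shift f)
bounded-shift (bounded D v) = bounded (suc D) λ { (suc n) (s≤s le) → v n le }

bounded-translate : ∀ {x} n {a} → Bounded x → (∀ j → Bounded (a j)) → ∀ j → Bounded (translate x n a j)
bounded-translate zero    bx ba j       = bounded-𝟘
bounded-translate (suc n) bx ba zero    = bounded-⊕ (ba 0) (bounded-⊛ bx (bounded-translate n bx (ba ∘ suc) 0))
bounded-translate (suc n) bx ba (suc j) =
  bounded-⊕ (bounded-⊛ bx (bounded-translate n bx (ba ∘ suc) (suc j))) (bounded-translate n bx (ba ∘ suc) j)

-- The product 0! 1! ... (n-1)!, the total factor lost when the n coefficients of a relation are
-- removed from the top.
superfactorial : ℕ → ℕ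
superfactorial zero    = 1
superfactorial (suc n) = superfactorial n ℕ.* n !

superfactorial≢0 : ∀ n → NonZero (superfactorial n)
superfactorial≢0 zero    = _
superfactorial≢0 (suc n) = ℕP.m*n≢0 (superfactorial n) (n !) {{superfactorial≢0 n}} {{n ℕP.!≢0}}

module Lacunary (p : ℕ) (p-prime : Prime p) where
  open PrimeModulus p p-prime
  open Independence p p-prime

  private
    instance
      p≢0 : NonZero p
      p≢0 = prime⇒nonZero p-prime

  module _ (S : Series) (S≈X+σS : ∀ {N} → S ≈[ N ] X ⊕ σ S) where

    module _ (N : ℤ) where
      private
        module 𝕄 = SeriesRing (ℤmod N)
        module Fr = Frobenius p (ℤmod N)

      -- Because S = X + σ S, translation by `X` turns a relation for `S` into one for `σ S`, and
      -- its r-th section is again a relation for `S`, of the same degree.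
      section : ℕ → ℕ → (ℕ → Series) → ℕ → Series
      section r d a j = Λ r (translate X (suc d) a j)

      bounded-section : ∀ r d {a} → (∀ j → Bounded (a j)) → ∀ j → Bounded (section r d a j)
      bounded-section r d ba j = bounded-Λ r (bounded-translate (suc d) (bounded-shift (bounded-const 1ℤ)) ba j)

      section-relation : ∀ r → r ℕ.< p → ∀ d a → eval (suc d) a S ≈[ N ] 𝟘 → eval (suc d) (section r d a) S ≈[ N ] 𝟘
      section-relation r r<p d a eq = 𝕄.≋-trans (𝕄.≋-sym (Fr.Λ-eval r (suc d) (translate X (suc d) a) S r<p))
        (Fr.Λ-cong r (𝕄.≋-trans (𝕄.≋-sym (𝕄.𝕊.eval-translate X (suc d) a (σ S)))
          (𝕄.≋-trans (𝕄.𝕊.eval-congʳ (suc d) a (𝕄.≋-sym S≈X+σS)) eq)))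

      section-top : ∀ r d a k → section r d a d k ≡ a d (r ℕ.+ k ℕ.* p)
      section-top r d a k = ≈[0]⇒≡ (𝔼.𝕊.translate-top X d a .at (r ℕ.+ k ℕ.* p))

      section-subtop : ∀ r d a k → section r (suc d) a d k ≡
        a d (r ℕ.+ k ℕ.* p) ℤ.+ + suc d ℤ.* shift (a (suc d)) (r ℕ.+ k ℕ.* p)
      section-subtop r d a k = ≈[0]⇒≡ (𝔼.≋-trans (𝔼.𝕊.translate-subtop X d a)
        (𝔼.𝕊R.+-congˡ {x = a d} (𝔼.≋-trans (mul≈ (suc d) (X ⊛ a (suc d))) scaled)) .at (r ℕ.+ k ℕ.* p))
        where
        scaled : + suc d ∙ (X ⊛ a (suc d)) ≈₀ + suc d ∙ shift (a (suc d))
        scaled = 𝔼.≋-trans (𝔼.≋-sym (const-∙ (+ suc d) (X ⊛ a (suc d))))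
          (𝔼.≋-trans (𝔼.𝕊R.*-congˡ {x = const (+ suc d)} (𝔼.X-⊛ (a (suc d)))) (const-∙ (+ suc d) (shift (a (suc d)))))

      private
        -- Taking a section divides exponents by p ≥ 2, so a length of at least 2 drops by at least
        -- one. Length 1, a constant coefficient, is where this stops.
        shorten : ∀ m r k → suc m ℕ.≤ k → suc (suc m) ℕ.≤ r ℕ.+ k ℕ.* p
        shorten m r k m<k = ℕP.≤-trans (ℕP.≤-trans (s≤s m<k) (ℕP.≤-trans double (ℕP.*-monoʳ-≤ k p>1))) (ℕP.m≤n+m (k ℕ.* p) r)
          where
          double : suc k ℕ.≤ k ℕ.* 2
          double = ≡.subst (suc k ℕ.≤_) (≡.sym (≡.trans (ℕP.*-comm k 2) (≡.cong (k ℕ.+_) (ℕP.+-identityʳ k))))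
            (ℕP.+-monoˡ-≤ k (ℕP.≤-trans (s≤s z≤n) m<k))

        kp≢1 : ∀ k → ¬ k ℕ.* p ≡ 1
        kp≢1 zero    ()
        kp≢1 (suc k) eq = ℕP.<⇒≱ p>1 (≡.subst (p ℕ.≤_) eq (ℕP.m≤m+n p (k ℕ.* p)))

        vanish⇒≈0 : ∀ c {z} → z ≡ 0ℤ → Congruent N (c ℤ.* z) 0ℤ
        vanish⇒≈0 c eq = ≡⇒Congruent N (≡.trans (≡.cong (c ℤ.*_) eq) (ℤP.*-zeroʳ c))

      -- S = X + σ S, so taking sections shortens coefficients, while replacing the subleading coefficient a d by
      -- sections of a d + (d + 1) X a (d + 1).  Once both leading coefficients are constant, section 1 lowers the degree.
      leading : ∀ d a → (∀ j → Bounded (a j)) → eval (suc d) a S ≈[ N ] 𝟘 → ∀ i → Congruent N (+ (d !) ℤ.* a d i) 0ℤ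
      leading-const : ∀ d a → (∀ j → Bounded (a j)) → (∀ n → 1 ℕ.≤ n → a d n ≡ 0ℤ) →
                      eval (suc d) a S ≈[ N ] 𝟘 → Congruent N (+ (d !) ℤ.* a d 0) 0ℤ
      lower : ∀ d a → (∀ j → Bounded (a j)) → (∀ n → 1 ℕ.≤ n → a (suc d) n ≡ 0ℤ) →
              ∀ m → (∀ n → suc m ℕ.≤ n → a d n ≡ 0ℤ) →
              eval (suc (suc d)) a S ≈[ N ] 𝟘 → Congruent N (+ (suc d !) ℤ.* a (suc d) 0) 0ℤ

      leading d a ba eq = go (bound (ba d)) a ba (λ n le → vanishes (ba d) n (ℕP.≤-trans (ℕP.n≤1+n _) le)) eq
        where
        go : ∀ m a → (∀ j → Bounded (a j)) → (∀ n → suc m ℕ.≤ n → a d n ≡ 0ℤ) →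
             eval (suc d) a S ≈[ N ] 𝟘 → ∀ i → Congruent N (+ (d !) ℤ.* a d i) 0ℤ
        go zero    a ba v eq zero    = leading-const d a ba v eq
        go zero    a ba v eq (suc i) = vanish⇒≈0 (+ (d !)) (v (suc i) (s≤s z≤n))
        -- The coefficient of index `i` is not lost: it has index `i / p` in the section `i % p`.
        go (suc m) a ba v eq i = ≡.subst (λ z → Congruent N (+ (d !) ℤ.* z) 0ℤ)
          (≡.trans (section-top r d a k) (≡.cong (a d) (≡.sym (m≡m%n+[m/n]*n i p))))
          (go m (section r d a) (bounded-section r d ba)
            (λ n le → ≡.trans (section-top r d a n) (v (r ℕ.+ n ℕ.* p) (shorten m r n le)))
            (section-relation r (m%n<n i p) d a eq) k)
          where
          r = i % p
          k = i / p

      leading-const zero a ba v eq = 𝕄R.trans (𝕄R.reflexive (≡.trans (ℤP.*-identityˡ (a 0 0)) (≡.sym a₀))) (eq .at 0)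
        where
        module 𝕄R = CommutativeRing (ℤmod N)
        a₀ : eval 1 a S 0 ≡ a 0 0
        a₀ = ≡.trans (≡.cong (λ z → a 0 0 ℤ.+ z) (ℤP.*-zeroʳ (S 0))) (ℤP.+-identityʳ (a 0 0))
      leading-const (suc d) a ba v eq =
        lower d a ba v (bound (ba d)) (λ n le → vanishes (ba d) n (ℕP.≤-trans (ℕP.n≤1+n _) le)) eq

      lower d a ba v (suc m) v′ eq = ≡.subst (λ z → Congruent N (+ (suc d !) ℤ.* z) 0ℤ) (section-top 0 (suc d) a 0)
        (lower d (section 0 (suc d) a) (bounded-section 0 (suc d) ba)
          (λ n le → ≡.trans (section-top 0 (suc d) a n) (v _ (ℕP.≤-trans le (ℕP.m≤m*n n p)))) m
          (λ n le → ≡.trans (section-subtop 0 d a n) (≡.cong₂ ℤ._+_ (v′ _ (shorten m 0 n le))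
             (≡.trans (≡.cong (+ suc d ℤ.*_) (shifted (n ℕ.* p) (kp≢1 n))) (ℤP.*-zeroʳ (+ suc d)))))
          (section-relation 0 0<p′ (suc d) a eq))
        where
        0<p′ : 0 ℕ.< p
        0<p′ = ℕP.<-trans (s≤s z≤n) p>1
        shifted : ∀ n → ¬ n ≡ 1 → shift (a (suc d)) n ≡ 0ℤ
        shifted zero          n≢1 = ≡.refl
        shifted (suc zero)    n≢1 = ⊥-elim (n≢1 ≡.refl)
        shifted (suc (suc n)) n≢1 = v (suc n) (s≤s z≤n)
      -- In section 1 the constant leading coefficient disappears and the degree drops. Since `a d`
      -- is constant too, the new leading coefficient starts with (d + 1) times `a (suc d) 0`; this
      -- factor turns d! into (d + 1)!.
      lower d a ba v zero v′ eq = ≡.subst (λ z → Congruent N z 0ℤ) value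
        (leading d b (bounded-section 1 (suc d) ba) relation 0)
        where
        b = section 1 (suc d) a
        b-top : b (suc d) ≈[ N ] 𝟘
        b-top = pointwise λ k → ≡⇒Congruent N (≡.trans (section-top 1 (suc d) a k) (v _ (s≤s z≤n)))
        relation : eval (suc d) b S ≈[ N ] 𝟘
        relation = 𝕄.≋-trans (𝕄.≋-sym (𝕄.≋-trans (𝕄.𝕊.eval-last (suc d) b S)
          (𝕄.≋-trans (𝕄.𝕊R.+-congˡ {x = eval (suc d) b S} (𝕄.≋-trans (𝕄.𝕊R.*-congʳ b-top) (𝕄.𝕊R.zeroˡ (pow S (suc d)))))
            (𝕄.𝕊R.+-identityʳ (eval (suc d) b S))))) (section-relation 1 p>1 (suc d) a eq)
        value : + (d !) ℤ.* b d 0 ≡ + (suc d !) ℤ.* a (suc d) 0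
        value = ≡.trans (≡.cong (+ (d !) ℤ.*_) (≡.trans (section-subtop 1 d a 0)
            (≡.trans (≡.cong (λ z → z ℤ.+ + suc d ℤ.* a (suc d) 0) (v′ 1 (s≤s z≤n))) (ℤP.+-identityˡ _))))
          (≡.trans (≡.sym (ℤP.*-assoc (+ (d !)) (+ suc d) (a (suc d) 0)))
            (≡.cong (ℤ._* a (suc d) 0) (≡.trans (ℤP.*-comm (+ (d !)) (+ suc d)) (≡.sym (ℤP.pos-* (suc d) (d !))))))

      -- The top coefficient is known to vanish only after multiplication by `n !`. So the whole
      -- relation is multiplied by this number, its top term is dropped, and the rest goes through
      -- the recursion.
      coefficients : ∀ n b → (∀ j → Bounded (b j)) → eval n b S ≈[ N ] 𝟘 →
                     ∀ j → j ℕ.< n → + superfactorial n ∙ b j ≈[ N ] 𝟘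
      coefficients (suc n) b bb eq j (s≤s j≤n) =
        𝕄.≋-trans (pointwise λ i → ≡⇒Congruent N (regroup (b j i))) (go (ℕP.m≤n⇒m<n∨m≡n j≤n))
        where
        regroup : ∀ z → + (superfactorial n ℕ.* n !) ℤ.* z ≡ + superfactorial n ℤ.* (+ (n !) ℤ.* z)
        regroup z = ≡.trans (≡.cong (ℤ._* z) (ℤP.pos-* (superfactorial n) (n !))) (ℤP.*-assoc (+ superfactorial n) (+ (n !)) z)
        b′ : ℕ → Series
        b′ j = const (+ (n !)) ⊛ b j
        b′≈ : ∀ j → b′ j ≈[ N ] + (n !) ∙ b j
        b′≈ j = const-∙ (+ (n !)) (b j)
        top : b′ n ≈[ N ] 𝟘
        top = 𝕄.≋-trans (b′≈ n) (pointwise (leading n b bb eq))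
        relation : eval n b′ S ≈[ N ] 𝟘
        relation = 𝕄.≋-trans (𝕄.≋-sym (𝕄.≋-trans (𝕄.𝕊.eval-last n b′ S)
            (𝕄.≋-trans (𝕄.𝕊R.+-congˡ {x = eval n b′ S} (𝕄.≋-trans (𝕄.𝕊R.*-congʳ top) (𝕄.𝕊R.zeroˡ (pow S n))))
              (𝕄.𝕊R.+-identityʳ (eval n b′ S)))))
          (𝕄.≋-trans (𝕄.𝕊.eval-*ˡ (suc n) (const (+ (n !))) b S)
            (𝕄.≋-trans (𝕄.𝕊R.*-congˡ {x = const (+ (n !))} eq) (𝕄.𝕊R.zeroʳ (const (+ (n !))))))
        ∙-cong : ∀ c {f g} → f ≈[ N ] g → c ∙ f ≈[ N ] c ∙ g
        ∙-cong c {f} {g} f≈g = 𝕄.≋-trans (𝕄.≋-sym (const-∙ c f)) (𝕄.≋-trans (𝕄.𝕊R.*-congˡ {x = const c} f≈g) (const-∙ c g))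
        go : j ℕ.< n ⊎ j ≡ n → + superfactorial n ∙ (+ (n !) ∙ b j) ≈[ N ] 𝟘
        go (inj₁ j<n) = 𝕄.≋-trans (∙-cong (+ superfactorial n) (𝕄.≋-sym (b′≈ j)))
          (coefficients n b′ (λ j → bounded-⊛ (bounded-const (+ (n !))) (bb j)) relation j j<n)
        go (inj₂ ≡.refl) = 𝕄.≋-trans (∙-cong (+ superfactorial n) (pointwise (leading n b bb eq)))
          (pointwise λ i → ≡⇒Congruent N (ℤP.*-zeroʳ (+ superfactorial n)))

    private
      ∣p^∣ : ∀ n → ℤ.∣ p^ n ∣ ≡ p ℕ.^ n
      ∣p^∣ zero    = ≡.refl
      ∣p^∣ (suc n) = ≡.trans (ℤP.abs-* (+ p) (p^ n)) (≡.cong (p ℕ.*_) (∣p^∣ n))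

      pow-const : ∀ {N} c n → pow (const c) n ≈[ N ] const (c ℤ.^ n)
      pow-const {N} c zero    = 𝕊R.refl
        where open SeriesRing (ℤmod N)
      pow-const {N} c (suc n) = 𝕊R.trans (𝕊R.*-congˡ {x = const c} (pow-const c n)) (𝕊R.sym (const-* c (c ℤ.^ n)))
        where open SeriesRing (ℤmod N) using (module 𝕊R; const-*)

    -- A relation for p S is one for S with coefficients pʲ a j, hence G pʲ a j ≡ 0 for the
    -- superfactorial `G`. If `a j` were nonzero modulo p it could be cancelled, and p^(M+1) would
    -- divide G pʲ. The choice M = G pⁿ excludes this, because G pʲ ≤ M < p^(M+1).
    independent-pS : ∀ n → ∃ λ M → Independent n (mul p S) (p^ suc M)
    independent-pS n = M , λ a ba eq j j<n → Dec.decidable-stable (≈𝟘? (+ p) (ba j)) λ aj≉0 →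
      too-large j j<n (≈0⇒∣ (𝕄.≋-trans (𝕄.const-* G (p^ j)) (𝕄.≋-trans (𝕄.𝕊R.*-congˡ {x = const G} (𝕄.≋-sym (pow-const (+ p) j)))
        (⊛-cancel-p^ (suc M) aj≉0 (begin
          a j ⊛ (const G ⊛ pow (const (+ p)) j)    ≈⟨ 𝕄.𝕊.*-leftComm (a j) (const G) (pow (const (+ p)) j) ⟩
          const G ⊛ (a j ⊛ pow (const (+ p)) j)    ≈⟨ const-∙ G (a j ⊛ pow (const (+ p)) j) ⟩
          G ∙ (a j ⊛ pow (const (+ p)) j)
            ≈⟨ coefficients (p^ suc M) n (λ j → a j ⊛ pow (const (+ p)) j)
                 (λ j → bounded-⊛ (ba j) (bounded-pow j (bounded-const (+ p)))) (relation a eq) j j<n ⟩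
          𝟘 ∎))) .at 0))
      where
      M : ℕ
      M = superfactorial n ℕ.* p ℕ.^ n
      G : ℤ
      G = + superfactorial n
      module 𝕄 = SeriesRing (ℤmod (p^ suc M))
      open SetoidReasoning 𝕄.𝕊R.setoid
      relation : ∀ a → eval n a (mul p S) ≈[ p^ suc M ] 𝟘 → eval n (λ j → a j ⊛ pow (const (+ p)) j) S ≈[ p^ suc M ] 𝟘
      relation a eq = 𝕄.≋-trans (𝕄.≋-sym (𝕄.𝕊.eval-scale n a (const (+ p)) S))
        (𝕄.≋-trans (𝕄.𝕊.eval-congʳ n a (𝕄.≋-trans (const-∙ (+ p) S) (𝕄.≋-sym (mul≈ p S)))) eq)
      too-large : ∀ j → j ℕ.< n → p^ suc M ∣ℤ G ℤ.* p^ j → ⊥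
      too-large j j<n p^∣ = ℕP.<⇒≱ (n<p^n (suc M)) (ℕP.≤-trans p^≤ (ℕP.≤-trans bound≤ (ℕP.n≤1+n M)))
        where
        bound≤ : superfactorial n ℕ.* p ℕ.^ j ℕ.≤ M
        bound≤ = ℕP.*-monoʳ-≤ (superfactorial n) (ℕP.^-monoʳ-≤ p (ℕP.<⇒≤ j<n))
        p^≤ : p ℕ.^ suc M ℕ.≤ superfactorial n ℕ.* p ℕ.^ j
        p^≤ = ℕ∣.∣⇒≤ {{ℕP.m*n≢0 (superfactorial n) (p ℕ.^ j) {{superfactorial≢0 n}} {{ℕP.m^n≢0 p j}}}}
          (≡.subst₂ ℕ∣._∣_ (∣p^∣ (suc M)) (≡.trans (ℤP.abs-* G (p^ j)) (≡.cong (superfactorial n ℕ.*_) (∣p^∣ j))) (ℤ∣.∣⇒∣ᵤ p^∣))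

-- Rational series, and the Artin-Hasse exponential as an instance of the general exponential.

module ℚL = RingLaws ℚP.+-*-commutativeRing
module ℚS = SeriesRing ℚP.+-*-commutativeRing
module ℤL = RingLaws ℤP.+-*-commutativeRing

ι : ℤ → ℚ
ι z = mkℚ z 0 (Coprimality.sym (Coprimality.1-coprimeTo ℤ.∣ z ∣))

ι-+ : ∀ a b → ι a ℚ.+ ι b ≡ ι (a ℤ.+ b)
ι-+ a b = ≡.trans (≡.cong (ℚ._/ 1) (≡.cong₂ ℤ._+_ (ℤP.*-identityʳ a) (ℤP.*-identityʳ b))) (ℚP.↥p/↧p≡p (ι (a ℤ.+ b)))

ι-* : ∀ a b → ι a ℚ.* ι b ≡ ι (a ℤ.* b)
ι-* a b = ℚP.↥p/↧p≡p (ι (a ℤ.* b))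

ι-injective : ∀ {a b} → ι a ≡ ι b → a ≡ b
ι-injective = ≡.cong ↥_

ι-mul : ∀ n q → ℚL.mul n q ≡ ι (+ n) ℚ.* q
ι-mul zero    q = ≡.sym (ℚP.*-zeroˡ q)
ι-mul (suc n) q = ≡.trans (≡.cong₂ ℚ._+_ (≡.sym (ℚP.*-identityˡ q)) (ι-mul n q))
  (≡.trans (≡.sym (ℚP.*-distribʳ-+ q (ι 1ℤ) (ι (+ n)))) (≡.cong (ℚ._* q) (ι-+ 1ℤ (+ n))))

ι-∑ : ∀ n (f : ℕ → ℤ) → ℚL.∑ n (ι ∘ f) ≡ ι (ℤL.∑ n f)
ι-∑ zero    f = ≡.refl
ι-∑ (suc n) f = ≡.trans (≡.cong (ι (f 0) ℚ.+_) (ι-∑ n (f ∘ suc))) (ι-+ (f 0) _)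

clear-denominator : ∀ q → ι (↧ q) ℚ.* q ≡ ι (↥ q)
clear-denominator q@(mkℚ n d-1 _) = ℚP.toℚᵘ-injective (ℚᵘP.≃-trans (ℚP.toℚᵘ-homo-* (ι (↧ q)) q) (ℚᵘ.*≡* (lemma (↧ q) n)))
  where
  lemma : ∀ d n → d ℤ.* n ℤ.* 1ℤ ≡ n ℤ.* (1ℤ ℤ.* d)
  lemma = solve-∀

mul-invNat : ∀ n .{{_ : NonZero n}} → ℚL.mul n (invNat n) ≡ 1ℚ
mul-invNat n@(suc k) = ≡.trans (ι-mul n (invNat n)) (ℚP.toℚᵘ-injective
  (ℚᵘP.≃-trans (ℚP.toℚᵘ-homo-* (ι (+ n)) (invNat n))
  (ℚᵘP.≃-trans (ℚᵘP.*-congˡ {ℚᵘ.mkℚᵘ (+ n) 0} (ℚP.toℚᵘ-fromℚᵘ (ℚᵘ.mkℚᵘ (+ 1) k)))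
  (ℚᵘ.*≡* (lemma (+ n))))))
  where
  lemma : ∀ d → d ℤ.* 1ℤ ℤ.* 1ℤ ≡ 1ℤ ℤ.* (1ℤ ℤ.* d)
  lemma = solve-∀

module Exp = Exponential.WithInverses ℚP.+-*-commutativeRing invNat mul-invNat

sumℚ≡∑ : ∀ m h → sumℚ m h ≡ ℚL.∑ m h
sumℚ≡∑ zero    h = ≡.refl
sumℚ≡∑ (suc m) h = ≡.trans (≡.cong (ℚ._+ h m) (sumℚ≡∑ m h)) (≡.sym (ℚL.∑-last m h))

convℚ≡⊛ : ∀ f g n → convℚ f g n ≡ (f ℚS.⊛ g) n
convℚ≡⊛ f g n = ≡.trans (sumℚ≡∑ (suc n) _) (≡.sym (ℚS.⊛-as-∑ f g n))

powℚ≡pow : ∀ f k n → powℚ f k n ≡ ℚS.𝕊.pow f k n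
powℚ≡pow f zero    zero    = ≡.refl
powℚ≡pow f zero    (suc n) = ≡.refl
powℚ≡pow f (suc k) n       = ≡.trans (convℚ≡⊛ f (powℚ f k) n) (ℚS.⊛-cong-≤ n (λ _ _ → ≡.refl) (λ i _ → powℚ≡pow f k i))

artinHasse≡exp : ∀ p n → artinHasse p n ≡ Exp.exp (AHlog p) ≡.refl n
artinHasse≡exp p n = ≡.trans (sumℚ≡∑ (suc n) _)
  (ℚL.∑-cong (suc n) (λ k _ → ≡.cong (ℚ._* invNat (k !)) (powℚ≡pow (AHlog p) k n)))

δ : ℕ → ℕ → ℤ
δ a b = if a ℕ.≡ᵇ b then 1ℤ else 0ℤ

δ-≡ : ∀ {a b} → a ≡ b → δ a b ≡ 1ℤ
δ-≡ {a} {b} eq with a ℕ.≡ᵇ b | ℕP.≡⇒≡ᵇ a b eq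
... | true | _ = ≡.refl

δ-≢ : ∀ {a b} → ¬ a ≡ b → δ a b ≡ 0ℤ
δ-≢ {a} {b} ne with a ℕ.≡ᵇ b | ℕP.≡ᵇ⇒≡ a b
... | true  | f = ⊥-elim (ne (f _))
... | false | _ = ≡.refl

-- The series S, its functional equation and its relation to the logarithm of E.

module PowerSum (p : ℕ) (p-prime : Prime p) where
  open PrimeModulus p p-prime

  private
    instance
      p≢0 : NonZero p
      p≢0 = prime⇒nonZero p-prime

  powers : ℕ → Series
  powers K n = ℤL.∑ K (λ k → δ (p ℕ.^ k) n)

  -- ∑ xᵖᵏ
  S : Series
  S n = powers (suc n) n

  -- A summand with k > n cannot contribute at exponent n, because pᵏ > k.
  powers-stable : ∀ {n K} → n ℕ.≤′ K → powers (suc K) n ≡ S n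
  powers-stable ℕ.≤′-refl = ≡.refl
  powers-stable {n} (ℕ.≤′-step {K} n≤′K) = ≡.trans (ℤL.∑-last (suc K) (λ k → δ (p ℕ.^ k) n))
    (≡.trans (≡.cong₂ ℤ._+_ (powers-stable n≤′K) (δ-≢ (ℕP.>⇒≢ (ℕP.<-trans (s≤s (ℕP.≤′⇒≤ n≤′K)) (n<p^n (suc K))))))
      (ℤP.+-identityʳ (S n)))

  δ-p* : ∀ a n → δ (p ℕ.* a) n ≡ select (n % p) (δ a (n / p))
  δ-p* a n with n % p in n%p | m≡m%n+[m/n]*n n p
  ... | zero  | eq with a ℕ.≟ n / p
  ...   | yes ≡.refl = ≡.trans (δ-≡ (≡.trans (ℕP.*-comm p a) (≡.sym eq))) (≡.sym (δ-≡ {a} ≡.refl))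
  ...   | no a≢      = ≡.trans (δ-≢ (λ pa≡n → a≢ (ℕP.*-cancelʳ-≡ a (n / p) p (≡.trans (ℕP.*-comm a p) (≡.trans pa≡n eq)))))
                          (≡.sym (δ-≢ a≢))
  δ-p* a n | suc r | eq = δ-≢ λ pa≡n → contra (≡.trans (≡.sym n%p) (ℕ∣.n∣m⇒m%n≡0 n p (≡.subst (p ℕ∣.∣_) pa≡n (ℕ∣.m∣m*n a))))
    where
    contra : ¬ suc r ≡ 0
    contra ()

  powers-suc : ∀ K n → powers (suc K) n ≡ (X ⊕ σ (powers K)) n
  powers-suc K n = ≡.cong₂ ℤ._+_ (first n) (rest K)
    where
    first : ∀ n → δ 1 n ≡ X n
    first zero          = ≡.refl
    first (suc zero)    = ≡.refl
    first (suc (suc n)) = ≡.refl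
    select-∑ : ∀ r K (f : ℕ → ℤ) → ℤL.∑ K (λ k → select r (f k)) ≡ select r (ℤL.∑ K f)
    select-∑ zero    K f = ≡.refl
    select-∑ (suc r) K f = ℤL.∑-zero K (λ _ _ → ≡.refl)
    rest : ∀ K → ℤL.∑ K (λ k → δ (p ℕ.* p ℕ.^ k) n) ≡ σ (powers K) n
    rest K = ≡.trans (ℤL.∑-cong K (λ k _ → δ-p* (p ℕ.^ k) n)) (select-∑ (n % p) K _)

  S≡X+σS : ∀ n → S n ≡ (X ⊕ σ S) n
  S≡X+σS n = ≡.trans (powers-suc n n) (≡.cong (λ z → X n ℤ.+ select (n % p) z) (stable n))
    where
    stable : ∀ n → powers n (n / p) ≡ S (n / p)
    stable zero    = ≡.subst (λ m → 0ℤ ≡ S m) (≡.sym (0/n≡0 p)) ≡.refl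
    stable (suc n) = powers-stable (ℕP.≤⇒≤′ (ℕP.≤-pred (m/n<m (suc n) p p>1)))

  S≈X+σS : ∀ {N} → S ≈[ N ] X ⊕ σ S
  S≈X+σS {N} = pointwise λ n → ≡⇒Congruent N (S≡X+σS n)

  -- The exponent pᵏ brought down by `θ` cancels the denominator of x^(pᵏ) / pᵏ.
  θ-AHlog : ∀ n → ℚS.θ (AHlog p) n ≡ ι (S n)
  θ-AHlog n = ≡.trans (≡.cong (ℚL.mul n) (sumℚ≡∑ (suc n) summand)) (≡.trans (ℚL.mul-∑ n (suc n) summand) (≡.trans
    (ℚL.∑-cong (suc n) (λ k _ → term k)) (ι-∑ (suc n) (λ k → δ (p ℕ.^ k) n))))
    where
    summand : ℕ → ℚ
    summand k = if p ℕ.^ k ℕ.≡ᵇ n then invNat (p ℕ.^ k) else 0ℚ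
    term : ∀ k → ℚL.mul n (summand k) ≡ ι (δ (p ℕ.^ k) n)
    term k with p ℕ.^ k ℕ.≡ᵇ n | ℕP.≡ᵇ⇒≡ (p ℕ.^ k) n
    ... | false | _ = ℚL.mul-0# n
    ... | true  | f = ≡.subst (λ m → ℚL.mul m (invNat (p ℕ.^ k)) ≡ 1ℚ) (f _) (mul-invNat (p ℕ.^ k) {{ℕP.m^n≢0 p k}})

-- Reduction of rationals integral at p modulo p^(M+1).

module Reduction (p : ℕ) (p-prime : Prime p) (M : ℕ) where
  open PrimeModulus p p-prime
  open PowerSum p p-prime

  private
    instance
      p≢0 : NonZero p
      p≢0 = prime⇒nonZero p-prime

  N : ℤ
  N = p^ suc M

  -- Reduction ℤ₍ₚ₎ → ℤ / N as a relation: m is a denominator of q prime to p.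
  infix 4 _↦_
  record _↦_ (q : ℚ) (z : ℤ) : Set where
    constructor reduces
    field
      m     : ℤ
      p∤m   : ¬ + p ∣ℤ m
      t     : ℤ
      eq    : ι m ℚ.* q ≡ ι (m ℤ.* z ℤ.+ N ℤ.* t)

  p∤-* : ∀ {a b} → ¬ + p ∣ℤ a → ¬ + p ∣ℤ b → ¬ + p ∣ℤ a ℤ.* b
  p∤-* {a} {b} p∤a p∤b p∣ab = Sum.[ p∤a , p∤b ] (p-ideal a b p∣ab)

  ↦-ι : ∀ z → ι z ↦ z
  ↦-ι z = reduces 1ℤ (λ p∣1 → 1≢0-mod-p (∣⇒≈0 p∣1)) 0ℤ (≡.trans (ι-* 1ℤ z) (≡.cong ι (lemma z N)))
    where
    lemma : ∀ z N → 1ℤ ℤ.* z ≡ 1ℤ ℤ.* z ℤ.+ N ℤ.* 0ℤ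
    lemma = solve-∀

  ↦-+ : ∀ {q r y z} → q ↦ y → r ↦ z → q ℚ.+ r ↦ y ℤ.+ z
  ↦-+ {q} {r} {y} {z} (reduces m p∤m t eq) (reduces m′ p∤m′ t′ eq′) =
    reduces (m ℤ.* m′) (p∤-* p∤m p∤m′) (m′ ℤ.* t ℤ.+ m ℤ.* t′) (begin
      ι (m ℤ.* m′) ℚ.* (q ℚ.+ r)                       ≡⟨ ≡.cong (ℚ._* (q ℚ.+ r)) (ι-* m m′) ⟨
      ι m ℚ.* ι m′ ℚ.* (q ℚ.+ r)                       ≡⟨ ℚL.pair-expand (ι m) (ι m′) q r ⟩
      ι m′ ℚ.* (ι m ℚ.* q) ℚ.+ ι m ℚ.* (ι m′ ℚ.* r)    ≡⟨ ≡.cong₂ (λ u v → ι m′ ℚ.* u ℚ.+ ι m ℚ.* v) eq eq′ ⟩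
      ι m′ ℚ.* ι u ℚ.+ ι m ℚ.* ι v                     ≡⟨ ≡.cong₂ ℚ._+_ (ι-* m′ u) (ι-* m v) ⟩
      ι (m′ ℤ.* u) ℚ.+ ι (m ℤ.* v)                     ≡⟨ ι-+ (m′ ℤ.* u) (m ℤ.* v) ⟩
      ι (m′ ℤ.* u ℤ.+ m ℤ.* v)                         ≡⟨ ≡.cong ι (lemma m m′ y z N t t′) ⟩
      ι (m ℤ.* m′ ℤ.* (y ℤ.+ z) ℤ.+ N ℤ.* (m′ ℤ.* t ℤ.+ m ℤ.* t′)) ∎)
    where
    open ≡.≡-Reasoning
    u = m ℤ.* y ℤ.+ N ℤ.* t
    v = m′ ℤ.* z ℤ.+ N ℤ.* t′
    lemma : ∀ m m′ y z N t t′ → m′ ℤ.* (m ℤ.* y ℤ.+ N ℤ.* t) ℤ.+ m ℤ.* (m′ ℤ.* z ℤ.+ N ℤ.* t′) ≡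
            m ℤ.* m′ ℤ.* (y ℤ.+ z) ℤ.+ N ℤ.* (m′ ℤ.* t ℤ.+ m ℤ.* t′)
    lemma = solve-∀

  ↦-* : ∀ {q r y z} → q ↦ y → r ↦ z → q ℚ.* r ↦ y ℤ.* z
  ↦-* {q} {r} {y} {z} (reduces m p∤m t eq) (reduces m′ p∤m′ t′ eq′) =
    reduces (m ℤ.* m′) (p∤-* p∤m p∤m′) t″ (begin
      ι (m ℤ.* m′) ℚ.* (q ℚ.* r)                ≡⟨ ≡.cong (ℚ._* (q ℚ.* r)) (ι-* m m′) ⟨
      ι m ℚ.* ι m′ ℚ.* (q ℚ.* r)                ≡⟨ ℚL.*-interchange (ι m) (ι m′) q r ⟩
      (ι m ℚ.* q) ℚ.* (ι m′ ℚ.* r)              ≡⟨ ≡.cong₂ ℚ._*_ eq eq′ ⟩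
      ι (m ℤ.* y ℤ.+ N ℤ.* t) ℚ.* ι (m′ ℤ.* z ℤ.+ N ℤ.* t′) ≡⟨ ι-* (m ℤ.* y ℤ.+ N ℤ.* t) (m′ ℤ.* z ℤ.+ N ℤ.* t′) ⟩
      ι ((m ℤ.* y ℤ.+ N ℤ.* t) ℤ.* (m′ ℤ.* z ℤ.+ N ℤ.* t′)) ≡⟨ ≡.cong ι (lemma m m′ y z N t t′) ⟩
      ι (m ℤ.* m′ ℤ.* (y ℤ.* z) ℤ.+ N ℤ.* t″) ∎)
    where
    open ≡.≡-Reasoning
    t″ = m ℤ.* y ℤ.* t′ ℤ.+ t ℤ.* (m′ ℤ.* z) ℤ.+ N ℤ.* (t ℤ.* t′)
    lemma : ∀ m m′ y z N t t′ → (m ℤ.* y ℤ.+ N ℤ.* t) ℤ.* (m′ ℤ.* z ℤ.+ N ℤ.* t′) ≡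
            m ℤ.* m′ ℤ.* (y ℤ.* z) ℤ.+ N ℤ.* (m ℤ.* y ℤ.* t′ ℤ.+ t ℤ.* (m′ ℤ.* z) ℤ.+ N ℤ.* (t ℤ.* t′))
    lemma = solve-∀

  ↦-≈ : ∀ {q y z} → q ↦ y → Congruent N y z → q ↦ z
  ↦-≈ {q} {y} {z} (reduces m p∤m t eq) (congruent (divides k y-z≡kN)) =
    reduces m p∤m (m ℤ.* k ℤ.+ t) (≡.trans eq (≡.cong ι (≡.trans (≡.cong (λ w → m ℤ.* w ℤ.+ N ℤ.* t) y≡) (lemma m z k N t))))
    where
    y≡ : y ≡ z ℤ.+ k ℤ.* N
    y≡ = ≡.trans (add y z) (≡.cong (λ w → z ℤ.+ w) y-z≡kN)
      where
      add : ∀ y z → y ≡ z ℤ.+ (y ℤ.- z)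
      add = solve-∀
    lemma : ∀ m z k N t → m ℤ.* (z ℤ.+ k ℤ.* N) ℤ.+ N ℤ.* t ≡ m ℤ.* z ℤ.+ N ℤ.* (m ℤ.* k ℤ.+ t)
    lemma = solve-∀

  cancel-p∤ : ∀ {m z} → ¬ + p ∣ℤ m → N ∣ℤ m ℤ.* z → N ∣ℤ z
  cancel-p∤ {m} {z} p∤m N∣mz = ≈0⇒∣ (⊛-cancel-p^ (suc M) {const m} {const z} (λ eq → p∤m (≈0⇒∣ (eq .at 0)))
    (𝕄.≋-trans (𝕄.≋-sym (𝕄.const-* m z)) (𝕄.≋-trans (𝕄.const-cong (∣⇒≈0 N∣mz)) 𝕄.const-0#)) .at 0)
    where module 𝕄 = SeriesRing (ℤmod N)

  -- Clearing both denominators shows that N divides m m′ (y - z), and m m′ is prime to p. This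
  -- carries identities between rational series over to congruences modulo N: both sides reduce the
  -- same rational number.
  ↦-unique : ∀ {q y z} → q ↦ y → q ↦ z → Congruent N y z
  ↦-unique {q} {y} {z} (reduces m p∤m t eq) (reduces m′ p∤m′ t′ eq′) = congruent (cancel-p∤ (p∤-* p∤m p∤m′)
    (divides (m ℤ.* t′ ℤ.- m′ ℤ.* t) (≡.trans (lemma m m′ y z N t t′)
      (≡.trans (≡.cong (λ w → w ℤ.- m ℤ.* v ℤ.+ (m ℤ.* t′ ℤ.- m′ ℤ.* t) ℤ.* N) mu≡)
        (lemma′ (m ℤ.* v) ((m ℤ.* t′ ℤ.- m′ ℤ.* t) ℤ.* N))))))
    where
    u = m ℤ.* y ℤ.+ N ℤ.* t
    v = m′ ℤ.* z ℤ.+ N ℤ.* t′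
    mu≡ : m′ ℤ.* u ≡ m ℤ.* v
    mu≡ = ι-injective (begin
      ι (m′ ℤ.* u)           ≡⟨ ι-* m′ u ⟨
      ι m′ ℚ.* ι u           ≡⟨ ≡.cong (ι m′ ℚ.*_) eq ⟨
      ι m′ ℚ.* (ι m ℚ.* q)   ≡⟨ ℚL.*-leftComm (ι m′) (ι m) q ⟩
      ι m ℚ.* (ι m′ ℚ.* q)   ≡⟨ ≡.cong (ι m ℚ.*_) eq′ ⟩
      ι m ℚ.* ι v            ≡⟨ ι-* m v ⟩
      ι (m ℤ.* v) ∎)
      where open ≡.≡-Reasoning
    lemma : ∀ m m′ y z N t t′ → m ℤ.* m′ ℤ.* (y ℤ.- z) ≡
            m′ ℤ.* (m ℤ.* y ℤ.+ N ℤ.* t) ℤ.- m ℤ.* (m′ ℤ.* z ℤ.+ N ℤ.* t′) ℤ.+ (m ℤ.* t′ ℤ.- m′ ℤ.* t) ℤ.* N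
    lemma = solve-∀
    lemma′ : ∀ a b → a ℤ.- a ℤ.+ b ≡ b
    lemma′ = solve-∀

  ↦-mul : ∀ n {q z} → q ↦ z → ℚL.mul n q ↦ ℤL.mul n z
  ↦-mul zero    q↦z = ↦-ι 0ℤ
  ↦-mul (suc n) q↦z = ↦-+ q↦z (↦-mul n q↦z)

  ↦-⊛ : ∀ n {f g f′ g′} → (∀ i → i ℕ.≤ n → f i ↦ f′ i) → (∀ i → i ℕ.≤ n → g i ↦ g′ i) → (f ℚS.⊛ g) n ↦ (f′ ⊛ g′) n
  ↦-⊛ zero    ff gg = ↦-* (ff 0 z≤n) (gg 0 z≤n)
  ↦-⊛ (suc n) ff gg = ↦-+ (↦-* (ff 0 z≤n) (gg (suc n) ℕP.≤-refl))
    (↦-⊛ n (λ i i≤n → ff (suc i) (s≤s i≤n)) (λ i i≤n → gg i (ℕP.m≤n⇒m≤1+n i≤n)))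

  infix 4 _⇉_
  _⇉_ : (ℕ → ℚ) → Series → Set
  f ⇉ g = ∀ n → f n ↦ g n

  ⇉-⊛ : ∀ {f g f′ g′} → f ⇉ f′ → g ⇉ g′ → f ℚS.⊛ g ⇉ f′ ⊛ g′
  ⇉-⊛ ff gg n = ↦-⊛ n (λ i _ → ff i) (λ i _ → gg i)

  ⇉-𝟙 : ℚS.𝟙 ⇉ 𝟙
  ⇉-𝟙 zero    = ↦-ι 1ℤ
  ⇉-𝟙 (suc n) = ↦-ι 0ℤ

  ⇉-pow : ∀ k {f f′} → f ⇉ f′ → ℚS.𝕊.pow f k ⇉ pow f′ k
  ⇉-pow zero    ff = ⇉-𝟙
  ⇉-pow (suc k) ff = ⇉-⊛ ff (⇉-pow k ff)

  module Frℚ = Frobenius p ℚP.+-*-commutativeRing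

  ⇉-σ : ∀ {f f′} → f ⇉ f′ → Frℚ.σ f ⇉ σ f′
  ⇉-σ ff n with n % p
  ... | zero  = ff _
  ... | suc _ = ↦-ι 0ℤ

  ⇉-unique : ∀ {f g g′} → f ⇉ g → f ⇉ g′ → g ≈[ N ] g′
  ⇉-unique fg fg′ = pointwise λ n → ↦-unique (fg n) (fg′ n)

  Integral : ℚ → Set
  Integral q = ∃ λ z → q ↦ z

  integral-⊛ : ∀ n {f g} → (∀ i → i ℕ.≤ n → Integral (f i)) → (∀ i → i ℕ.≤ n → Integral (g i)) → Integral ((f ℚS.⊛ g) n)
  integral-⊛ zero    ff gg = _ , ↦-* (proj₂ (ff 0 z≤n)) (proj₂ (gg 0 z≤n))
  integral-⊛ (suc n) ff gg = _ , ↦-+ (↦-* (proj₂ (ff 0 z≤n)) (proj₂ (gg (suc n) ℕP.≤-refl)))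
    (proj₂ (integral-⊛ n (λ i i≤n → ff (suc i) (s≤s i≤n)) (λ i i≤n → gg i (ℕP.m≤n⇒m≤1+n i≤n))))

-- An integer lift of E modulo p^(M+1), and the functional equation of its p-th power.

module Lift (p : ℕ) (p-prime : Prime p) (e : ℕ → ℕ) (e-reduces : IsReductionOfAH p e) (M : ℕ) where
  open PrimeModulus p p-prime
  open PowerSum p p-prime
  open Reduction p p-prime M

  private
    instance
      p≢0 : NonZero p
      p≢0 = prime⇒nonZero p-prime

  coprime-p^ : ∀ d k → ¬ p ℕ∣.∣ d → Coprime d (p ℕ.^ k)
  coprime-p^ d k p∤d {i} (i∣d , i∣p^k) = ℕ∣.∣1⇒≡1 (strip k i∣p^k)
    where
    i-coprime-p : Coprime i p
    i-coprime-p {j} (j∣i , j∣p) with prime⇒irreducible p-prime j∣p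
    ... | inj₁ j≡1    = j≡1
    ... | inj₂ ≡.refl = ⊥-elim (p∤d (ℕ∣.∣-trans j∣i i∣d))
    strip : ∀ k → i ℕ∣.∣ p ℕ.^ k → i ℕ∣.∣ 1
    strip zero    i∣ = i∣
    strip (suc k) i∣ = strip k (Coprimality.coprime-divisor i-coprime-p i∣)

  pos-p^ : ∀ k → + (p ℕ.^ k) ≡ p^ k
  pos-p^ zero    = ≡.refl
  pos-p^ (suc k) = ≡.trans (ℤP.pos-* p (p ℕ.^ k)) (≡.cong (+ p ℤ.*_) (pos-p^ k))

  inverse : ∀ d → ¬ p ℕ∣.∣ d → ∃ λ u → N ∣ℤ + d ℤ.* u ℤ.- 1ℤ
  inverse d p∤d = fromBézout (Coprimality.coprime-Bézout (coprime-p^ d (suc M) p∤d))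
    where
    1+ab : ∀ a b → + (1 ℕ.+ a ℕ.* b) ≡ 1ℤ ℤ.+ + a ℤ.* + b
    1+ab a b = ≡.cong (λ z → 1ℤ ℤ.+ z) (ℤP.pos-* a b)
    yN : ∀ y → + (y ℕ.* p ℕ.^ suc M) ≡ + y ℤ.* N
    yN y = ≡.trans (ℤP.pos-* y (p ℕ.^ suc M)) (≡.cong (+ y ℤ.*_) (pos-p^ (suc M)))
    lemma₁ : ∀ d x a → x ℤ.* d ≡ 1ℤ ℤ.+ a → d ℤ.* x ℤ.- 1ℤ ≡ a
    lemma₁ d x a eq = ≡.trans (≡.cong (ℤ._- 1ℤ) (≡.trans (ℤP.*-comm d x) eq)) (ring a)
      where
      ring : ∀ a → 1ℤ ℤ.+ a ℤ.- 1ℤ ≡ a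
      ring = solve-∀
    lemma₂ : ∀ d x a → 1ℤ ℤ.+ x ℤ.* d ≡ a → d ℤ.* (ℤ.- x) ℤ.- 1ℤ ≡ ℤ.- a
    lemma₂ d x a eq = ≡.trans (ring d x) (≡.cong ℤ.-_ eq)
      where
      ring : ∀ d x → d ℤ.* (ℤ.- x) ℤ.- 1ℤ ≡ ℤ.- (1ℤ ℤ.+ x ℤ.* d)
      ring = solve-∀
    fromBézout : Bézout.Identity 1 d (p ℕ.^ suc M) → ∃ λ u → N ∣ℤ + d ℤ.* u ℤ.- 1ℤ
    fromBézout (Bézout.+- x y eq) = + x , divides (+ y) (lemma₁ (+ d) (+ x) (+ y ℤ.* N)
      (≡.trans (≡.sym (ℤP.pos-* x d)) (≡.trans (≡.cong +_ (≡.sym eq)) (≡.cong (λ z → 1ℤ ℤ.+ z) (yN y)))))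
    fromBézout (Bézout.-+ x y eq) = ℤ.- + x , divides (ℤ.- + y) (≡.trans (lemma₂ (+ d) (+ x) (+ y ℤ.* N)
      (≡.trans (≡.sym (1+ab x d)) (≡.trans (≡.cong +_ eq) (yN y)))) (ℤP.neg-distribˡ-* (+ y) N))

  -- The divisibility hypothesis already makes `q` integral at p: if p divided the denominator it
  -- would divide the numerator as well, against lowest terms. The denominator is therefore
  -- invertible modulo p^(M+1), and `q` has a residue there lifting `c`.
  reduce : ∀ q c → + p ∣ℤ ↥ q ℤ.- c ℤ.* ↧ q → ∃ λ z → q ↦ z × Congruent (+ p) z c
  reduce q@(mkℚ n d-1 coprime) c p∣ = fromInverse (inverse (suc d-1) (λ p∣d → p∤d (ℤ∣.∣ᵤ⇒∣ p∣d)))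
    where
    d = + suc d-1
    p∤d : ¬ + p ∣ℤ d
    p∤d p∣d = Irrelevant.⊥-elim (ℕP.<⇒≢ p>1 (≡.sym (coprime (ℤ∣.∣⇒∣ᵤ p∣n , ℤ∣.∣⇒∣ᵤ p∣d))))
      where
      add : ∀ a b → a ℤ.- b ℤ.+ b ≡ a
      add = solve-∀
      p∣n : + p ∣ℤ n
      p∣n = ≡.subst (+ p ∣ℤ_) (add n (c ℤ.* d)) (ℤ∣.∣m∣n⇒∣m+n p∣ (ℤ∣.∣n⇒∣m*n c p∣d))
    fromInverse : (∃ λ u → N ∣ℤ d ℤ.* u ℤ.- 1ℤ) → ∃ λ z → q ↦ z × Congruent (+ p) z c
    fromInverse (u , divides k du-1≡kN) = u ℤ.* n , q↦z , congruent p∣z-c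
      where
      t = ℤ.- (k ℤ.* n)
      n≡ : n ≡ d ℤ.* (u ℤ.* n) ℤ.+ N ℤ.* t
      n≡ = lemma d u n k N du-1≡kN
        where
        ring₁ : ∀ d u n → n ≡ d ℤ.* (u ℤ.* n) ℤ.- (d ℤ.* u ℤ.- 1ℤ) ℤ.* n
        ring₁ = solve-∀
        ring₂ : ∀ d u n k N → d ℤ.* (u ℤ.* n) ℤ.- k ℤ.* N ℤ.* n ≡ d ℤ.* (u ℤ.* n) ℤ.+ N ℤ.* (ℤ.- (k ℤ.* n))
        ring₂ = solve-∀
        lemma : ∀ d u n k N → d ℤ.* u ℤ.- 1ℤ ≡ k ℤ.* N → n ≡ d ℤ.* (u ℤ.* n) ℤ.+ N ℤ.* (ℤ.- (k ℤ.* n))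
        lemma d u n k N eq = ≡.trans (ring₁ d u n)
          (≡.trans (≡.cong (λ w → d ℤ.* (u ℤ.* n) ℤ.- w ℤ.* n) eq) (ring₂ d u n k N))
      q↦z : q ↦ u ℤ.* n
      q↦z = reduces d p∤d t (≡.trans (clear-denominator q) (≡.cong ι n≡))
      p∣z-c : + p ∣ℤ u ℤ.* n ℤ.- c
      p∣z-c = Sum.[ (λ p∣d → ⊥-elim (p∤d p∣d)) , (λ p∣ → p∣) ] (p-ideal d (u ℤ.* n ℤ.- c)
        (≡.subst (+ p ∣ℤ_) (lemma n c d (u ℤ.* n) (N ℤ.* t) n≡) (ℤ∣.∣m∣n⇒∣m-n p∣ (ℤ∣.∣m⇒∣m*n t (p∣p^ M)))))
        where
        ring : ∀ c d z w → d ℤ.* z ℤ.+ w ℤ.- c ℤ.* d ℤ.- w ≡ d ℤ.* (z ℤ.- c)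
        ring = solve-∀
        lemma : ∀ n c d z w → n ≡ d ℤ.* z ℤ.+ w → n ℤ.- c ℤ.* d ℤ.- w ≡ d ℤ.* (z ℤ.- c)
        lemma n c d z w eq = ≡.trans (≡.cong (λ n → n ℤ.- c ℤ.* d ℤ.- w) eq) (ring c d z w)

  E : ℕ → ℚ
  E = artinHasse p

  reduced : ∀ n → ∃ λ z → E n ↦ z × Congruent (+ p) z (+ e n)
  reduced n = reduce (E n) (+ e n) (ℤ∣.∣ᵤ⇒∣ (e-reduces n))

  ε : Series
  ε n = proj₁ (reduced n)

  E⇉ε : E ⇉ ε
  E⇉ε n = proj₁ (proj₂ (reduced n))

  V : Series
  V = pow ε p

  Sℚ : ℕ → ℚ
  Sℚ = ι ∘ S

  open ℚS using (LogDer; _≋_; ≋-sym; ≋-trans; ≋-refl; LogDer-pow; LogDer-⊛; ⊛-cong; module 𝕊; module 𝕊R)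

  E₀≡1 : E 0 ≡ 1ℚ
  E₀≡1 = ≡.refl

  LogDer-E : LogDer Sℚ E
  LogDer-E = ≋-trans (ℚS.θ-cong E≋exp) (≋-trans (Exp.LogDer-exp (AHlog p) ≡.refl)
    (⊛-cong (pointwise θ-AHlog) (≋-sym E≋exp)))
    where
    E≋exp : E ≋ Exp.exp (AHlog p) ≡.refl
    E≋exp = pointwise (artinHasse≡exp p)

  LogDer-cong : ∀ {h k f} → h ≋ k → LogDer h f → LogDer k f
  LogDer-cong h≋k Df = ≋-trans Df (⊛-cong h≋k ≋-refl)

  ι-σ : ∀ f n → ι (σ f n) ≡ Frℚ.σ (ι ∘ f) n
  ι-σ f n with n % p
  ... | zero  = ≡.refl
  ... | suc _ = ≡.refl

  ι-X : ∀ n → ι (X n) ≡ ℚS.X n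
  ι-X zero          = ≡.refl
  ι-X (suc zero)    = ≡.refl
  ι-X (suc (suc n)) = ≡.refl

  pSℚ≋ : 𝕊.mul p Sℚ ≋ 𝕊.mul p ℚS.X ℚS.⊕ 𝕊.mul p (Frℚ.σ Sℚ)
  pSℚ≋ = ≋-trans (𝕊.mul-cong p (pointwise λ n → ≡.trans (≡.cong ι (S≡X+σS n))
    (≡.trans (≡.sym (ι-+ (X n) (σ S n))) (≡.cong₂ ℚ._+_ (ι-X n) (ι-σ S n))))) (𝕊.mul-distrib-+ p ℚS.X (Frℚ.σ Sℚ))

  mul-at-0 : ∀ m {f} → f 0 ≡ 0ℚ → 𝕊.mul m f 0 ≡ 0ℚ
  mul-at-0 m {f} f₀≡0 = ≡.trans (ℚS.mul-at m f 0) (≡.trans (≡.cong (ℚL.mul m) f₀≡0) (ℚL.mul-0# m))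

  pow-at-0 : ∀ m {f} → f 0 ≡ 1ℚ → 𝕊.pow f m 0 ≡ 1ℚ
  pow-at-0 zero    f₀≡1 = ≡.refl
  pow-at-0 (suc m) f₀≡1 = ≡.cong₂ ℚ._*_ f₀≡1 (pow-at-0 m f₀≡1)

  σ-at-0 : ∀ f → Frℚ.σ f 0 ≡ f 0
  σ-at-0 f = Frℚ.Λ₀σ f .at 0

  Eᵖ : ℕ → ℚ
  Eᵖ = 𝕊.pow E p

  -- Both sides have constant term 1 and logarithmic derivative p S, in view of S = X + σ S.
  Eᵖ≋ : Eᵖ ≋ Exp.expX p ℚS.⊛ Frℚ.σ E
  Eᵖ≋ = Exp.LogDer-unique (mul-at-0 p {Sℚ} ≡.refl)
    (≡.trans (pow-at-0 p {E} E₀≡1) (≡.sym (≡.trans (ℚP.*-identityˡ (Frℚ.σ E 0)) (σ-at-0 E))))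
    (LogDer-pow p LogDer-E)
    (LogDer-cong (≋-sym pSℚ≋) (LogDer-⊛ (Exp.LogDer-expX p) (Frℚ.LogDer-σ LogDer-E)))

  σ-mul : ∀ m f → Frℚ.σ (𝕊.mul m f) ≋ 𝕊.mul m (Frℚ.σ f)
  σ-mul m f = pointwise λ n → ≡.trans (go m f n) (≡.sym (ℚS.mul-at m (Frℚ.σ f) n))
    where
    go : ∀ m f n → Frℚ.σ (𝕊.mul m f) n ≡ ℚL.mul m (Frℚ.σ f n)
    go m f n with n % p
    ... | zero  = ℚS.mul-at m f (n / p)
    ... | suc _ = ≡.sym (ℚL.mul-0# m)

  -- The constant is p² and not p, so that this exponential is a polynomial modulo powers of p also for p = 2.
  Eᵖᵖ≋ : 𝕊.pow Eᵖ p ≋ Exp.expX (p ℕ.* p) ℚS.⊛ Frℚ.σ Eᵖ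
  Eᵖᵖ≋ = Exp.LogDer-unique (mul-at-0 p {𝕊.mul p Sℚ} (mul-at-0 p {Sℚ} ≡.refl))
    (≡.trans (pow-at-0 p {Eᵖ} Eᵖ₀≡1) (≡.sym (≡.trans (ℚP.*-identityˡ (Frℚ.σ Eᵖ 0)) (≡.trans (σ-at-0 Eᵖ) Eᵖ₀≡1))))
    (LogDer-pow p DEᵖ)
    (LogDer-cong h≋ (LogDer-⊛ (Exp.LogDer-expX (p ℕ.* p)) (Frℚ.LogDer-σ DEᵖ)))
    where
    Eᵖ₀≡1 : Eᵖ 0 ≡ 1ℚ
    Eᵖ₀≡1 = pow-at-0 p {E} E₀≡1
    DEᵖ : LogDer (𝕊.mul p Sℚ) Eᵖ
    DEᵖ = LogDer-pow p LogDer-E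
    h≋ : 𝕊.mul (p ℕ.* p) ℚS.X ℚS.⊕ 𝕊.mul p (Frℚ.σ (𝕊.mul p Sℚ)) ≋ 𝕊.mul p (𝕊.mul p Sℚ)
    h≋ = ≋-trans (𝕊R.+-cong (𝕊.mul-assoc-* p p ℚS.X) (𝕊.mul-cong p (σ-mul p Sℚ)))
      (≋-sym (≋-trans (𝕊.mul-cong p pSℚ≋) (𝕊.mul-distrib-+ p (𝕊.mul p ℚS.X) (𝕊.mul p (Frℚ.σ Sℚ)))))

  neg-integral : ∀ {q} → Integral q → Integral (ℚ.- q)
  neg-integral {q} (z , q↦z) = _ , ≡.subst (_↦ (ℤ.- 1ℤ) ℤ.* z) (-1*x≈-x q) (↦-* (↦-ι (ℤ.- 1ℤ)) q↦z)
    where open RingProperties (CommutativeRing.ring ℚP.+-*-commutativeRing) using (-1*x≈-x)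

  -- Integrality of pⁿ / n! is derived from `Eᵖ≋` and not from a count of the factors p in n!: exp
  -- (p x) is the quotient of Eᵖ by σ E, both integral and the latter with constant term 1, so its
  -- coefficients can be solved for one by one.
  expX-integral : ∀ n → Integral (Exp.expX p n)
  expX-integral n = upTo n n ℕP.≤-refl
    where
    w : ℕ → ℚ
    w = Exp.expX p
    solved : ∀ n → w (suc n) ≡ Eᵖ (suc n) ℚ.+ ℚ.- ((w ℚS.⊛ ℚS.tail (Frℚ.σ E)) n)
    solved n = ℚL.x+c≈y⇒x≈y-c (≡.sym (≡.trans (Eᵖ≋ .at (suc n)) (≡.trans (ℚS.⊛-unfoldʳ w (Frℚ.σ E) n)
      (≡.cong (ℚ._+ (w ℚS.⊛ ℚS.tail (Frℚ.σ E)) n) (≡.trans (≡.cong (w (suc n) ℚ.*_) (σ-at-0 E)) (ℚP.*-identityʳ (w (suc n))))))))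
    upTo : ∀ n i → i ℕ.≤ n → Integral (w i)
    upTo n       zero    i≤n       = 1ℤ , ↦-ι 1ℤ
    upTo (suc n) (suc i) (s≤s i≤n) = ≡.subst Integral (≡.sym (solved i))
      (_ , ↦-+ (⇉-pow p E⇉ε (suc i)) (proj₂ (neg-integral (integral-⊛ i (λ j j≤i → upTo n j (ℕP.≤-trans j≤i i≤n))
        (λ j _ → _ , ⇉-σ E⇉ε (suc j))))))

  -- A residue of p²ⁿ / n!, formed so that the factor pⁿ remains visible as a divisor of the integer
  -- itself.
  z : ℕ → ℤ
  z n = ℤL.mul (p ℕ.^ n) (proj₁ (expX-integral n))

  expX⇉z : Exp.expX (p ℕ.* p) ⇉ z
  expX⇉z n = ≡.subst (_↦ z n) (≡.sym (Exp.expX-* p p n)) (↦-mul (p ℕ.^ n) (proj₂ (expX-integral n)))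

  p^∣z : ∀ n → p^ n ∣ℤ z n
  p^∣z n = divides (proj₁ (expX-integral n)) (≡.trans (ℤmul (p ℕ.^ n) _) (≡.cong (proj₁ (expX-integral n) ℤ.*_) (pos-p^ n)))
    where
    ℤmul : ∀ m a → ℤL.mul m a ≡ a ℤ.* + m
    ℤmul zero    a = ≡.sym (ℤP.*-zeroʳ a)
    ℤmul (suc m) a = ≡.trans (≡.cong (λ w → a ℤ.+ w) (ℤmul m a)) (≡.sym (ℤP.*-suc a (+ m)))

  p^-mono : ∀ {k n} → k ℕ.≤ n → p^ k ∣ℤ p^ n
  p^-mono {n = n} z≤n = divides (p^ n) (≡.sym (ℤP.*-identityʳ (p^ n)))
  p^-mono (s≤s k≤n)   = ℤ∣.*-monoʳ-∣ (+ p) (p^-mono k≤n)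

  -- exp (p² x) modulo pᴹ⁺¹
  Z : Series
  Z n with n ℕ.≤? M
  ... | yes _ = z n
  ... | no  _ = 0ℤ

  expX⇉Z : Exp.expX (p ℕ.* p) ⇉ Z
  expX⇉Z n with n ℕ.≤? M
  ... | yes _  = expX⇉z n
  ... | no n≰M = ↦-≈ (expX⇉z n) (∣⇒≈0 (ℤ∣.∣-trans (p^-mono (ℕP.≰⇒> n≰M)) (p^∣z n)))

  bounded-Z : Bounded Z
  bounded-Z = bounded (suc M) vanish
    where
    vanish : ∀ n → suc M ℕ.≤ n → Z n ≡ 0ℤ
    vanish n M<n with n ℕ.≤? M
    ... | yes n≤M = ⊥-elim (ℕP.<⇒≱ M<n n≤M)
    ... | no _    = ≡.refl

  Z≈𝟙 : Z ≈ₚ 𝟙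
  Z≈𝟙 = pointwise go
    where
    go : ∀ n → Congruent (+ p) (Z n) (𝟙 n)
    go zero    = congruent (ℤ∣.∣-trans (p∣p^ M) (Congruent.difference (↦-unique (expX⇉Z 0) (↦-ι 1ℤ))))
    go (suc n) with suc n ℕ.≤? M
    ... | yes _ = ∣⇒≈0 (ℤ∣.∣-trans (p∣p^ n) (p^∣z (suc n)))
    ... | no  _ = ∣⇒≈0 (divides 0ℤ ≡.refl)

  -- The two sides are reductions of the two sides of `Eᵖᵖ≋`, with exp (p² x) reduced to the
  -- polynomial `Z`.
  V-frobenius : pow V p ≈[ N ] Z ⊛ σ V
  V-frobenius = ⇉-unique (⇉-pow p (⇉-pow p E⇉ε))
    (λ n → ≡.subst (_↦ (Z ⊛ σ V) n) (≡.sym (Eᵖᵖ≋ .at n)) (⇉-⊛ expX⇉Z (⇉-σ (⇉-pow p E⇉ε)) n))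

  V-logDer : SeriesRing.LogDer (ℤmod N) (mul p S) V
  V-logDer = SeriesRing.LogDer-pow (ℤmod N) p (⇉-unique (λ n → ↦-mul n (E⇉ε n))
    (λ n → ≡.subst (_↦ (S ⊛ ε) n) (≡.sym (LogDer-E .at n)) (⇉-⊛ (λ n → ↦-ι (S n)) E⇉ε n)))

  V≈e^p : V ≈ₚ pow (λ n → + e n) p
  V≈e^p = 𝔽.𝕊.pow-cong p (pointwise λ n → proj₂ (proj₂ (reduced n)))

  V≉𝟘 : ¬ V ≈ₚ 𝟘
  V≉𝟘 = pow-nonzero p λ ε≈0 → 1≢0-mod-p (ℤₚ.trans (ℤₚ.sym ε₀≈1) (ε≈0 .at 0))
    where
    ε₀≈1 : Congruent (+ p) (ε 0) 1ℤ
    ε₀≈1 = congruent (ℤ∣.∣-trans (p∣p^ M) (Congruent.difference (↦-unique (E⇉ε 0) (↦-ι 1ℤ))))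

-- Induction on the degree of a relation.

module Transcendence (p : ℕ) (p-prime : Prime p) (e : ℕ → ℕ) (e-reduces : IsReductionOfAH p e) where
  open PrimeModulus p p-prime
  open Independence p p-prime
  open PowerSum p p-prime
  open Lacunary p p-prime

  private
    instance
      p≢0 : NonZero p
      p≢0 = prime⇒nonZero p-prime

  ē : Series
  ē n = + e n

  module Step (d M : ℕ) (ind : IndependentUpTo d (pow ē p)) (ind-pS : Independent (suc d) (mul p S) (p^ suc M)) where
    open Lift p p-prime e e-reduces M using (V; Z; V≈e^p; V≉𝟘; bounded-Z; Z≈𝟙; V-frobenius; V-logDer)
    N = p^ suc M
    module 𝕄 = SeriesRing (ℤmod N)
    module Fr = Frobenius p (ℤmod N)

    W : ℕ → Series
    W zero    = V
    W (suc k) = pow (W k) p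

    -- The k-th of these is the p^k-th power of `Z`: raising the functional equation of `V` to a
    -- power multiplies no further factors into it, since σ is still applied only once.
    Zs : ℕ → Series
    Zs zero    = Z
    Zs (suc k) = pow (Zs k) p

    W-frobenius : ∀ k → W (suc k) ≈[ N ] Zs k ⊛ σ (W k)
    W-frobenius zero    = V-frobenius
    W-frobenius (suc k) = 𝕄.≋-trans (𝕄.𝕊.pow-cong p (W-frobenius k)) (𝕄.≋-trans (𝕄.𝕊.pow-distrib-* (Zs k) (σ (W k)) p)
      (𝕄.𝕊R.*-congˡ {x = pow (Zs k) p} (𝕄.≋-sym (Fr.σ-pow (W k) p))))

    bounded-Zs : ∀ k → Bounded (Zs k)
    bounded-Zs zero    = bounded-Z
    bounded-Zs (suc k) = bounded-pow p (bounded-Zs k)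

    Zs≉𝟘 : ∀ k → ¬ Zs k ≈ₚ 𝟘
    Zs≉𝟘 zero    Z≈𝟘 = 𝟙≉ₚ𝟘 (𝔽.≋-trans (𝔽.≋-sym Z≈𝟙) Z≈𝟘)
    Zs≉𝟘 (suc k) = pow-nonzero p (Zs≉𝟘 k)

    lift : ∀ k → FrobeniusLift (W k)
    lift zero    = 𝔽.≋-trans (weaken (p∣p^ M) V-frobenius) (𝔽.≋-trans (𝔽.𝕊R.*-congʳ Z≈𝟙) (𝔽.𝕊R.*-identityˡ (σ V)))
    lift (suc k) = frobeniusLift-pow (lift k)

    ind-W : ∀ k → IndependentUpTo d (W k)
    ind-W zero    n n≤d = independent-≈ (𝔽.≋-sym V≈e^p) (ind n n≤d)
    ind-W (suc k) n n≤d = independent-pow (lift k) (ind-W k n n≤d)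

    -- The modulus stays at `N` all the way up, because the functional equations hold modulo `N`.
    -- Independence of p S enters only at the bottom.
    ascend : ∀ k → Independent (suc d) (W k) N
    ascend zero    = independent-logDer M (lift 0) V≉𝟘 V-logDer (ind-W 0) ind-pS
    ascend (suc k) = independent-σ (Zs k) (bounded-Zs k) (Zs≉𝟘 k) (W-frobenius k) (ascend k)

    -- Each extraction of a p-th root costs one factor p of the modulus. The exponent of the modulus
    -- is one more than the index of `W`, so starting from `W M` modulo p^(M+1) the factors last
    -- exactly until `V` modulo p.
    descend : ∀ j → j ≤ M → Independent (suc d) (W (M ℕ.∸ j)) (p^ suc (M ℕ.∸ j))
    descend zero    j≤M = ascend M
    descend (suc j) j<M = independent-pow⁻¹ (M ℕ.∸ suc j) (lift (M ℕ.∸ suc j)) (ind-W (M ℕ.∸ suc j))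
      (≡.subst (λ k → Independent (suc d) (W k) (p^ suc k)) (ℕP.+-∸-assoc 1 j<M) (descend j (ℕP.<⇒≤ j<M)))

    independent-V : Independent (suc d) V (p^ 1)
    independent-V = ≡.subst (λ k → Independent (suc d) (W k) (p^ suc k)) (ℕP.n∸n≡0 M) (descend M ℕP.≤-refl)

    independent-ēᵖ : Independent (suc d) (pow ē p) (+ p)
    independent-ēᵖ = independent-≈ V≈e^p λ a ba eq → independent-V a ba (weaken (ℤ∣.∣-reflexive (ℤP.*-identityʳ (+ p))) eq)

  independent-step : ∀ d → IndependentUpTo d (pow ē p) → Independent (suc d) (pow ē p) (+ p)
  independent-step d ind = Step.independent-ēᵖ d (proj₁ lacunary) ind (proj₂ lacunary)
    where
    lacunary : ∃ λ M → Independent (suc d) (mul p S) (p^ suc M)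
    lacunary = independent-pS S S≈X+σS (suc d)

  -- Strong induction on the number of coefficients. The lift and the exponent `M` are chosen anew
  -- at each stage; only `pow ē p`, taken modulo p, is common to all of them.
  independent-upTo : ∀ d → IndependentUpTo d (pow ē p)
  independent-upTo d       zero    n≤d       a ba eq j ()
  independent-upTo (suc d) (suc n) (s≤s n≤d) =
    independent-step n (λ m m≤n → independent-upTo d m (ℕP.≤-trans m≤n n≤d))

  independent-ē : ∀ n → Independent n ē (+ p)
  independent-ē n = independent-root (λ m → independent-upTo m m ℕP.≤-refl) n n ℕP.≤-refl

-- Translation of the statement over ℕ into a relation between integer series.

module ℤS = SeriesRing ℤP.+-*-commutativeRing

+sumℕ : ∀ m h → + sumℕ m h ≡ ℤL.∑ m (λ i → + h i)
+sumℕ zero    h = ≡.refl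
+sumℕ (suc m) h = ≡.trans (≡.cong (λ z → z ℤ.+ + h m) (+sumℕ m h)) (≡.sym (ℤL.∑-last m (λ i → + h i)))

+convℕ : ∀ f g n → + convℕ f g n ≡ ((λ i → + f i) ⊛ (λ i → + g i)) n
+convℕ f g n = ≡.trans (+sumℕ (suc n) (λ i → f i ℕ.* g (n ℕ.∸ i)))
  (≡.trans (ℤL.∑-cong (suc n) (λ i _ → ℤP.pos-* (f i) (g (n ℕ.∸ i)))) (≡.sym (ℤS.⊛-as-∑ (λ i → + f i) (λ i → + g i) n)))

+powℕ : ∀ f k n → + powℕ f k n ≡ pow (λ i → + f i) k n
+powℕ f zero    zero    = ≡.refl
+powℕ f zero    (suc n) = ≡.refl
+powℕ f (suc k) n       = ≡.trans (+convℕ f (powℕ f k) n) (ℤS.⊛-cong-≤ n (λ _ _ → ≡.refl) (λ i _ → +powℕ f k i))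

+shiftℕ : ∀ i f n → + shiftℕ i f n ≡ shifts i (λ k → + f k) n
+shiftℕ zero          f n       = ≡.refl
+shiftℕ (suc i)       f zero    = ≡.refl
-- Index 1 needs its own clause, since `_≤ᵇ_` computes through the strict comparison after one
-- successor.
+shiftℕ (suc zero)    f (suc n) = ≡.refl
+shiftℕ (suc (suc i)) f (suc n) = +shiftℕ (suc i) f n

shifts-cong : ∀ i {f g : Series} → (∀ n → f n ≡ g n) → ∀ n → shifts i f n ≡ shifts i g n
shifts-cong i eq n = ℤS.shifts-cong i (pointwise eq) .at n

polynomial : ℕ → (ℕ → ℤ) → Series
polynomial D b = eval D (λ i → const (b i)) X

bounded-polynomial : ∀ D b → Bounded (polynomial D b)
bounded-polynomial zero    b = bounded-𝟘
bounded-polynomial (suc D) b =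
  bounded-⊕ (bounded-const (b 0)) (bounded-⊛ (bounded-shift (bounded-const 1ℤ)) (bounded-polynomial D (b ∘ suc)))

polynomial-coefficient : ∀ D b i → i ℕ.< D → polynomial D b i ≡ b i
polynomial-coefficient (suc D) b zero    i<D       =
  ≡.trans (≡.cong (λ z → b 0 ℤ.+ z) (ℤS.X-⊛ (polynomial D (b ∘ suc)) .at 0)) (ℤP.+-identityʳ (b 0))
polynomial-coefficient (suc D) b (suc i) (s≤s i<D) =
  ≡.trans (≡.cong (λ z → 0ℤ ℤ.+ z) (ℤS.X-⊛ (polynomial D (b ∘ suc)) .at (suc i)))
    (≡.trans (ℤP.+-identityˡ _) (polynomial-coefficient D (b ∘ suc) i i<D))

X^-⊛ : ∀ i g n → (pow X i ⊛ g) n ≡ shifts i g n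
X^-⊛ i g n = go i .at n
  where
  go : ∀ i → ℤS._≋_ (pow X i ⊛ g) (shifts i g)
  go zero    = ℤS.𝕊R.*-identityˡ g
  go (suc i) = ℤS.≋-trans (ℤS.𝕊R.*-assoc X (pow X i) g) (ℤS.≋-trans (ℤS.X-⊛ (pow X i ⊛ g)) (ℤS.shift-cong (go i)))

∑-at : ∀ m (F : ℕ → Series) n → ∑ m F n ≡ ℤL.∑ m (λ i → F i n)
∑-at zero    F n = ≡.refl
∑-at (suc m) F n = ≡.cong (λ z → F 0 n ℤ.+ z) (∑-at m (F ∘ suc) n)

polynomial-⊛ : ∀ D b g n → (polynomial D b ⊛ g) n ≡ ℤL.∑ D (λ i → b i ℤ.* shifts i g n)
polynomial-⊛ D b g n = begin
  (polynomial D b ⊛ g) n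
    ≡⟨ ℤS.⊛-cong (ℤS.𝕊.eval-∑ D (λ i → const (b i)) X) (ℤS.≋-refl {g}) .at n ⟩
  (∑ D (λ i → const (b i) ⊛ pow X i) ⊛ g) n
    ≡⟨ ℤS.𝕊.∑-*ʳ D g (λ i → const (b i) ⊛ pow X i) .at n ⟩
  ∑ D (λ i → const (b i) ⊛ pow X i ⊛ g) n
    ≡⟨ ∑-at D (λ i → const (b i) ⊛ pow X i ⊛ g) n ⟩
  ℤL.∑ D (λ i → (const (b i) ⊛ pow X i ⊛ g) n)
    ≡⟨ ℤL.∑-cong D (λ i _ → ≡.trans (ℤS.⊛-assoc (const (b i)) (pow X i) g n)
         (≡.trans (ℤS.const-⊛ (b i) (pow X i ⊛ g) n) (≡.cong (b i ℤ.*_) (X^-⊛ i g n)))) ⟩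
  ℤL.∑ D (λ i → b i ℤ.* shifts i g n) ∎
  where open ≡.≡-Reasoning

+evalPolyCoeff : ∀ dx dy c f n →
  + evalPolyCoeff dx dy c f n ≡ eval (suc dy) (λ j → polynomial (suc dx) (λ i → + c i j)) (λ k → + f k) n
+evalPolyCoeff dx dy c f n = begin
  + evalPolyCoeff dx dy c f n
    ≡⟨ +sumℕ (suc dx) (λ i → sumℕ (suc dy) (λ j → c i j ℕ.* shiftℕ i (powℕ f j) n)) ⟩
  ℤL.∑ (suc dx) (λ i → + sumℕ (suc dy) (λ j → c i j ℕ.* shiftℕ i (powℕ f j) n))
    ≡⟨ ℤL.∑-cong (suc dx) (λ i _ → ≡.trans (+sumℕ (suc dy) (λ j → c i j ℕ.* shiftℕ i (powℕ f j) n))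
         (ℤL.∑-cong (suc dy) (λ j _ → term i j))) ⟩
  ℤL.∑ (suc dx) (λ i → ℤL.∑ (suc dy) (λ j → + c i j ℤ.* shifts i (pow f̄ j) n))
    ≡⟨ ℤL.∑-comm (suc dx) (suc dy) (λ i j → + c i j ℤ.* shifts i (pow f̄ j) n) ⟩
  ℤL.∑ (suc dy) (λ j → ℤL.∑ (suc dx) (λ i → + c i j ℤ.* shifts i (pow f̄ j) n))
    ≡⟨ ℤL.∑-cong (suc dy) (λ j _ → polynomial-⊛ (suc dx) (λ i → + c i j) (pow f̄ j) n) ⟨
  ℤL.∑ (suc dy) (λ j → (a j ⊛ pow f̄ j) n)
    ≡⟨ ∑-at (suc dy) (λ j → a j ⊛ pow f̄ j) n ⟨
  ∑ (suc dy) (λ j → a j ⊛ pow f̄ j) n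
    ≡⟨ ℤS.𝕊.eval-∑ (suc dy) a f̄ .at n ⟨
  eval (suc dy) a f̄ n ∎
  where
  open ≡.≡-Reasoning
  f̄ : Series
  f̄ k = + f k
  a : ℕ → Series
  a j = polynomial (suc dx) (λ i → + c i j)
  term : ∀ i j → + (c i j ℕ.* shiftℕ i (powℕ f j) n) ≡ + c i j ℤ.* shifts i (pow f̄ j) n
  term i j = ≡.trans (ℤP.pos-* (c i j) (shiftℕ i (powℕ f j) n))
    (≡.cong (+ c i j ℤ.*_) (≡.trans (+shiftℕ i (powℕ f j) n) (shifts-cong i (+powℕ f j) n)))

theorem1p1 : (p : ℕ) → Prime p → (e : ℕ → ℕ) → IsReductionOfAH p e →
    (dx dy : ℕ) → (c : ℕ → ℕ → ℕ) →
    Σ ℕ (λ i → Σ ℕ (λ j → i ≤ dx × j ≤ dy × ¬ (p ∣ c i j))) →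
    ¬ ((n : ℕ) → p ∣ evalPolyCoeff dx dy c e n)
theorem1p1 p p-prime e e-reduces dx dy c (i , j , i≤dx , j≤dy , p∤cij) relation =
  p∤cij (ℤ∣.∣⇒∣ᵤ (≡.subst (+ p ∣ℤ_) (polynomial-coefficient (suc dx) (λ i → + c i j) i (s≤s i≤dx)) (≈0⇒∣ (aⱼ≈0 .at i))))
  where
  a : ℕ → Series
  a j = polynomial (suc dx) (λ i → + c i j)
  aⱼ≈0 : a j ≈[ + p ] 𝟘
  aⱼ≈0 = Transcendence.independent-ē p p-prime e e-reduces (suc dy) a (λ j → bounded-polynomial (suc dx) (λ i → + c i j))
    (pointwise λ n → ∣⇒≈0 (≡.subst (+ p ∣ℤ_) (+evalPolyCoeff dx dy c e n) (ℤ∣.∣ᵤ⇒∣ (relation n)))) j (s≤s j≤dy)
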